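{- Let $p\geq 5$ be a prime, $k\geq 1$ an integer and $t\in\{1,\dots,p-1\}$. Let \[S=\{(A,B)\in(\mathbb{F}_{p^k})^2 : 4A^3+27B^2\neq 0\},\] and let $S_t\subset S$ be the set of pairs $(A,B)$ for which the trace $T$ of the $p^k$-th power Frobenius of the elliptic curve $y^2=x^3+Ax+B$ over $\mathbb{F}_{p^k}$ (i.e. $T=p^k+1-\#E(\mathbb{F}_{p^k})$) satisfies $T\equiv t\bmod p$. Then $\#S=p^{2k}-p^k$ and \[\Big|\#S_t-\frac{\#S}{p-1}\Big|\leq 3p^{\frac{3k}{2}+1}.\] -}

module Defs where

open import Data.Nat as ℕ using (ℕ; zero; suc)
import Data.Nat.Divisibility as ℕD
open import Data.Integer as ℤ using (ℤ; +_; ∣_∣)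
import Data.Integer.Divisibility as ℤD
open import Data.List using (List; length; filter; cartesianProduct)
open import Data.List.Relation.Unary.Unique.Propositional using (Unique)
open import Data.List.Membership.Propositional using (_∈_)
open import Data.Product using (_×_; _,_; ∃)
open import Relation.Binary.PropositionalEquality using (_≡_; _≢_)
open import Relation.Binary.Definitions using (DecidableEquality)
open import Relation.Nullary using (Dec; ¬_; ¬?)

open import Algebra.Core using (Op₁; Op₂)
import Algebra.Structures as AS

record FiniteField : Set₁ where
  infixl 6 _+_
  infixl 7 _*_
  field
    Carrier : Set
    _+_ _*_ : Op₂ Carrier
    -_ : Op₁ Carrier
    0# 1# : Carrier
    isCommutativeRing : AS.IsCommutativeRing _≡_ _+_ _*_ -_ 0# 1#
    _≟_ : DecidableEquality Carrier
    0≢1 : 0# ≢ 1#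
    inverse : ∀ x → x ≢ 0# → ∃ λ y → x * y ≡ 1#
    elements : List Carrier
    elements-unique : Unique elements
    elements-complete : ∀ x → x ∈ elements

module _ (F : FiniteField) where
  open FiniteField F

  order : ℕ
  order = length elements

  fromℕ : ℕ → Carrier
  fromℕ zero = 0#
  fromℕ (suc n) = 1# + fromℕ n

  disc : Carrier → Carrier → Carrier
  disc A B = fromℕ 4 * (A * A * A) + fromℕ 27 * (B * B)

  affineCount : Carrier → Carrier → ℕ
  affineCount A B =
    length (filter (λ { (x , y) → (y * y) ≟ (x * x * x + A * x + B) })
                   (cartesianProduct elements elements))

  -- #E(F) : affine points plus the point at infinity
  #E : Carrier → Carrier → ℕ
  #E A B = suc (affineCount A B)

  trace : Carrier → Carrier → ℤ
  trace A B = + (suc order) ℤ.- + (#E A B)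

  nonsingular? : (AB : Carrier × Carrier) → Dec (¬ (disc (Data.Product.proj₁ AB) (Data.Product.proj₂ AB) ≡ 0#))
  nonsingular? (A , B) = ¬? (disc A B ≟ 0#)

  S : List (Carrier × Carrier)
  S = filter nonsingular? (cartesianProduct elements elements)

  traceCong? : (p t : ℕ) → (AB : Carrier × Carrier) →
               Dec ((+ p) ℤD.∣ (trace (Data.Product.proj₁ AB) (Data.Product.proj₂ AB) ℤ.- + t))
  traceCong? p t (A , B) = p ℕD.∣? ∣ trace A B ℤ.- + t ∣

  S[_,_] : ℕ → ℕ → List (Carrier × Carrier)
  S[ p , t ] = filter (traceCong? p t) S

  #S : ℕ
  #S = length S

  #S[_,_] : ℕ → ℕ → ℕ
  #S[ p , t ] = length S[ p , t ]

-- Let q = p^k, n = (p − 1)/2, c = (q − 1)/(p − 1), and let H(A, B) be the coefficient of x^(p−1) in (x³ + A x + B)^n.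
-- Counting points modulo p and applying the Cartier operator k times shows that the trace is congruent to H(A, B)^c, the
-- norm of H(A, B) to the prime field. For p ≥ 7 and fixed A ≠ 0, H(A, B) is a polynomial f in B of positive degree d ≤ n/3,
-- and it is separable because it satisfies the Picard–Fuchs equation; for p = 5 it is 2A.
-- Stepanov's method estimates the number of x with f(x)^c = t: linear algebra provides a nonzero polynomial
-- Σ f^(ic) (x − x^q)^j f^(e_j) h_ij of small degree vanishing to high order at all x where f(x)^c takes prescribed values.
-- Prescribing t gives an upper bound, prescribing all the other nonzero values a lower bound; both are within 2p√q + p of c.
-- It remains to sum over the columns A = const (or B = const) and to discard the q singular pairs.
module Submission where

open import Algebra.Bundles using (CommutativeRing; RawRing; CommutativeMonoid)
import Algebra.Properties.AbelianGroup
import Algebra.Properties.CommutativeSemiring.Binomial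
import Algebra.Properties.CommutativeSemiring.Exp
import Algebra.Properties.Monoid.Sum
import Algebra.Properties.Ring
import Algebra.Properties.Semiring.Mult
import Algebra.Solver.Ring
open import Algebra.Solver.Ring.AlmostCommutativeRing using (fromCommutativeRing; _-Raw-AlmostCommutative⟶_; module _-Raw-AlmostCommutative⟶_)
open import Data.Empty using (⊥; ⊥-elim)
open import Data.Fin as Fin using (Fin; splitAt; _↑ˡ_; _↑ʳ_; toℕ)
import Data.Fin.Properties as FinP
open import Data.Integer as ℤ using (+_; ℤ; -[1+_])
import Data.Integer.Divisibility as ℤD
import Data.Integer.Properties as ℤP
open import Data.List as List using (List; []; _∷_; length; map; filter; _++_; cartesianProduct)
open import Data.List.Membership.Propositional using (_∈_; find)
open import Data.List.Membership.Propositional.Properties using (∈-lookup; ∈-filter⁺; ∈-filter⁻; ∈-map⁺; ∈-map⁻; ∈-cartesianProduct⁺)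
open import Data.List.Membership.Propositional.Properties.WithK using (unique∧set⇒bag)
import Data.List.Properties as ListP
open import Data.List.Relation.Binary.BagAndSetEquality using (∼bag⇒↭)
open import Data.List.Relation.Binary.Permutation.Propositional as Perm using (_↭_)
open import Data.List.Relation.Binary.Permutation.Propositional.Properties using (↭-length)
open import Data.List.Relation.Unary.All as All using (All)
open import Data.List.Relation.Unary.All.Properties using (¬All⇒Any¬)
open import Data.List.Relation.Unary.AllPairs using ([]; _∷_)
open import Data.List.Relation.Unary.Any as Any using (here; there)
open import Data.List.Relation.Unary.Any.Properties using (lookup-index)
open import Data.List.Relation.Unary.Unique.Propositional using (Unique)
import Data.List.Relation.Unary.Unique.Propositional.Properties as UniqueP
open import Data.Maybe using (Maybe; just; nothing)
open import Data.Nat as ℕ using (ℕ; zero; suc; _≤_; _<_; z≤n; s≤s; _∸_; _!)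
open import Data.Nat.Combinatorics using (_C_; nCk≡n!/k![n-k]!; k![n∸k]!∣n!; nCn≡1)
open import Data.Nat.Coprimality using (prime⇒coprime; coprime-Bézout)
open import Data.Nat.DivMod as DivMod using (m/n*n≡m)
open import Data.Nat.Divisibility as ℕD using () renaming (_∣_ to _∣ⁿ_)
open import Data.Nat.GCD using (module Bézout)
open import Data.Nat.Induction using (<-rec)
open import Data.Nat.Primality using (Prime; euclidsLemma; prime⇒nonTrivial; prime⇒nonZero; prime⇒irreducible)
open import Data.Nat.Properties as ℕP using (_!*_!≢0)
import Data.Nat.Tactic.RingSolver as ℕSolver
open import Data.Product using (∃; ∃₂; _×_; _,_; proj₁; proj₂)
open import Data.Sum using (_⊎_; inj₁; inj₂; [_,_]′; reduce; swap)
open import Data.Unit using (⊤; tt)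
open import Function using (_∘_; id; mk⇔)
open import Level using (0ℓ)
open import Relation.Binary.Definitions using (tri<; tri≈; tri>)
open import Relation.Binary.PropositionalEquality as ≡ using (_≡_; _≢_)
open import Relation.Nullary using (¬_; Dec; yes; no; ¬?)
open import Relation.Nullary.Decidable using (_×-dec_)
open import Relation.Unary using (Pred; Decidable)

-- Vanishing orders are measured without derivatives, which would lose information in characteristic
-- p: at a point `x₀` with `f(x₀) ≠ 0` one substitutes `x₀ + f(x₀) ε` and reads off powers of `ε`.
-- The scaling keeps the conditions polynomial in `x₀` of small degree: `f` becomes `f(x₀)` times a
-- unit, `f(x₀)^c` is prescribed, and `x − x^q` becomes `f(x₀) ε` up to `ε^q`. What is left of
-- `f(x₀)` depends on the exponents `e_j`. Taking `e_j = 0` suffices against one value; against p -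
-- 2 values `e_j = l − j` makes the powers of `f(x₀)` equal for all j and frees room for more
-- unknowns. That the auxiliary polynomial is not zero is the delicate point. It follows from a
-- Taylor expansion modulo `f`, which shows that `f` divides certain q-th powers; separability of
-- `f` is what permits taking the root. The order of vanishing is `l = (p − 1) r` with `r` the
-- integer part of √q / (p - 1). As 4d ≤ p - 1, the degree d disappears from the error 2p√q. The
-- parameters of the lower bound fit only for k ≥ 4; for smaller k the error exceeds the expected
-- number `c` itself.

total : (ℕ → ℕ) → ℕ → ℕ
total K zero = 0
total K (suc J) = K 0 ℕ.+ total (K ∘ suc) J

-- Inequalities between the parameters of Stepanov's method

module Arithmetic where
  open import Data.Nat using (_+_; _*_)
  open ℕP.≤-Reasoning

  parity : ∀ n → ∃ λ j → n ≡ j + j ⊎ n ≡ suc (j + j)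
  parity zero = 0 , inj₁ ≡.refl
  parity (suc n) with parity n
  ... | j , inj₁ e = j , inj₂ (≡.cong suc e)
  ... | j , inj₂ e = suc j , inj₁ (≡.trans (≡.cong suc e) (≡.cong suc (≡.sym (ℕP.+-suc j j))))

  square-root : ∀ q → ∃ λ s → s * s ≤ q × q < suc s * suc s
  square-root zero = 0 , z≤n , s≤s z≤n
  square-root (suc q) with square-root q
  ... | s , s²≤q , q< with suc q ℕP.<? suc s * suc s
  ...   | yes lt = s , ℕP.m≤n⇒m≤1+n s²≤q , lt
  ...   | no nlt = suc s , ℕP.≮⇒≥ nlt , ℕP.<-≤-trans (s≤s q<) (ℕP.≤-trans (ℕP.m≤m+n _ (suc s + suc s)) (ℕP.≤-reflexive lemma))
    where
    lemma : suc (suc s * suc s) + (suc s + suc s) ≡ suc (suc s) * suc (suc s)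
    lemma = ℕSolver.solve (s ∷ [])

  square-cancel : ∀ {a s} → a * a < suc s * suc s → a ≤ s
  square-cancel {a} {s} lt with a ℕP.≤? s
  ... | yes a≤s = a≤s
  ... | no a≰s = ⊥-elim (ℕP.<⇒≱ lt (ℕP.*-mono-≤ (ℕP.≰⇒> a≰s) (ℕP.≰⇒> a≰s)))

  total-cong : ∀ {K L} J → (∀ j → K j ≡ L j) → total K J ≡ total L J
  total-cong zero e = ≡.refl
  total-cong (suc J) e = ≡.cong₂ _+_ (e 0) (total-cong J (e ∘ suc))

  total-const : ∀ a J → total (λ _ → a) J ≡ J * a
  total-const a zero = ≡.refl
  total-const a (suc J) = ≡.cong (λ z → a + z) (total-const a J)

  -- The arithmetic series, doubled and shifted by `d * l` so that neither division nor subtraction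
  -- occurs.
  total-linear : ∀ κ d l → 2 * total (λ s → κ + s * d) l + d * l ≡ 2 * (l * κ) + d * (l * l)
  total-linear κ d zero = ≡.refl
  total-linear κ d (suc l) = ≡.trans (≡.cong (λ T → 2 * (κ + 0 + T) + d * suc l) (total-cong {λ j → κ + (d + j * d)} {λ j → κ + d + j * d} l λ j → ≡.sym (ℕP.+-assoc κ d (j * d))))
    (≡.trans (lemma₁ (total (λ s → κ + d + s * d) l)) (≡.trans (≡.cong (λ x → 2 * κ + d + x) (total-linear (κ + d) d l)) lemma₂))
    where
    lemma₁ : ∀ T → 2 * (κ + 0 + T) + d * suc l ≡ 2 * κ + d + (2 * T + d * l)
    lemma₁ T = ℕSolver.solve (T ∷ κ ∷ d ∷ l ∷ [])
    lemma₂ : 2 * κ + d + (2 * (l * (κ + d)) + d * (l * l)) ≡ 2 * (suc l * κ) + d * (suc l * suc l)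
    lemma₂ = ℕSolver.solve (κ ∷ d ∷ l ∷ [])

  -- Here `m = p - 1`, `q = 1 + m c`, `s` is the integer part of the square root of `q`, `r` that of
  -- `s / m`, and `d = 1 + δ` is the degree of `f`. The order of vanishing `l` is taken as a
  -- multiple of `m`, so that `m` cancels against the degree bound.
  module _ (m′ c s r δ : ℕ) (4≤m : 4 ≤ suc m′) (4d≤m : 4 * suc δ ≤ suc m′)
    (s²≤q : s * s ≤ suc (suc m′ * c)) (q<s² : suc (suc m′ * c) < suc s * suc s)
    (mr≤s : suc m′ * r ≤ s) (s<mr+m : s < suc m′ * suc r) (1≤r : 1 ≤ r) where
    private
      m p d l : ℕ
      m = suc m′
      p = suc m
      d = suc δ
      l = m * r

    -- The error term: divided by `r`, the excess `c (2δ + 1)` over the main term costs at most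
    -- `2 p s`. The degree of `f` disappears here, because `4 d ≤ m` gives `2 (2δ + 1) ≤ p`.
    key : c * (2 * δ + 1) ≤ 2 * p * s * r
    key = ℕP.*-cancelˡ-≤ (2 * m) (begin
      2 * m * (c * (2 * δ + 1)) ≡⟨ lemma₁ m ⟩
      2 * (2 * δ + 1) * (m * c) ≤⟨ ℕP.*-mono-≤ 2[2δ+1]≤p mc≤ ⟩
      p * (s * s + 2 * s) ≤⟨ ℕP.*-monoʳ-≤ p (ℕP.+-monoˡ-≤ (2 * s) (ℕP.m≤n*m (s * s) 2)) ⟩
      p * (2 * (s * s) + 2 * s) ≡⟨ lemma₂ p ⟩
      2 * p * s * suc s ≤⟨ ℕP.*-monoʳ-≤ (2 * p * s) s<2mr ⟩
      2 * p * s * (2 * (m * r)) ≡⟨ lemma₃ m p ⟩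
      2 * m * (2 * p * s * r) ∎)
      where
      lemma₁ : ∀ m → 2 * m * (c * (2 * δ + 1)) ≡ 2 * (2 * δ + 1) * (m * c)
      lemma₁ m = ℕSolver.solve (m ∷ c ∷ δ ∷ [])
      lemma₂ : ∀ p → p * (2 * (s * s) + 2 * s) ≡ 2 * p * s * suc s
      lemma₂ p = ℕSolver.solve (p ∷ s ∷ [])
      lemma₃ : ∀ m p → 2 * p * s * (2 * (m * r)) ≡ 2 * m * (2 * p * s * r)
      lemma₃ m p = ℕSolver.solve (m ∷ p ∷ s ∷ r ∷ [])
      lemma₄ : 2 * (2 * δ + 1) + 2 ≡ 4 * suc δ
      lemma₄ = ℕSolver.solve (δ ∷ [])
      2[2δ+1]≤p : 2 * (2 * δ + 1) ≤ p
      2[2δ+1]≤p = ℕP.≤-trans (ℕP.≤-trans (ℕP.m≤m+n _ 2) (ℕP.≤-reflexive lemma₄)) (ℕP.≤-trans 4d≤m (ℕP.n≤1+n m))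
      lemma₅ : suc s * suc s ≡ suc (s * s + 2 * s)
      lemma₅ = ℕSolver.solve (s ∷ [])
      mc≤ : m * c ≤ s * s + 2 * s
      mc≤ = ℕP.≤-trans (ℕP.n≤1+n _) (ℕ.s≤s⁻¹ (ℕP.<-≤-trans q<s² (ℕP.≤-reflexive lemma₅)))
      s<2mr : suc s ≤ 2 * (m * r)
      s<2mr = begin
        suc s ≤⟨ s<mr+m ⟩
        m * suc r ≡⟨ ℕP.*-suc m r ⟩
        m + m * r ≤⟨ ℕP.+-monoˡ-≤ (m * r) (ℕP.≤-trans (ℕP.≤-reflexive (≡.sym (ℕP.*-identityʳ m))) (ℕP.*-monoʳ-≤ m 1≤r)) ⟩
        m * r + m * r ≡⟨ ≡.cong (λ z → m * r + z) (≡.sym (ℕP.+-identityʳ (m * r))) ⟩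
        2 * (m * r) ∎

    -- This is `(m r)² ≤ s² ≤ 1 + m c` divided by `m`; as `m > 1`, the summand 1 is too small to
    -- matter for integers.
    mr²≤c : m * (r * r) ≤ c
    mr²≤c = ℕP.≮⇒≥ λ c<mr² → ℕP.<⇒≱ {1} {m} (ℕP.≤-trans (s≤s (s≤s z≤n)) 4≤m) (ℕP.+-cancelʳ-≤ (m * c) m 1 (begin
      m + m * c ≡⟨ ℕP.*-suc m c ⟨
      m * suc c ≤⟨ ℕP.*-monoʳ-≤ m c<mr² ⟩
      m * (m * (r * r)) ≡⟨ lemma m ⟩
      (m * r) * (m * r) ≤⟨ ℕP.*-mono-≤ mr≤s mr≤s ⟩
      s * s ≤⟨ s²≤q ⟩
      1 + m * c ∎))
      where
      lemma : ∀ m → m * (m * (r * r)) ≡ (m * r) * (m * r)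
      lemma m = ℕSolver.solve (m ∷ r ∷ [])

    -- The hypothesis is Stepanov's inequality `N l < c (J - 1 + d) m` for `J = r + d`, with `m`
    -- cancelled.
    upper-bound : ∀ {N} → N * r < c * (r + (2 * δ + 1)) → N ≤ c + 2 * p * s
    upper-bound {N} lt = ℕP.≮⇒≥ λ big → ℕP.<⇒≱ lt (begin
      c * (r + (2 * δ + 1)) ≡⟨ ℕP.*-distribˡ-+ c r (2 * δ + 1) ⟩
      c * r + c * (2 * δ + 1) ≤⟨ ℕP.+-monoʳ-≤ (c * r) key ⟩
      c * r + 2 * p * s * r ≡⟨ ℕP.*-distribʳ-+ r c (2 * p * s) ⟨
      (c + 2 * p * s) * r ≤⟨ ℕP.*-monoˡ-≤ r (ℕP.<⇒≤ big) ⟩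
      N * r ∎)

    -- `N′` counts the points where `f^c` takes one of the other nonzero values. Together with the
    -- at most `d` zeros of `f` and the `N` points for `t` they fill the field, so an upper bound
    -- for `N′` is a lower bound for `N`; the summand `p` absorbs the zeros.
    lower-bound : ∀ {N N′} → N′ * r < c * (m′ * r + (2 * δ + 1)) → suc (m * c) ≤ d + N + N′ → c ≤ N + 2 * p * s + p
    lower-bound {N} {N′} lt q≤ = ℕP.≮⇒≥ λ big → ℕP.<⇒≱ lt (begin
      c * (m′ * r + (2 * δ + 1)) ≡⟨ lemma₁ ⟩
      m′ * c * r + c * (2 * δ + 1) ≤⟨ ℕP.+-monoʳ-≤ (m′ * c * r) key ⟩
      m′ * c * r + 2 * p * s * r ≡⟨ ℕP.*-distribʳ-+ r (m′ * c) (2 * p * s) ⟨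
      (m′ * c + 2 * p * s) * r ≤⟨ ℕP.*-monoˡ-≤ r (ℕP.+-cancelˡ-≤ (d + N) _ N′ (begin
        d + N + (m′ * c + 2 * p * s) ≤⟨ ℕP.+-monoˡ-≤ _ (ℕP.+-monoˡ-≤ N d≤p) ⟩
        p + N + (m′ * c + 2 * p * s) ≡⟨ lemma₂ p (2 * p * s) ⟩
        (N + 2 * p * s + p) + m′ * c ≤⟨ ℕP.+-monoˡ-≤ (m′ * c) (ℕP.<⇒≤ big) ⟩
        m * c ≤⟨ ℕP.n≤1+n _ ⟩
        suc (m * c) ≤⟨ q≤ ⟩
        d + N + N′ ∎)) ⟩
      N′ * r ∎)
      where
      lemma₁ : c * (m′ * r + (2 * δ + 1)) ≡ m′ * c * r + c * (2 * δ + 1)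
      lemma₁ = ℕSolver.solve (c ∷ m′ ∷ r ∷ δ ∷ [])
      lemma₂ : ∀ p y → p + N + (m′ * c + y) ≡ (N + y + p) + m′ * c
      lemma₂ p y = ℕSolver.solve (p ∷ N ∷ m′ ∷ c ∷ y ∷ [])
      d≤p : d ≤ p
      d≤p = ℕP.≤-trans (ℕP.m≤n*m d 4) (ℕP.≤-trans 4d≤m (ℕP.n≤1+n m))

    -- K + (J − 1) q + (m − 1) c d ≤ c m (J + d − 1) when K + J = c + 1.
    degree-bound : ∀ {K J-1} → K + J-1 ≡ c → K + J-1 * suc (m * c) + m′ * (c * d) ≤ c * (J-1 + d) * m
    degree-bound {K} {J-1} e = begin
      K + J-1 * suc (m * c) + m′ * (c * d) ≡⟨ lemma₁ (m * c) ⟩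
      (K + J-1) + J-1 * (m * c) + m′ * (c * d) ≡⟨ ≡.cong (λ x → x + J-1 * (m * c) + m′ * (c * d)) e ⟩
      c + J-1 * (m * c) + m′ * (c * d) ≤⟨ ℕP.+-monoˡ-≤ _ (ℕP.+-monoˡ-≤ _ (ℕP.m≤m*n c d)) ⟩
      c * d + J-1 * (m * c) + m′ * (c * d) ≡⟨ lemma₂ d ⟩
      c * (J-1 + d) * m ∎
      where
      lemma₁ : ∀ x → K + J-1 * suc x + m′ * (c * d) ≡ (K + J-1) + J-1 * x + m′ * (c * d)
      lemma₁ x = ℕSolver.solve (K ∷ J-1 ∷ x ∷ m′ ∷ c ∷ δ ∷ [])
      lemma₂ : ∀ d → c * d + J-1 * (suc m′ * c) + m′ * (c * d) ≡ c * (J-1 + d) * suc m′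
      lemma₂ d = ℕSolver.solve (c ∷ d ∷ J-1 ∷ m′ ∷ [])

    r+2d≤c : r + 2 * d ≤ c
    r+2d≤c = ℕP.≤-trans (ℕP.*-cancelˡ-≤ 2 (begin
      2 * (r + 2 * d) ≡⟨ lemma₁ d ⟩
      2 * r + 4 * d ≤⟨ ℕP.+-mono-≤ (ℕP.*-monoˡ-≤ r (ℕP.≤-trans (s≤s (s≤s z≤n)) 4≤m)) 4d≤m ⟩
      m * r + m ≤⟨ ℕP.+-mono-≤ (ℕP.*-monoʳ-≤ m r≤r²) (ℕP.≤-trans (ℕP.≤-reflexive (≡.sym (ℕP.*-identityʳ m))) (ℕP.*-monoʳ-≤ m (ℕP.*-mono-≤ 1≤r 1≤r))) ⟩
      m * (r * r) + m * (r * r) ≡⟨ ≡.cong (λ z → m * (r * r) + z) (≡.sym (ℕP.+-identityʳ _)) ⟩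
      2 * (m * (r * r)) ∎)) mr²≤c
      where
      lemma₁ : ∀ d → 2 * (r + 2 * d) ≡ 2 * r + 4 * d
      lemma₁ d = ℕSolver.solve (r ∷ d ∷ [])
      r≤r² : r ≤ r * r
      r≤r² = ℕP.≤-trans (ℕP.≤-reflexive (≡.sym (ℕP.*-identityʳ r))) (ℕP.*-monoʳ-≤ r 1≤r)

    -- Fewer conditions (left) than unknown coefficients (right). Twice the series is `2 l κ` plus
    -- about `d l²`, so the claim reduces to `l² < m (2κ + r)`, which holds because `m r² ≤ c` while
    -- `κ` is close to `c`.
    upper-count : ∀ {κ} → κ + (r + d) ≡ suc c → total (λ s → κ + s * d) l < m * ((r + d) * κ)
    upper-count {κ} e = ℕP.*-cancelˡ-< 2 _ _ (ℕP.+-cancelʳ-< (d * l) _ _ (begin-strict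
      2 * total (λ s → κ + s * d) l + d * l ≡⟨ total-linear κ d l ⟩
      2 * (l * κ) + d * (l * l) <⟨ ℕP.+-monoʳ-< (2 * (l * κ)) (ℕP.*-monoʳ-< d l²<) ⟩
      2 * (l * κ) + d * (m * (2 * κ + r)) ≡⟨ lemma₁ m d ⟩
      2 * (m * ((r + d) * κ)) + d * l ∎))
      where
      lemma₁ : ∀ m d → 2 * (m * r * κ) + d * (m * (2 * κ + r)) ≡ 2 * (m * ((r + d) * κ)) + d * (m * r)
      lemma₁ m d = ℕSolver.solve (m ∷ d ∷ r ∷ κ ∷ [])
      lemma₂ : ∀ m → m * r * (m * r) ≡ m * (m * (r * r))
      lemma₂ m = ℕSolver.solve (m ∷ r ∷ [])
      lemma₃ : ∀ d → 2 * (κ + (r + d)) ≡ 2 * κ + r + (r + 2 * d)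
      lemma₃ d = ℕSolver.solve (κ ∷ r ∷ d ∷ [])
      l²< : l * l < m * (2 * κ + r)
      l²< = ≡.subst (_< m * (2 * κ + r)) (≡.sym (lemma₂ m)) (ℕP.*-monoʳ-< m (ℕP.+-cancelʳ-< (r + 2 * d) _ _ (begin-strict
        m * (r * r) + (r + 2 * d) ≤⟨ ℕP.+-mono-≤ mr²≤c r+2d≤c ⟩
        c + c <⟨ ℕP.+-mono-< (ℕP.n<1+n c) (ℕP.n<1+n c) ⟩
        suc c + suc c ≡⟨ ≡.cong (λ z → suc c + z) (≡.sym (ℕP.+-identityʳ (suc c))) ⟩
        2 * suc c ≡⟨ ≡.cong (2 *_) (≡.sym e) ⟩
        2 * (κ + (r + d)) ≡⟨ lemma₃ d ⟩
        2 * κ + r + (r + 2 * d) ∎)))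

    module _ (p²≤s : p * p ≤ s) where
      d≤r : d ≤ r
      d≤r = ℕP.≤-trans (ℕP.≤-trans (ℕP.m≤n*m d 4) (ℕP.≤-trans 4d≤m (ℕP.n≤1+n m))) (ℕP.≮⇒≥ λ r<p → ℕP.<⇒≱ s<mr+m (begin
        m * suc r ≤⟨ ℕP.*-mono-≤ (ℕP.n≤1+n m) r<p ⟩
        p * p ≤⟨ p²≤s ⟩
        s ∎))

      ml≤c : m * l ≤ c
      ml≤c = ℕP.≤-trans (ℕP.*-monoʳ-≤ m mr≤s) (ℕP.*-cancelˡ-≤ m (ℕP.+-cancelʳ-≤ 1 _ _ (begin
        m * (m * s) + 1 ≤⟨ ℕP.+-monoʳ-≤ _ 1≤s ⟩
        m * (m * s) + s ≡⟨ lemma m ⟩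
        (m * m + 1) * s ≤⟨ ℕP.*-monoˡ-≤ s (ℕP.≤-trans (ℕP.≤-trans (ℕP.m≤m+n _ (2 * m)) (ℕP.≤-reflexive (lemma₂ m))) p²≤s) ⟩
        s * s ≤⟨ s²≤q ⟩
        suc (m * c) ≡⟨ ℕP.+-comm 1 (m * c) ⟩
        m * c + 1 ∎)))
        where
        lemma : ∀ m → m * (m * s) + s ≡ (m * m + 1) * s
        lemma m = ℕSolver.solve (m ∷ s ∷ [])
        lemma₂ : ∀ m → m * m + 1 + 2 * m ≡ suc m * suc m
        lemma₂ m = ℕSolver.solve (m ∷ [])
        1≤s : 1 ≤ s
        1≤s = ℕP.≤-trans (s≤s z≤n) p²≤s

      -- There are about `m J κ` unknowns against `m′ l κ` conditions, so `J` has to exceed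
      -- `m′ * r`; the extra `d` provides the margin.
      J = m′ * r + d

      J≤l : J ≤ l
      J≤l = ℕP.≤-trans (ℕP.+-monoʳ-≤ (m′ * r) d≤r) (ℕP.≤-reflexive (ℕP.+-comm (m′ * r) r))

      2[dl+J]≤c : 2 * (d * l + J) ≤ c
      2[dl+J]≤c = begin
        2 * (d * l + J) ≤⟨ ℕP.*-monoʳ-≤ 2 (ℕP.+-monoʳ-≤ (d * l) J≤l) ⟩
        2 * (d * l + l) ≡⟨ lemma d l ⟩
        (2 * d + 2) * l ≤⟨ ℕP.*-monoˡ-≤ l (ℕP.*-cancelˡ-≤ 2 (begin
          2 * (2 * d + 2) ≡⟨ lemma₂ d ⟩
          4 * d + 4 ≤⟨ ℕP.+-mono-≤ 4d≤m 4≤m ⟩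
          m + m ≡⟨ ≡.cong (λ z → m + z) (≡.sym (ℕP.+-identityʳ m)) ⟩
          2 * m ∎)) ⟩
        m * l ≤⟨ ml≤c ⟩
        c ∎
        where
        lemma : ∀ d l → 2 * (d * l + l) ≡ (2 * d + 2) * l
        lemma d l = ℕSolver.solve (d ∷ l ∷ [])
        lemma₂ : ∀ d → 2 * (2 * d + 2) ≡ 4 * d + 4
        lemma₂ d = ℕSolver.solve (d ∷ [])

      -- Once the parts common to both series are removed, `gap` remains. There `2 κ > c` outweighs
      -- `m′ r² ≤ c`; this is where `2[dl+J]≤c` keeps `κ` above half of `c`.
      lower-count : ∀ {κ} → κ + (d * l + J) ≡ suc c → m′ * total (λ s → κ + s * d) l < m * total (λ j → κ + j * d) J
      lower-count {κ} e = ℕP.*-cancelˡ-< 2 _ _ (ℕP.+-cancelʳ-< (m′ * (d * l) + m * (d * J)) _ _ (begin-strict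
        2 * (m′ * TL) + (m′ * (d * l) + m * (d * J)) ≡⟨ lemma₁ m d J TL (d * l) ⟩
        m′ * (2 * TL + d * l) + d * (m * J) ≡⟨ ≡.cong (λ x → m′ * x + d * (m * J)) (total-linear κ d l) ⟩
        m′ * (2 * (l * κ) + d * (l * l)) + d * (m * J) ≡⟨ lemma₂ d ⟩
        common + d * m * (m′ * (r * r) + d) <⟨ ℕP.+-monoʳ-< common (ℕP.*-monoʳ-< (d * m) {m′ * (r * r) + d} gap) ⟩
        common + d * m * (2 * κ + (2 * (m′ * r * d) + d * d)) ≡⟨ lemma₃ d ⟩
        m * (2 * (J * κ) + d * (J * J)) + m′ * (d * l) ≡⟨ ≡.cong (λ x → m * x + m′ * (d * l)) (≡.sym (total-linear κ d J)) ⟩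
        m * (2 * TJ + d * J) + m′ * (d * l) ≡⟨ lemma₄ m TJ (d * J) (d * l) ⟩
        2 * (m * TJ) + (m′ * (d * l) + m * (d * J)) ∎))
        where
        TL = total (λ s → κ + s * d) l
        TJ = total (λ j → κ + j * d) J
        common = 2 * (m′ * l * κ) + d * m * (m′ * (m′ * (r * r))) + d * (m * (m′ * r))
        lemma₁ : ∀ m d J T x → 2 * (m′ * T) + (m′ * x + m * (d * J)) ≡ m′ * (2 * T + x) + d * (m * J)
        lemma₁ m d J T x = ℕSolver.solve (m ∷ m′ ∷ d ∷ J ∷ T ∷ x ∷ [])
        lemma₂ : ∀ d → m′ * (2 * (suc m′ * r * κ) + d * (suc m′ * r * (suc m′ * r))) + d * (suc m′ * (m′ * r + d)) ≡
                 2 * (m′ * (suc m′ * r) * κ) + d * suc m′ * (m′ * (m′ * (r * r))) + d * (suc m′ * (m′ * r)) + d * suc m′ * (m′ * (r * r) + d)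
        lemma₂ d = ℕSolver.solve (m′ ∷ r ∷ d ∷ κ ∷ [])
        lemma₃ : ∀ d → 2 * (m′ * (suc m′ * r) * κ) + d * suc m′ * (m′ * (m′ * (r * r))) + d * (suc m′ * (m′ * r)) + d * suc m′ * (2 * κ + (2 * (m′ * r * d) + d * d)) ≡
                 suc m′ * (2 * ((m′ * r + d) * κ) + d * ((m′ * r + d) * (m′ * r + d))) + m′ * (d * (suc m′ * r))
        lemma₃ d = ℕSolver.solve (m′ ∷ r ∷ d ∷ κ ∷ [])
        lemma₄ : ∀ m T x y → m * (2 * T + x) + m′ * y ≡ 2 * (m * T) + (m′ * y + m * x)
        lemma₄ m T x y = ℕSolver.solve (m ∷ m′ ∷ T ∷ x ∷ y ∷ [])
        gap : m′ * (r * r) + d < 2 * κ + (2 * (m′ * r * d) + d * d)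
        gap = ℕP.+-mono-<-≤ (ℕP.≤-<-trans (ℕP.≤-trans (ℕP.m≤n+m (m′ * (r * r)) (r * r)) mr²≤c) c<2κ)
          (ℕP.≤-trans (ℕP.m≤m*n d d) (ℕP.m≤n+m (d * d) (2 * (m′ * r * d))))
          where
          c<2κ : c < 2 * κ
          c<2κ = ℕP.+-cancelʳ-< c c (2 * κ) (begin-strict
            c + c <⟨ ℕP.+-mono-< (ℕP.n<1+n c) (ℕP.n<1+n c) ⟩
            suc c + suc c ≡⟨ ≡.cong (λ z → suc c + z) (≡.sym (ℕP.+-identityʳ (suc c))) ⟩
            2 * suc c ≡⟨ ≡.cong (2 *_) (≡.sym e) ⟩
            2 * (κ + (d * l + J)) ≡⟨ ℕP.*-distribˡ-+ 2 κ (d * l + J) ⟩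
            2 * κ + 2 * (d * l + J) ≤⟨ ℕP.+-monoʳ-≤ (2 * κ) 2[dl+J]≤c ⟩
            2 * κ + c ∎)

-- From the column estimates to the final inequality

module Numerics where
  open import Data.Integer using (∣_∣)
  open import Data.Nat using (_+_; _*_; _^_)
  open ℕP.≤-Reasoning

  ∣-∣≤ : ∀ {a b D} → a ≤ b + D → b ≤ a + D → ∣ + a ℤ.- + b ∣ ≤ D
  ∣-∣≤ {a} {b} {D} a≤ b≤ rewrite ℤP.m-n≡m⊖n a b with ℕP.≤-total a b
  ... | inj₁ a≤b = ≡.subst (_≤ D) (≡.sym (ℤP.∣⊖∣-≤ a≤b)) (ℕP.m≤n+o⇒m∸n≤o b a b≤)
  ... | inj₂ b≤a = ≡.subst (_≤ D) (≡.sym (≡.trans (ℤP.∣m⊖n∣≡∣n⊖m∣ a b) (ℤP.∣⊖∣-≤ b≤a))) (ℕP.m≤n+o⇒m∸n≤o a b a≤)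

  -- `M` counts all pairs of norm `t`, singular ones included, `St` only the nonsingular ones.
  -- `Q = q - 1` is the number of columns to which the value estimate applies.
  module _ (m c k s St M S Q : ℕ) (2≤p : 2 ≤ suc m) (2≤s : 2 ≤ s) (s²≤q : s * s ≤ suc m ^ k)
    (1+Q≡q : suc Q ≡ suc m ^ k) (1+mc≡q : suc (m * c) ≡ suc m ^ k) (S+q : S + suc m ^ k ≡ suc m ^ k * suc m ^ k)
    (St≤M : St ≤ M) (M≤St+q : M ≤ St + suc m ^ k)
    (upper : M ≤ suc m ^ k + Q * (c + (2 * suc m * s + suc m))) (lower : Q * c ≤ M + Q * (2 * suc m * s + suc m)) where
    private
      p q err : ℕ
      p = suc m
      q = p ^ k
      err = 2 * p * s + p

      Q≡mc : Q ≡ m * c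
      Q≡mc = ℕP.suc-injective (≡.trans 1+Q≡q (≡.sym 1+mc≡q))

      Q≤q : Q ≤ q
      Q≤q = ℕP.≤-trans (ℕP.n≤1+n Q) (ℕP.≤-reflexive 1+Q≡q)

      S≡qQ : S ≡ q * Q
      S≡qQ = ℕP.+-cancelʳ-≡ q S (q * Q) (≡.trans S+q (≡.trans (≡.cong (q *_) (≡.sym 1+Q≡q)) (≡.trans (ℕP.*-suc q Q) (ℕP.+-comm q (q * Q)))))

      D = m * q * (2 + err)

      left : m * St ≤ S + D
      left = begin
        m * St ≤⟨ ℕP.*-monoʳ-≤ m (ℕP.≤-trans St≤M upper) ⟩
        m * (q + Q * (c + err)) ≡⟨ lemma₁ q err ⟩
        Q * (m * c) + (m * q + m * (Q * err)) ≤⟨ ℕP.+-mono-≤ (ℕP.≤-trans (ℕP.*-mono-≤ Q≤q (ℕP.≤-reflexive (≡.sym Q≡mc))) (ℕP.≤-reflexive (≡.sym S≡qQ)))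
             (ℕP.≤-trans (ℕP.+-monoʳ-≤ (m * q) (ℕP.*-monoʳ-≤ m (ℕP.*-monoˡ-≤ err Q≤q))) (ℕP.≤-trans (ℕP.m≤m+n _ (m * q)) (ℕP.≤-reflexive (lemma₂ q err)))) ⟩
        S + D ∎
        where
        lemma₁ : ∀ q e → m * (q + Q * (c + e)) ≡ Q * (m * c) + (m * q + m * (Q * e))
        lemma₁ q e = ℕSolver.solve (m ∷ q ∷ Q ∷ c ∷ e ∷ [])
        lemma₂ : ∀ q e → m * q + m * (q * e) + m * q ≡ m * q * (2 + e)
        lemma₂ q e = ℕSolver.solve (m ∷ q ∷ e ∷ [])

      right : S ≤ m * St + D
      right = begin
        S ≡⟨ ≡.trans S≡qQ (≡.cong₂ _*_ (≡.sym 1+Q≡q) Q≡mc) ⟩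
        suc Q * (m * c) ≡⟨ lemma₁ ⟩
        m * (Q * c + c) ≤⟨ ℕP.*-monoʳ-≤ m (ℕP.+-mono-≤ (ℕP.≤-trans lower (ℕP.+-mono-≤ M≤St+q (ℕP.*-monoˡ-≤ err Q≤q))) c≤q) ⟩
        m * (St + q + q * err + q) ≡⟨ lemma₂ q err ⟩
        m * St + D ∎
        where
        lemma₁ : suc Q * (m * c) ≡ m * (Q * c + c)
        lemma₁ = ℕSolver.solve (Q ∷ m ∷ c ∷ [])
        lemma₂ : ∀ q e → m * (St + q + q * e + q) ≡ m * St + m * q * (2 + e)
        lemma₂ q e = ℕSolver.solve (m ∷ St ∷ q ∷ e ∷ [])
        c≤q : c ≤ q
        c≤q = ℕP.≤-trans (ℕP.m≤n*m c m {{ℕ.>-nonZero (ℕ.s≤s⁻¹ 2≤p)}}) (ℕP.≤-trans (ℕP.n≤1+n _) (ℕP.≤-reflexive 1+mc≡q))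

      -- Origin of the constant 3: `p + 2 ≤ 2 p ≤ p s` lets `2 p s` absorb everything of lower
      -- order. In `right` the 2 stands for the singular pairs and for the column missing from the
      -- lower bound.
      D≤ : D ≤ m * q * (3 * p * s)
      D≤ = ℕP.*-monoʳ-≤ (m * q) (begin
        2 + (2 * p * s + p) ≡⟨ ℕP.+-comm 2 _ ⟩
        2 * p * s + p + 2 ≡⟨ ℕP.+-assoc (2 * p * s) p 2 ⟩
        2 * p * s + (p + 2) ≤⟨ ℕP.+-monoʳ-≤ (2 * p * s) (ℕP.≤-trans (ℕP.+-monoʳ-≤ p 2≤p) (ℕP.≤-trans (ℕP.≤-reflexive (lemma₁ p)) (ℕP.*-monoʳ-≤ p 2≤s))) ⟩
        2 * p * s + p * s ≡⟨ lemma₂ p ⟩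
        3 * p * s ∎)
        where
        lemma₁ : ∀ p → p + p ≡ p * 2
        lemma₁ p = ℕSolver.solve (p ∷ [])
        lemma₂ : ∀ p → 2 * p * s + p * s ≡ 3 * p * s
        lemma₂ p = ℕSolver.solve (p ∷ s ∷ [])

    -- Multiplying by `m` and squaring removes the fraction `S / m` and the half-integral exponent
    -- `3k/2 + 1`; the square root of `q` enters only through `s * s ≤ q`.
    deviation-bound : ∣ + m ℤ.* + St ℤ.- + S ∣ ^ 2 ≤ 9 * m ^ 2 * p ^ (3 * k + 2)
    deviation-bound = begin
      ∣ + m ℤ.* + St ℤ.- + S ∣ ^ 2 ≡⟨ ≡.cong (λ z → ∣ z ℤ.- + S ∣ ^ 2) (≡.sym (ℤP.pos-* m St)) ⟩
      ∣ + (m * St) ℤ.- + S ∣ ^ 2 ≤⟨ ℕP.^-monoˡ-≤ 2 (ℕP.≤-trans (∣-∣≤ left right) D≤) ⟩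
      (m * q * (3 * p * s)) ^ 2 ≡⟨ lemma₁ p q ⟩
      9 * (m * (m * 1)) * (q * (q * (s * s)) * (p * (p * 1))) ≤⟨ ℕP.*-monoʳ-≤ (9 * (m * (m * 1))) (ℕP.*-monoˡ-≤ (p * (p * 1)) (ℕP.*-monoʳ-≤ q (ℕP.*-monoʳ-≤ q s²≤q))) ⟩
      9 * m ^ 2 * (q * (q * q) * p ^ 2) ≡⟨ ≡.cong (λ x → 9 * m ^ 2 * (x * p ^ 2)) (≡.trans (lemma₂ q) (≡.trans (ℕP.^-*-assoc p k 3) (≡.cong (p ^_) (ℕP.*-comm k 3)))) ⟩
      9 * m ^ 2 * (p ^ (3 * k) * p ^ 2) ≡⟨ ≡.cong (9 * m ^ 2 *_) (≡.sym (ℕP.^-distribˡ-+-* p (3 * k) 2)) ⟩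
      9 * m ^ 2 * p ^ (3 * k + 2) ∎
      where
      lemma₁ : ∀ p q → m * q * (3 * p * s) * (m * q * (3 * p * s) * 1) ≡ 9 * (m * (m * 1)) * (q * (q * (s * s)) * (p * (p * 1)))
      lemma₁ p q = ℕSolver.solve (m ∷ p ∷ q ∷ s ∷ [])
      lemma₂ : ∀ q → q * (q * q) ≡ q * (q * (q * 1))
      lemma₂ q = ℕSolver.solve (q ∷ [])

open import Relation.Binary.Reasoning.MultiSetoid

-- Commutative rings: integer constants, divisibility, finite sums

module RingTheory (R : CommutativeRing 0ℓ 0ℓ) where
  open CommutativeRing R public hiding (zero)
  open Algebra.Properties.Ring ring public
    using (-‿distribˡ-*; -‿distribʳ-*)
  open Algebra.Properties.AbelianGroup +-abelianGroup public
    using () renaming (ε⁻¹≈ε to -0≈0; ⁻¹-∙-comm to -‿+-comm; ⁻¹-involutive to -‿involutive)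
  open Algebra.Properties.CommutativeSemiring.Exp commutativeSemiring public
    using (_^_; ^-congˡ; ^-congʳ; ^-homo-*; ^-assocʳ; ^-distrib-*)
  open Algebra.Properties.Semiring.Mult semiring public
    using (×-homo-+; ×1-homo-*) renaming (_×_ to _·_)

  ι : ℕ → Carrier
  ι n = n · 1#

  -- The canonical map from the integers. As the coefficient map of the ring solver it lets
  -- identities with constants such as 27 or 108 be decided in every commutative ring at once.
  ι± : ℤ → Carrier
  ι± (+ n) = ι n
  ι± (-[1+ n ]) = - ι (suc n)

  private
    ι±-neg : ∀ n → ι± (ℤ.- (+ n)) ≈ - ι n
    ι±-neg zero = sym -0≈0
    ι±-neg (suc n) = refl

    cancel : ∀ a b c → a + b ≈ (c + a) + (b + - c)
    cancel a b c = begin⟨ setoid ⟩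
      a + b ≈⟨ +-identityʳ _ ⟨
      (a + b) + 0# ≈⟨ +-congˡ (-‿inverseʳ c) ⟨
      (a + b) + (c + - c) ≈⟨ +-assoc _ _ _ ⟨
      (a + b) + c + - c ≈⟨ +-congʳ (+-comm _ _) ⟩
      c + (a + b) + - c ≈⟨ +-congʳ (+-assoc _ _ _) ⟨
      c + a + b + - c ≈⟨ +-assoc _ _ _ ⟩
      (c + a) + (b + - c) ∎

    ι±-⊖ : ∀ m n → ι± (m ℤ.⊖ n) ≈ ι m + - ι n
    ι±-⊖ m zero = begin⟨ setoid ⟩
      ι m ≈⟨ +-identityʳ _ ⟨
      ι m + 0# ≈⟨ +-congˡ -0≈0 ⟨
      ι m + - 0# ∎
    ι±-⊖ zero (suc n) = sym (+-identityˡ _)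
    ι±-⊖ (suc m) (suc n) rewrite ℤP.[1+m]⊖[1+n]≡m⊖n m n = begin⟨ setoid ⟩
      ι± (m ℤ.⊖ n) ≈⟨ ι±-⊖ m n ⟩
      ι m + - ι n ≈⟨ cancel _ _ 1# ⟩
      (1# + ι m) + (- ι n + - 1#) ≈⟨ +-congˡ (+-comm _ _) ⟩
      (1# + ι m) + (- 1# + - ι n) ≈⟨ +-congˡ (-‿+-comm _ _) ⟩
      (1# + ι m) + - (1# + ι n) ∎

    ι±-+ : ∀ a b → ι± (a ℤ.+ b) ≈ ι± a + ι± b
    ι±-+ (+ m) (+ n) = ×-homo-+ 1# m n
    ι±-+ (+ m) (-[1+ n ]) = ι±-⊖ m (suc n)
    ι±-+ (-[1+ m ]) (+ n) = trans (ι±-⊖ n (suc m)) (+-comm _ _)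
    ι±-+ (-[1+ m ]) (-[1+ n ]) = begin⟨ setoid ⟩
      - (1# + ι (suc (m ℕ.+ n))) ≈⟨ reflexive (≡.cong (λ k → - (1# + ι k)) (ℕP.+-suc m n)) ⟨
      - ι (suc m ℕ.+ suc n) ≈⟨ -‿cong (×-homo-+ 1# (suc m) (suc n)) ⟩
      - (ι (suc m) + ι (suc n)) ≈⟨ -‿+-comm _ _ ⟨
      - ι (suc m) + - ι (suc n) ∎

    ι±-- : ∀ a → ι± (ℤ.- a) ≈ - ι± a
    ι±-- (+ n) = ι±-neg n
    ι±-- (-[1+ n ]) = sym (-‿involutive _)

    ι±-* : ∀ a b → ι± (a ℤ.* b) ≈ ι± a * ι± b
    ι±-* (+ m) (+ n) rewrite ≡.sym (ℤP.pos-* m n) = ×1-homo-* m n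
    ι±-* (+ m) (-[1+ n ]) rewrite ≡.sym (ℤP.neg-distribʳ-* (+ m) (+ suc n)) | ≡.sym (ℤP.pos-* m (suc n)) =
      trans (ι±-neg (m ℕ.* suc n)) (trans (-‿cong (×1-homo-* m (suc n))) (-‿distribʳ-* _ _))
    ι±-* (-[1+ m ]) (+ n) rewrite ≡.sym (ℤP.neg-distribˡ-* (+ suc m) (+ n)) | ≡.sym (ℤP.pos-* (suc m) n) =
      trans (ι±-neg (suc m ℕ.* n)) (trans (-‿cong (×1-homo-* (suc m) n)) (-‿distribˡ-* _ _))
    ι±-* (-[1+ m ]) (-[1+ n ]) = begin⟨ setoid ⟩
      ι (suc m ℕ.* suc n) ≈⟨ ×1-homo-* (suc m) (suc n) ⟩
      ι (suc m) * ι (suc n) ≈⟨ -‿involutive _ ⟨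
      - - (ι (suc m) * ι (suc n)) ≈⟨ -‿cong (-‿distribˡ-* _ _) ⟩
      - (- ι (suc m) * ι (suc n)) ≈⟨ -‿distribʳ-* _ _ ⟩
      - ι (suc m) * - ι (suc n) ∎

  ℤ-raw : RawRing 0ℓ 0ℓ
  ℤ-raw = record { _≈_ = _≡_ ; _+_ = ℤ._+_ ; _*_ = ℤ._*_ ; -_ = ℤ.-_ ; 0# = + 0 ; 1# = + 1 }

  ι±-hom : ℤ-raw -Raw-AlmostCommutative⟶ fromCommutativeRing R
  ι±-hom = record
    { ⟦_⟧ = ι± ; +-homo = ι±-+ ; *-homo = ι±-* ; -‿homo = ι±--
    ; 0-homo = refl ; 1-homo = +-identityʳ 1# }

  private
    _≟ι_ : ∀ a b → Maybe (ι± a ≈ ι± b)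
    a ≟ι b with a ℤP.≟ b
    ... | yes a≡b = just (reflexive (≡.cong ι± a≡b))
    ... | no _ = nothing

  module Solver = Algebra.Solver.Ring ℤ-raw (fromCommutativeRing R) ι±-hom _≟ι_
  open Solver public using (solve; _:=_; _:+_; _:*_; _:-_; :-_; _:^_; con)

  0^ : ∀ {n} → 0 < n → 0# ^ n ≈ 0#
  0^ {suc n} _ = zeroˡ _

  1^ : ∀ n → 1# ^ n ≈ 1#
  1^ zero = refl
  1^ (suc n) = trans (*-identityˡ _) (1^ n)

  x-y≈0⇒x≈y : ∀ {x y} → x - y ≈ 0# → x ≈ y
  x-y≈0⇒x≈y {x} {y} e = begin⟨ setoid ⟩
    x ≈⟨ solve 2 (λ x y → x := (x :- y) :+ y) refl x y ⟩
    x - y + y ≈⟨ +-congʳ e ⟩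
    0# + y ≈⟨ +-identityˡ _ ⟩
    y ∎

  x≈y⇒x-y≈0 : ∀ {x y} → x ≈ y → x - y ≈ 0#
  x≈y⇒x-y≈0 {x} {y} e = trans (+-congʳ e) (-‿inverseʳ y)

  infix 4 _∣_
  _∣_ : Carrier → Carrier → Set
  a ∣ b = ∃ λ c → b ≈ a * c

  ∣-cong : ∀ {a b c} → b ≈ c → a ∣ b → a ∣ c
  ∣-cong b≈c (x , e) = x , trans (sym b≈c) e

  ∣-trans : ∀ {a b c} → a ∣ b → b ∣ c → a ∣ c
  ∣-trans {a} {b} {c} (x , e) (y , e′) = x * y , trans e′ (trans (*-congʳ e) (*-assoc a x y))

  ∣-+ : ∀ {a b c} → a ∣ b → a ∣ c → a ∣ b + c
  ∣-+ (x , e) (y , e′) = x + y , trans (+-cong e e′) (sym (distribˡ _ x y))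

  ∣-*ˡ : ∀ {a b} c → a ∣ b → a ∣ c * b
  ∣-*ˡ {a} {b} c (x , e) = c * x , trans (*-congˡ e) (solve 3 (λ a c x → c :* (a :* x) := a :* (c :* x)) refl a c x)

  ∣-*ʳ : ∀ {a b} c → a ∣ b → a ∣ b * c
  ∣-*ʳ c d = ∣-cong (*-comm c _) (∣-*ˡ c d)

  ∣-neg : ∀ {a b} → a ∣ b → a ∣ - b
  ∣-neg (x , e) = - x , trans (-‿cong e) (-‿distribʳ-* _ x)

  ∣-- : ∀ {a b c} → a ∣ b → a ∣ c → a ∣ b - c
  ∣-- d d′ = ∣-+ d (∣-neg d′)

  ∣0 : ∀ {a} → a ∣ 0#
  ∣0 = 0# , sym (zeroʳ _)

  ∣-^ : ∀ {m n} a → m ≤ n → a ^ m ∣ a ^ n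
  ∣-^ {m} {n} a m≤n = a ^ (n ∸ m) ,
    trans (reflexive (≡.cong (a ^_) (≡.sym (ℕP.m+[n∸m]≡n m≤n)))) (^-homo-* a m (n ∸ m))

  ∑ : ℕ → (ℕ → Carrier) → Carrier
  ∑ zero f = 0#
  ∑ (suc n) f = f 0 + ∑ n (f ∘ suc)

  ∑-cong : ∀ n {f g} → (∀ i → i < n → f i ≈ g i) → ∑ n f ≈ ∑ n g
  ∑-cong zero e = refl
  ∑-cong (suc n) e = +-cong (e 0 (s≤s z≤n)) (∑-cong n λ i i<n → e (suc i) (s≤s i<n))

  ∑-0 : ∀ n → ∑ n (λ _ → 0#) ≈ 0#
  ∑-0 zero = refl
  ∑-0 (suc n) = trans (+-identityˡ _) (∑-0 n)

  ∑-+ : ∀ n f g → ∑ n (λ i → f i + g i) ≈ ∑ n f + ∑ n g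
  ∑-+ zero f g = sym (+-identityʳ _)
  ∑-+ (suc n) f g = trans (+-congˡ (∑-+ n _ _))
    (solve 4 (λ a b c d → a :+ b :+ (c :+ d) := a :+ c :+ (b :+ d)) refl _ _ _ _)

  ∑-*ˡ : ∀ n a f → ∑ n (λ i → a * f i) ≈ a * ∑ n f
  ∑-*ˡ zero a f = sym (zeroʳ a)
  ∑-*ˡ (suc n) a f = trans (+-congˡ (∑-*ˡ n a _)) (sym (distribˡ a _ _))

  ∑-last : ∀ n f → ∑ (suc n) f ≈ ∑ n f + f n
  ∑-last zero f = +-comm _ _
  ∑-last (suc n) f = trans (+-congˡ (∑-last n (f ∘ suc))) (sym (+-assoc _ _ _))

  CharP : ℕ → Set
  CharP p = ι p ≈ 0#

  char-∣ : ∀ {p n} → CharP p → p ∣ⁿ n → ι n ≈ 0#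
  char-∣ {p} ch (ℕD.divides-refl k) = trans (×1-homo-* k p) (trans (*-congˡ ch) (zeroʳ _))

  geometric : ∀ x y n → (x - y) * ∑ (suc n) (λ i → x ^ i * y ^ (n ∸ i)) ≈ x ^ suc n - y ^ suc n
  geometric x y zero = solve 2 (λ x y → (x :- y) :* (x :^ 0 :* x :^ 0 :+ con (+ 0)) := x :^ 1 :- y :^ 1) refl x y
  geometric x y (suc n) = begin⟨ setoid ⟩
    (x - y) * (1# * Y + ∑ (suc n) (λ i → x * x ^ i * y ^ (n ∸ i)))
      ≈⟨ *-congˡ (+-congˡ (trans (∑-cong (suc n) λ i _ → *-assoc x (x ^ i) (y ^ (n ∸ i))) (∑-*ˡ (suc n) x (λ i → x ^ i * y ^ (n ∸ i))))) ⟩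
    (x - y) * (1# * Y + x * S)
      ≈⟨ solve 4 (λ x y Y S → (x :- y) :* (x :^ 0 :* Y :+ x :* S) := (x :- y) :* Y :+ x :* ((x :- y) :* S)) refl x y Y S ⟩
    (x - y) * Y + x * ((x - y) * S)
      ≈⟨ +-congˡ (*-congˡ (geometric x y n)) ⟩
    (x - y) * Y + x * (x ^ suc n - Y)
      ≈⟨ solve 4 (λ x y X Y → (x :- y) :* Y :+ x :* (X :- Y) := x :* X :- y :* Y) refl x y (x ^ suc n) Y ⟩
    x ^ suc (suc n) - y ^ suc (suc n) ∎
    where
    Y = y ^ suc n
    S = ∑ (suc n) (λ i → x ^ i * y ^ (n ∸ i))

-- The Frobenius endomorphism

n!∤p : ∀ {p} → Prime p → ∀ n → n < p → ¬ p ∣ⁿ n !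
n!∤p pr zero _ d = ℕP.<⇒≢ (ℕ.nonTrivial⇒n>1 _ {{prime⇒nonTrivial pr}}) (≡.sym (ℕD.∣1⇒≡1 d))
n!∤p pr (suc n) n<p d with euclidsLemma (suc n) (n !) pr d
... | inj₁ d′ = ℕP.<⇒≱ n<p (ℕD.∣⇒≤ d′)
... | inj₂ d′ = n!∤p pr n (ℕP.<-trans ℕP.≤-refl n<p) d′

p∣pCk : ∀ {p k} → Prime p → 0 < k → k < p → p ∣ⁿ p C k
p∣pCk {suc p-1} {k} pr 0<k k<p with euclidsLemma (p C k) (k ! ℕ.* (p ∸ k) !) pr p∣prod
  where
  p = suc p-1
  k≤p = ℕP.<⇒≤ k<p
  instance _ = k !* (p ∸ k) !≢0
  p∣prod : p ∣ⁿ (p C k) ℕ.* (k ! ℕ.* (p ∸ k) !)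
  p∣prod = ≡.subst (p ∣ⁿ_) (≡.sym (≡.trans (≡.cong (ℕ._* (k ! ℕ.* (p ∸ k) !)) (nCk≡n!/k![n-k]! k≤p)) (m/n*n≡m (k![n∸k]!∣n! k≤p))))
    (ℕD.m∣m*n (p-1 !))
... | inj₁ d = d
... | inj₂ d with euclidsLemma (k !) ((suc p-1 ∸ k) !) pr d
...   | inj₁ d′ = ⊥-elim (n!∤p pr k k<p d′)
...   | inj₂ d′ = ⊥-elim (n!∤p pr (suc p-1 ∸ k) (ℕP.∸-monoʳ-< 0<k (ℕP.<⇒≤ k<p)) d′)

module Frobenius (R : CommutativeRing 0ℓ 0ℓ) {p} (pr : Prime p) (ch : RingTheory.CharP R p) where
  open RingTheory R
  open Algebra.Properties.CommutativeSemiring.Binomial commutativeSemiring using (binomialTerm; theorem)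
  open Algebra.Properties.Monoid.Sum +-monoid using (sum; sum-init-last; sum-cong-≋; sum-replicate-zero)

  private
    top : ∀ n k → k ≡ n → ∀ {x y} → (n C k) · (x ^ k * y ^ (n ∸ k)) ≈ x ^ n
    top n _ ≡.refl rewrite nCn≡1 n | ℕP.n∸n≡0 n = trans (+-identityʳ _) (*-identityʳ _)

    middle : ∀ q → suc (suc q) ≡ p → ∀ x y (i : Fin (suc q)) → binomialTerm x y (suc (suc q)) (Fin.suc (Fin.inject₁ i)) ≈ 0#
    middle q ≡.refl x y i = begin⟨ setoid ⟩
      _ ≈⟨ ×-assoc* (p C k) _ ⟨
      ι (p C k) * _ ≈⟨ *-congʳ (char-∣ ch (p∣pCk pr (s≤s z≤n) k<p)) ⟩
      0# * _ ≈⟨ zeroˡ _ ⟩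
      0# ∎
      where
      k = suc (Fin.toℕ (Fin.inject₁ i))
      k<p : k < suc (suc q)
      k<p = s≤s (≡.subst (_< suc q) (≡.sym (FinP.toℕ-inject₁ i)) (FinP.toℕ<n i))
      ×-assoc* : ∀ n z → ι n * z ≈ n · z
      ×-assoc* zero z = zeroˡ z
      ×-assoc* (suc n) z = trans (distribʳ _ _ _) (+-cong (*-identityˡ z) (×-assoc* n z))

    dream : ∀ q → suc (suc q) ≡ p → ∀ x y → (x + y) ^ p ≈ x ^ p + y ^ p
    dream q ≡.refl x y = begin⟨ setoid ⟩
      (x + y) ^ p ≈⟨ theorem p x y ⟩
      term Fin.zero + sum (λ i → term (Fin.suc i)) ≈⟨ +-congˡ (sum-init-last (λ i → term (Fin.suc i))) ⟩
      term Fin.zero + (sum (λ i → term (Fin.suc (Fin.inject₁ i))) + term (Fin.suc (Fin.fromℕ (suc q))))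
        ≈⟨ +-congˡ (+-congʳ (trans (sum-cong-≋ (middle q ≡.refl x y)) (sum-replicate-zero (suc q)))) ⟩
      term Fin.zero + (0# + term (Fin.suc (Fin.fromℕ (suc q)))) ≈⟨ +-cong first (trans (+-identityˡ _) last) ⟩
      y ^ p + x ^ p ≈⟨ +-comm _ _ ⟩
      x ^ p + y ^ p ∎
      where
      term = binomialTerm x y p
      first : term Fin.zero ≈ y ^ p
      first = trans (+-identityʳ _) (*-identityˡ _)
      last : term (Fin.suc (Fin.fromℕ (suc q))) ≈ x ^ p
      last = top p _ (FinP.toℕ-fromℕ p)

  frobenius-+ : ∀ x y → (x + y) ^ p ≈ x ^ p + y ^ p
  frobenius-+ = dream (p ∸ 2) (ℕP.m+[n∸m]≡n (ℕ.nonTrivial⇒n>1 p {{prime⇒nonTrivial pr}}))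

  frobenius^-+ : ∀ k x y → (x + y) ^ (p ℕ.^ k) ≈ x ^ (p ℕ.^ k) + y ^ (p ℕ.^ k)
  frobenius^-+ zero x y = trans (*-identityʳ _) (sym (+-cong (*-identityʳ _) (*-identityʳ _)))
  frobenius^-+ (suc k) x y = begin⟨ setoid ⟩
    (x + y) ^ (p ℕ.* p ℕ.^ k) ≈⟨ ^-assocʳ _ p _ ⟨
    ((x + y) ^ p) ^ (p ℕ.^ k) ≈⟨ ^-congˡ (p ℕ.^ k) (frobenius-+ x y) ⟩
    (x ^ p + y ^ p) ^ (p ℕ.^ k) ≈⟨ frobenius^-+ k _ _ ⟩
    (x ^ p) ^ (p ℕ.^ k) + (y ^ p) ^ (p ℕ.^ k) ≈⟨ +-cong (^-assocʳ x p _) (^-assocʳ y p _) ⟩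
    x ^ (p ℕ.* p ℕ.^ k) + y ^ (p ℕ.* p ℕ.^ k) ∎

-- Ring homomorphisms and quotients

record Hom (R S : CommutativeRing 0ℓ 0ℓ) : Set where
  private
    module R = RingTheory R
    module S = RingTheory S
  field
    ⟦_⟧ : R.Carrier → S.Carrier
    cong : ∀ {x y} → x R.≈ y → ⟦ x ⟧ S.≈ ⟦ y ⟧
    +-homo : ∀ x y → ⟦ x R.+ y ⟧ S.≈ ⟦ x ⟧ S.+ ⟦ y ⟧
    *-homo : ∀ x y → ⟦ x R.* y ⟧ S.≈ ⟦ x ⟧ S.* ⟦ y ⟧
    1-homo : ⟦ R.1# ⟧ S.≈ S.1#

  0-homo : ⟦ R.0# ⟧ S.≈ S.0#
  0-homo = begin⟨ S.setoid ⟩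
    z ≈⟨ S.solve 1 (λ z → z S.:= z S.:+ z S.:- z) S.refl z ⟩
    z S.+ z S.- z ≈⟨ S.+-congʳ (+-homo _ _) ⟨
    ⟦ R.0# R.+ R.0# ⟧ S.- z ≈⟨ S.+-congʳ (cong (R.+-identityˡ _)) ⟩
    z S.- z ≈⟨ S.-‿inverseʳ z ⟩
    S.0# ∎
    where
    z = ⟦ R.0# ⟧

  neg-homo : ∀ x → ⟦ R.- x ⟧ S.≈ S.- ⟦ x ⟧
  neg-homo x = begin⟨ S.setoid ⟩
    y ≈⟨ S.solve 2 (λ x y → y S.:= (x S.:+ y) S.:- x) S.refl ⟦ x ⟧ y ⟩
    (⟦ x ⟧ S.+ y) S.- ⟦ x ⟧ ≈⟨ S.+-congʳ (S.trans (S.sym (+-homo _ _)) (S.trans (cong (R.-‿inverseʳ x)) 0-homo)) ⟩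
    S.0# S.- ⟦ x ⟧ ≈⟨ S.+-identityˡ _ ⟩
    S.- ⟦ x ⟧ ∎
    where
    y = ⟦ R.- x ⟧

  sub-homo : ∀ x y → ⟦ x R.- y ⟧ S.≈ ⟦ x ⟧ S.- ⟦ y ⟧
  sub-homo x y = S.trans (+-homo _ _) (S.+-congˡ (neg-homo y))

  ^-homo : ∀ x n → ⟦ x R.^ n ⟧ S.≈ ⟦ x ⟧ S.^ n
  ^-homo x zero = 1-homo
  ^-homo x (suc n) = S.trans (*-homo _ _) (S.*-congˡ (^-homo x n))

  ∑-homo : ∀ n f → ⟦ R.∑ n f ⟧ S.≈ S.∑ n (⟦_⟧ ∘ f)
  ∑-homo zero f = 0-homo
  ∑-homo (suc n) f = S.trans (+-homo _ _) (S.+-congˡ (∑-homo n _))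

  ι-homo : ∀ n → ⟦ R.ι n ⟧ S.≈ S.ι n
  ι-homo zero = 0-homo
  ι-homo (suc n) = S.trans (+-homo _ _) (S.+-cong 1-homo (ι-homo n))

  CharP-homo : ∀ {p} → R.CharP p → S.CharP p
  CharP-homo {p} ch = S.trans (S.sym (ι-homo p)) (S.trans (cong ch) 0-homo)

id-hom : ∀ {R} → Hom R R
id-hom {R} = record { ⟦_⟧ = id ; cong = id ; +-homo = λ _ _ → refl ; *-homo = λ _ _ → refl ; 1-homo = refl }
  where open CommutativeRing R

infixr 9 _∘ʰ_
_∘ʰ_ : ∀ {R S T} → Hom S T → Hom R S → Hom R T
_∘ʰ_ {T = T} g f = record
  { ⟦_⟧ = G.⟦_⟧ ∘ F.⟦_⟧ ; cong = G.cong ∘ F.cong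
  ; +-homo = λ x y → trans (G.cong (F.+-homo x y)) (G.+-homo _ _)
  ; *-homo = λ x y → trans (G.cong (F.*-homo x y)) (G.*-homo _ _)
  ; 1-homo = trans (G.cong F.1-homo) G.1-homo }
  where
  open CommutativeRing T using (trans)
  module F = Hom f
  module G = Hom g

frobenius-hom : ∀ R {p} → Prime p → RingTheory.CharP R p → ℕ → Hom R R
frobenius-hom R {p} pr ch k = record
  { ⟦_⟧ = _^ (p ℕ.^ k) ; cong = ^-congˡ (p ℕ.^ k) ; +-homo = frobenius^-+ k
  ; *-homo = λ x y → ^-distrib-* x y (p ℕ.^ k) ; 1-homo = 1^ (p ℕ.^ k) }
  where
  open RingTheory R
  open Frobenius R pr ch

-- R modulo e, on the same carrier.
_/⟨_⟩ : (R : CommutativeRing 0ℓ 0ℓ) → CommutativeRing.Carrier R → CommutativeRing 0ℓ 0ℓ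
R /⟨ e ⟩ = record
  { Carrier = Carrier ; _≈_ = λ x y → e ∣ x - y ; _+_ = _+_ ; _*_ = _*_ ; -_ = -_ ; 0# = 0# ; 1# = 1#
  ; isCommutativeRing = record
    { isRing = record
      { +-isAbelianGroup = record
        { isGroup = record
          { isMonoid = record
            { isSemigroup = record
              { isMagma = record
                { isEquivalence = record
                  { refl = lift refl
                  ; sym = λ {x} {y} d → ∣-cong (solve 2 (λ x y → :- (x :- y) := y :- x) refl x y) (∣-neg d)
                  ; trans = λ {x} {y} {z} d d′ → ∣-cong (solve 3 (λ x y z → (x :- y) :+ (y :- z) := x :- z) refl x y z) (∣-+ d d′) }
                ; ∙-cong = λ {x} {y} {u} {v} d d′ →
                    ∣-cong (solve 4 (λ x y u v → (x :- y) :+ (u :- v) := (x :+ u) :- (y :+ v)) refl x y u v) (∣-+ d d′) }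
              ; assoc = λ x y z → lift (+-assoc x y z) }
            ; identity = (λ x → lift (+-identityˡ x)) , (λ x → lift (+-identityʳ x)) }
          ; inverse = (λ x → lift (-‿inverseˡ x)) , (λ x → lift (-‿inverseʳ x))
          ; ⁻¹-cong = λ {x} {y} d → ∣-cong (solve 2 (λ x y → :- (x :- y) := :- x :- :- y) refl x y) (∣-neg d) }
        ; comm = λ x y → lift (+-comm x y) }
      ; *-cong = λ {x} {y} {u} {v} d d′ →
          ∣-cong (solve 4 (λ x y u v → u :* (x :- y) :+ y :* (u :- v) := x :* u :- y :* v) refl x y u v) (∣-+ (∣-*ˡ u d) (∣-*ˡ y d′))
      ; *-assoc = λ x y z → lift (*-assoc x y z)
      ; *-identity = (λ x → lift (*-identityˡ x)) , (λ x → lift (*-identityʳ x))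
      ; distrib = (λ x y z → lift (distribˡ x y z)) , (λ x y z → lift (distribʳ x y z)) }
    ; *-comm = λ x y → lift (*-comm x y) } }
  where
  open RingTheory R
  lift : ∀ {x y} → x ≈ y → e ∣ x - y
  lift x≈y = ∣-cong (sym (x≈y⇒x-y≈0 x≈y)) ∣0

quotient-hom : ∀ R e → Hom R (R /⟨ e ⟩)
quotient-hom R e = record
  { ⟦_⟧ = id ; cong = λ x≈y → ∣-cong (sym (x≈y⇒x-y≈0 x≈y)) ∣0
  ; +-homo = λ _ _ → Q.refl ; *-homo = λ _ _ → Q.refl ; 1-homo = Q.refl }
  where
  open RingTheory R
  module Q = CommutativeRing (R /⟨ e ⟩)

-- Polynomial rings, derivatives and substitutions

module Convolution (R : CommutativeRing 0ℓ 0ℓ) where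
  open RingTheory R

  conv : (ℕ → Carrier) → (ℕ → Carrier) → ℕ → Carrier
  conv f g zero = f 0 * g 0
  conv f g (suc n) = f 0 * g (suc n) + conv (f ∘ suc) g n

  conv-cong : ∀ {f f′ g g′} → (∀ i → f i ≈ f′ i) → (∀ i → g i ≈ g′ i) → ∀ n → conv f g n ≈ conv f′ g′ n
  conv-cong e e′ zero = *-cong (e 0) (e′ 0)
  conv-cong e e′ (suc n) = +-cong (*-cong (e 0) (e′ (suc n))) (conv-cong (e ∘ suc) e′ n)

  conv-+ : ∀ f f′ g n → conv (λ i → f i + f′ i) g n ≈ conv f g n + conv f′ g n
  conv-+ f f′ g zero = distribʳ _ _ _
  conv-+ f f′ g (suc n) = trans (+-congˡ (conv-+ (f ∘ suc) (f′ ∘ suc) g n))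
    (solve 5 (λ a b c d e → (a :+ b) :* c :+ (d :+ e) := (a :* c :+ d) :+ (b :* c :+ e)) refl _ _ _ _ _)

  conv-* : ∀ a f g n → conv (λ i → a * f i) g n ≈ a * conv f g n
  conv-* a f g zero = *-assoc _ _ _
  conv-* a f g (suc n) = trans (+-cong (*-assoc _ _ _) (conv-* a (f ∘ suc) g n)) (sym (distribˡ _ _ _))

  conv-0 : ∀ {f} g → (∀ i → f i ≈ 0#) → ∀ n → conv f g n ≈ 0#
  conv-0 g e zero = trans (*-congʳ (e 0)) (zeroˡ _)
  conv-0 g e (suc n) = trans (+-cong (trans (*-congʳ (e 0)) (zeroˡ _)) (conv-0 g (e ∘ suc) n)) (+-identityˡ _)

  conv-last : ∀ f g n → conv f g (suc n) ≈ f (suc n) * g 0 + conv f (g ∘ suc) n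
  conv-last f g zero = +-comm _ _
  conv-last f g (suc n) = trans (+-congˡ (conv-last (f ∘ suc) g n))
    (solve 3 (λ a b c → a :+ (b :+ c) := b :+ (a :+ c)) refl _ _ _)

  conv-comm : ∀ f g n → conv f g n ≈ conv g f n
  conv-comm f g zero = *-comm _ _
  conv-comm f g (suc n) = trans (+-cong (*-comm _ _) (conv-comm (f ∘ suc) g n)) (sym (conv-last g f n))

  conv-assoc : ∀ f g h n → conv (conv f g) h n ≈ conv f (conv g h) n
  conv-assoc f g h zero = *-assoc _ _ _
  conv-assoc f g h (suc n) = begin⟨ setoid ⟩
    f 0 * g 0 * h (suc n) + conv (λ i → f 0 * g (suc i) + conv (f ∘ suc) g i) h n
      ≈⟨ +-congˡ (trans (conv-+ _ _ h n) (+-cong (conv-* (f 0) (g ∘ suc) h n) (conv-assoc (f ∘ suc) g h n))) ⟩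
    f 0 * g 0 * h (suc n) + (f 0 * conv (g ∘ suc) h n + conv (f ∘ suc) (conv g h) n)
      ≈⟨ solve 5 (λ a b c d e → a :* b :* c :+ (a :* d :+ e) := a :* (b :* c :+ d) :+ e) refl _ _ _ _ _ ⟩
    f 0 * (g 0 * h (suc n) + conv (g ∘ suc) h n) + conv (f ∘ suc) (conv g h) n ∎

  conv-vanish : ∀ a b {f g} → (∀ i → a ≤ i → f i ≈ 0#) → (∀ i → suc b ≤ i → g i ≈ 0#) →
                ∀ n → a ℕ.+ b ≤ n → conv f g n ≈ 0#
  conv-vanish zero b {g = g} f0 g0 n _ = conv-0 g (λ i → f0 i z≤n) n
  conv-vanish (suc a) b f0 g0 (suc n) (s≤s le) =
    trans (+-cong (trans (*-congˡ (g0 (suc n) (s≤s (ℕP.≤-trans (ℕP.m≤n+m b a) le)))) (zeroʳ _))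
                  (conv-vanish a b (λ i le′ → f0 (suc i) (s≤s le′)) g0 n le))
          (+-identityˡ _)

  conv-top : ∀ a b {f g} → (∀ i → suc a ≤ i → f i ≈ 0#) → (∀ i → suc b ≤ i → g i ≈ 0#) →
             conv f g (a ℕ.+ b) ≈ f a * g b
  conv-top zero zero f0 g0 = refl
  conv-top zero (suc b) {g = g} f0 g0 = trans (+-congˡ (conv-0 g (λ i → f0 (suc i) (s≤s z≤n)) b)) (+-identityʳ _)
  conv-top (suc a) b {f} {g} f0 g0 =
    trans (+-cong (trans (*-congˡ (g0 _ (s≤s (ℕP.m≤n+m b a)))) (zeroʳ _)) (conv-top a b {f ∘ suc} {g} (λ i le → f0 (suc i) (s≤s le)) g0))
          (+-identityˡ _)

module PolyDefs (R : CommutativeRing 0ℓ 0ℓ) where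
  open RingTheory R
  open Convolution R

  Poly : Set
  Poly = List Carrier

  coeff : Poly → ℕ → Carrier
  coeff [] _ = 0#
  coeff (a ∷ p) zero = a
  coeff (a ∷ p) (suc n) = coeff p n

  -- A record, so that the two polynomials can be inferred from a proof.
  infix 4 _≋_
  record _≋_ (p q : Poly) : Set where
    constructor ext
    field at : ∀ n → coeff p n ≈ coeff q n
  open _≋_ public

  infixl 6 _⊕_
  infixl 7 _⊛_

  opaque
    _⊕_ : Poly → Poly → Poly
    [] ⊕ q = q
    (a ∷ p) ⊕ [] = a ∷ p
    (a ∷ p) ⊕ (b ∷ q) = (a + b) ∷ (p ⊕ q)

    _⊛_ : Poly → Poly → Poly
    [] ⊛ q = []
    (a ∷ p) ⊛ q = map (a *_) q ⊕ (0# ∷ (p ⊛ q))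

    coeff-⊕ : ∀ p q n → coeff (p ⊕ q) n ≈ coeff p n + coeff q n
    coeff-⊕ [] q n = sym (+-identityˡ _)
    coeff-⊕ (a ∷ p) [] n = sym (+-identityʳ _)
    coeff-⊕ (a ∷ p) (b ∷ q) zero = refl
    coeff-⊕ (a ∷ p) (b ∷ q) (suc n) = coeff-⊕ p q n

    coeff-map : ∀ {f : Carrier → Carrier} → f 0# ≈ 0# → ∀ p n → coeff (map f p) n ≈ f (coeff p n)
    coeff-map e [] n = sym e
    coeff-map e (a ∷ p) zero = refl
    coeff-map e (a ∷ p) (suc n) = coeff-map e p n

    coeff-⊛ : ∀ p q n → coeff (p ⊛ q) n ≈ conv (coeff p) (coeff q) n
    coeff-⊛ [] q n = sym (conv-0 (coeff q) (λ _ → refl) n)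
    coeff-⊛ (a ∷ p) q zero = trans (coeff-⊕ (map (a *_) q) _ 0) (trans (+-identityʳ _) (coeff-map (zeroʳ a) q 0))
    coeff-⊛ (a ∷ p) q (suc n) = trans (coeff-⊕ (map (a *_) q) _ (suc n)) (+-cong (coeff-map (zeroʳ a) q (suc n)) (coeff-⊛ p q n))

    neg : Poly → Poly
    neg = map (-_)

    coeff-neg : ∀ p n → coeff (neg p) n ≈ - coeff p n
    coeff-neg = coeff-map -0≈0

  polyRing : CommutativeRing 0ℓ 0ℓ
  polyRing = record
    { Carrier = Poly ; _≈_ = _≋_ ; _+_ = _⊕_ ; _*_ = _⊛_ ; -_ = neg ; 0# = [] ; 1# = 1# ∷ []
    ; isCommutativeRing = record
      { isRing = record
        { +-isAbelianGroup = record
          { isGroup = record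
            { isMonoid = record
              { isSemigroup = record
                { isMagma = record
                  { isEquivalence = record
                    { refl = ext λ n → refl ; sym = λ e → ext λ n → sym (at e n)
                    ; trans = λ e e′ → ext λ n → trans (at e n) (at e′ n) }
                  ; ∙-cong = λ {p} {p′} {q} {q′} e e′ → ext λ n →
                      trans (coeff-⊕ p q n) (trans (+-cong (at e n) (at e′ n)) (sym (coeff-⊕ p′ q′ n))) }
                ; assoc = λ p q r → ext λ n → trans (coeff-⊕ (p ⊕ q) r n) (trans (+-congʳ (coeff-⊕ p q n))
                    (trans (+-assoc _ _ _) (sym (trans (coeff-⊕ p (q ⊕ r) n) (+-congˡ (coeff-⊕ q r n)))))) }
              ; identity = (λ p → ext λ n → trans (coeff-⊕ [] p n) (+-identityˡ _)) , (λ p → ext λ n → trans (coeff-⊕ p [] n) (+-identityʳ _)) }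
            ; inverse = (λ p → ext λ n → trans (coeff-⊕ (neg p) p n) (trans (+-congʳ (coeff-neg p n)) (-‿inverseˡ _)))
                      , (λ p → ext λ n → trans (coeff-⊕ p (neg p) n) (trans (+-congˡ (coeff-neg p n)) (-‿inverseʳ _)))
            ; ⁻¹-cong = λ {p} {q} e → ext λ n → trans (coeff-neg p n) (trans (-‿cong (at e n)) (sym (coeff-neg q n))) }
          ; comm = λ p q → ext λ n → trans (coeff-⊕ p q n) (trans (+-comm _ _) (sym (coeff-⊕ q p n))) }
        ; *-cong = λ {p} {p′} {q} {q′} e e′ → ext λ n →
            trans (coeff-⊛ p q n) (trans (conv-cong (at e) (at e′) n) (sym (coeff-⊛ p′ q′ n)))
        ; *-assoc = λ p q r → ext λ n → begin⟨ setoid ⟩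
            coeff ((p ⊛ q) ⊛ r) n ≈⟨ coeff-⊛ (p ⊛ q) r n ⟩
            conv (coeff (p ⊛ q)) (coeff r) n ≈⟨ conv-cong (coeff-⊛ p q) (λ _ → refl) n ⟩
            conv (conv (coeff p) (coeff q)) (coeff r) n ≈⟨ conv-assoc (coeff p) (coeff q) (coeff r) n ⟩
            conv (coeff p) (conv (coeff q) (coeff r)) n ≈⟨ conv-cong (λ _ → refl) (coeff-⊛ q r) n ⟨
            conv (coeff p) (coeff (q ⊛ r)) n ≈⟨ coeff-⊛ p (q ⊛ r) n ⟨
            coeff (p ⊛ (q ⊛ r)) n ∎
        ; *-identity = 1⊛ , λ p → ext λ n → trans (⊛-comm p (1# ∷ []) n) (at (1⊛ p) n)
        ; distrib = (λ p q r → ext λ n → trans (⊛-comm p (q ⊕ r) n) (trans (at (⊛-distribʳ p q r) n)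
                       (trans (coeff-⊕ (q ⊛ p) (r ⊛ p) n) (trans (+-cong (⊛-comm q p n) (⊛-comm r p n)) (sym (coeff-⊕ (p ⊛ q) (p ⊛ r) n))))))
                  , ⊛-distribʳ }
      ; *-comm = λ p q → ext (⊛-comm p q) } }
    where
    ⊛-comm : ∀ p q n → coeff (p ⊛ q) n ≈ coeff (q ⊛ p) n
    ⊛-comm p q n = trans (coeff-⊛ p q n) (trans (conv-comm _ _ n) (sym (coeff-⊛ q p n)))
    1⊛ : ∀ p → (1# ∷ []) ⊛ p ≋ p
    1⊛ p = ext λ n → trans (coeff-⊛ (1# ∷ []) p n) (lem n)
      where
      lem : ∀ n → conv (coeff (1# ∷ [])) (coeff p) n ≈ coeff p n
      lem zero = *-identityˡ _
      lem (suc n) = trans (+-cong (*-identityˡ _) (conv-0 (coeff p) (λ _ → refl) n)) (+-identityʳ _)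
    ⊛-distribʳ : ∀ r p q → (p ⊕ q) ⊛ r ≋ (p ⊛ r) ⊕ (q ⊛ r)
    ⊛-distribʳ r p q = ext λ n → begin⟨ setoid ⟩
      coeff ((p ⊕ q) ⊛ r) n ≈⟨ coeff-⊛ (p ⊕ q) r n ⟩
      conv (coeff (p ⊕ q)) (coeff r) n ≈⟨ conv-cong (coeff-⊕ p q) (λ _ → refl) n ⟩
      conv (λ i → coeff p i + coeff q i) (coeff r) n ≈⟨ conv-+ _ _ (coeff r) n ⟩
      conv (coeff p) (coeff r) n + conv (coeff q) (coeff r) n ≈⟨ +-cong (coeff-⊛ p r n) (coeff-⊛ q r n) ⟨
      coeff (p ⊛ r) n + coeff (q ⊛ r) n ≈⟨ coeff-⊕ (p ⊛ r) (q ⊛ r) n ⟨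
      coeff ((p ⊛ r) ⊕ (q ⊛ r)) n ∎

infix 30 _[X]
_[X] : CommutativeRing 0ℓ 0ℓ → CommutativeRing 0ℓ 0ℓ
R [X] = PolyDefs.polyRing R

module PolyTheory (R : CommutativeRing 0ℓ 0ℓ) where
  open RingTheory R
  open Convolution R
  open PolyDefs R public
  module P = RingTheory (R [X])

  C : Carrier → Poly
  C a = a ∷ []

  X : Poly
  X = 0# ∷ 1# ∷ []

  C-hom : Hom R (R [X])
  C-hom = record
    { ⟦_⟧ = C ; cong = λ e → ext λ { zero → e ; (suc _) → refl }
    ; +-homo = λ a b → ext λ { zero → sym (coeff-⊕ (C a) (C b) 0) ; (suc n) → sym (trans (coeff-⊕ (C a) (C b) (suc n)) (+-identityʳ _)) }
    ; *-homo = λ a b → ext λ { zero → sym (coeff-⊛ (C a) (C b) 0)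
                             ; (suc n) → sym (trans (coeff-⊛ (C a) (C b) (suc n)) (trans (+-cong (zeroʳ a) (conv-0 (coeff (C b)) (λ _ → refl) n)) (+-identityʳ _))) }
    ; 1-homo = P.refl }

  coeff-sub : ∀ p q n → coeff (p P.- q) n ≈ coeff p n - coeff q n
  coeff-sub p q n = trans (coeff-⊕ p (P.- q) n) (+-congˡ (coeff-neg q n))

  coeff-C* : ∀ a p n → coeff (C a P.* p) n ≈ a * coeff p n
  coeff-C* a p n = trans (coeff-⊛ (C a) p n) (lem n)
    where
    lem : ∀ n → conv (coeff (C a)) (coeff p) n ≈ a * coeff p n
    lem zero = refl
    lem (suc n) = trans (+-congˡ (conv-0 (coeff p) (λ _ → refl) n)) (+-identityʳ _)

  coeff-X*-0 : ∀ p → coeff (X P.* p) 0 ≈ 0#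
  coeff-X*-0 p = trans (coeff-⊛ X p 0) (zeroˡ _)

  coeff-X*-suc : ∀ p n → coeff (X P.* p) (suc n) ≈ coeff p n
  coeff-X*-suc p n = begin⟨ setoid ⟩
    coeff (X P.* p) (suc n) ≈⟨ coeff-⊛ X p (suc n) ⟩
    0# * coeff p (suc n) + conv (coeff (1# ∷ [])) (coeff p) n ≈⟨ trans (+-congʳ (zeroˡ _)) (+-identityˡ _) ⟩
    conv (coeff (1# ∷ [])) (coeff p) n ≈⟨ coeff-⊛ (1# ∷ []) p n ⟨
    coeff ((1# ∷ []) ⊛ p) n ≈⟨ at (P.*-identityˡ p) n ⟩
    coeff p n ∎

  coeff-∑ : ∀ m (f : ℕ → Poly) n → coeff (P.∑ m f) n ≈ ∑ m (λ i → coeff (f i) n)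
  coeff-∑ zero f n = refl
  coeff-∑ (suc m) f n = trans (coeff-⊕ (f 0) _ n) (+-congˡ (coeff-∑ m (f ∘ suc) n))

  ∷-split : ∀ a p → a ∷ p ≋ C a P.+ X P.* p
  ∷-split a p = ext λ
    { zero → sym (trans (coeff-⊕ (C a) (X P.* p) 0) (trans (+-congˡ (coeff-X*-0 p)) (+-identityʳ _)))
    ; (suc n) → sym (trans (coeff-⊕ (C a) (X P.* p) (suc n)) (trans (+-identityˡ _) (coeff-X*-suc p n))) }

  coeff-X^*-+ : ∀ k p n → coeff (X P.^ k P.* p) (k ℕ.+ n) ≈ coeff p n
  coeff-X^*-+ zero p n = at (P.*-identityˡ p) n
  coeff-X^*-+ (suc k) p n = trans (at (P.*-assoc X (X P.^ k) p) _) (trans (coeff-X*-suc _ (k ℕ.+ n)) (coeff-X^*-+ k p n))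

  coeff-X^*-< : ∀ {k n} → n < k → ∀ p → coeff (X P.^ k P.* p) n ≈ 0#
  coeff-X^*-< {suc k} {zero} _ p = trans (at (P.*-assoc X (X P.^ k) p) 0) (coeff-X*-0 _)
  coeff-X^*-< {suc k} {suc n} (s≤s n<k) p = trans (at (P.*-assoc X (X P.^ k) p) (suc n)) (trans (coeff-X*-suc _ n) (coeff-X^*-< n<k p))

  X^∣⇒coeff≈0 : ∀ {k p} → X P.^ k P.∣ p → ∀ n → n < k → coeff p n ≈ 0#
  X^∣⇒coeff≈0 (q , e) n n<k = trans (at e n) (coeff-X^*-< n<k q)

  coeff≈0⇒X^∣ : ∀ k p → (∀ n → n < k → coeff p n ≈ 0#) → X P.^ k P.∣ p
  coeff≈0⇒X^∣ zero p e = p , P.sym (P.*-identityˡ p)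
  coeff≈0⇒X^∣ (suc k) [] e = P.∣0
  coeff≈0⇒X^∣ (suc k) (a ∷ p) e with coeff≈0⇒X^∣ k p (λ n n<k → e (suc n) (s≤s n<k))
  ... | q , e′ = q , (begin⟨ P.setoid ⟩
    a ∷ p ≈⟨ ∷-split a p ⟩
    C a P.+ X P.* p ≈⟨ P.+-congʳ (Hom.cong C-hom (e 0 (s≤s z≤n))) ⟩
    C 0# P.+ X P.* p ≈⟨ P.+-congʳ (Hom.0-homo C-hom) ⟩
    P.0# P.+ X P.* p ≈⟨ P.+-identityˡ _ ⟩
    X P.* p ≈⟨ P.*-congˡ e′ ⟩
    X P.* (X P.^ k P.* q) ≈⟨ P.*-assoc _ _ _ ⟨
    X P.^ suc k P.* q ∎)

  -- degree less than n
  infix 4 _≺_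
  record _≺_ (p : Poly) (n : ℕ) : Set where
    constructor bound
    field vanish : ∀ i → n ≤ i → coeff p i ≈ 0#
  open _≺_ public

  ≺-cong : ∀ {p q n} → p ≋ q → p ≺ n → q ≺ n
  ≺-cong e b = bound λ i le → trans (sym (at e i)) (vanish b i le)

  ≺-mono : ∀ {p m n} → m ≤ n → p ≺ m → p ≺ n
  ≺-mono m≤n b = bound λ i le → vanish b i (ℕP.≤-trans m≤n le)

  ≺-0 : ∀ {n} → P.0# ≺ n
  ≺-0 = bound λ i _ → refl

  ≺0⇒≋0 : ∀ {p} → p ≺ 0 → p ≋ P.0#
  ≺0⇒≋0 b = ext λ n → vanish b n z≤n

  ≺-+ : ∀ {p q n} → p ≺ n → q ≺ n → p P.+ q ≺ n
  ≺-+ {p} {q} b b′ = bound λ i le → trans (coeff-⊕ p q i) (trans (+-cong (vanish b i le) (vanish b′ i le)) (+-identityˡ _))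

  ≺-neg : ∀ {p n} → p ≺ n → P.- p ≺ n
  ≺-neg {p} b = bound λ i le → trans (coeff-neg p i) (trans (-‿cong (vanish b i le)) -0≈0)

  ≺-∑ : ∀ {n} m {f : ℕ → Poly} → (∀ i → i < m → f i ≺ n) → P.∑ m f ≺ n
  ≺-∑ zero b = ≺-0
  ≺-∑ (suc m) {f} b = ≺-+ (b 0 (s≤s z≤n)) (≺-∑ m λ i i<m → b (suc i) (s≤s i<m))

  -- Degree less than `a` times degree at most `b`: the asymmetric form avoids subtracting 1 from a
  -- sum of strict bounds and covers `a = 0`.
  ≺-* : ∀ {p q} a b → p ≺ a → q ≺ suc b → p P.* q ≺ a ℕ.+ b
  ≺-* {p} {q} a b bp bq = bound λ i le → trans (coeff-⊛ p q i) (conv-vanish a b (vanish bp) (vanish bq) i le)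

  ≺-C : ∀ {a} → C a ≺ 1
  ≺-C = bound λ { (suc i) _ → refl }

  ≺-X : X ≺ 2
  ≺-X = bound λ { (suc (suc i)) _ → refl ; (suc zero) (s≤s ()) }

  ≺-^ : ∀ {p} d n → p ≺ suc d → p P.^ n ≺ suc (n ℕ.* d)
  ≺-^ d zero b = ≺-C
  ≺-^ {p} d (suc n) b = ≺-* (suc d) (n ℕ.* d) b (≺-^ d n b)

  coeff-top : ∀ {p q} a b → p ≺ suc a → q ≺ suc b → coeff (p P.* q) (a ℕ.+ b) ≈ coeff p a * coeff q b
  coeff-top {p} {q} a b bp bq = trans (coeff-⊛ p q (a ℕ.+ b)) (conv-top a b (vanish bp) (vanish bq))

  ≺-length : ∀ p → p ≺ length p
  ≺-length p = bound (go p)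
    where
    go : ∀ p i → length p ≤ i → coeff p i ≈ 0#
    go [] i _ = refl
    go (a ∷ p) (suc i) (s≤s le) = go p i le

  ≺-pred : ∀ {p n} → p ≺ suc n → coeff p n ≈ 0# → p ≺ n
  ≺-pred {p} {n} b e = bound go
    where
    go : ∀ i → n ≤ i → coeff p i ≈ 0#
    go i le with ℕP.m≤n⇒m<n∨m≡n le
    ... | inj₁ n<i = vanish b i n<i
    ... | inj₂ ≡.refl = e

  opaque
    D : Poly → Poly
    D [] = []
    D (a ∷ p) = p ⊕ (0# ∷ D p)

    coeff-D : ∀ p n → coeff (D p) n ≈ ι (suc n) * coeff p (suc n)
    coeff-D [] n = sym (zeroʳ _)
    coeff-D (a ∷ p) zero = trans (coeff-⊕ p (0# ∷ D p) 0) (trans (+-identityʳ _) (sym (trans (*-congʳ (+-identityʳ 1#)) (*-identityˡ _))))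
    coeff-D (a ∷ p) (suc n) = begin⟨ setoid ⟩
      coeff (D (a ∷ p)) (suc n) ≈⟨ coeff-⊕ p (0# ∷ D p) (suc n) ⟩
      coeff p (suc n) + coeff (D p) n ≈⟨ +-congˡ (coeff-D p n) ⟩
      coeff p (suc n) + ι (suc n) * coeff p (suc n) ≈⟨ solve 2 (λ a b → a :+ b :* a := (a :^ 0 :+ b) :* a) refl _ _ ⟩
      (1# + ι (suc n)) * coeff p (suc n) ∎

  D-cong : ∀ {p q} → p ≋ q → D p ≋ D q
  D-cong {p} {q} e = ext λ n → trans (coeff-D p n) (trans (*-congˡ (at e (suc n))) (sym (coeff-D q n)))

  D-+ : ∀ p q → D (p P.+ q) ≋ D p P.+ D q
  D-+ p q = ext λ n → begin⟨ setoid ⟩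
    coeff (D (p P.+ q)) n ≈⟨ coeff-D (p P.+ q) n ⟩
    ι (suc n) * coeff (p P.+ q) (suc n) ≈⟨ *-congˡ (coeff-⊕ p q (suc n)) ⟩
    ι (suc n) * (coeff p (suc n) + coeff q (suc n)) ≈⟨ distribˡ _ _ _ ⟩
    _ ≈⟨ +-cong (coeff-D p n) (coeff-D q n) ⟨
    coeff (D p) n + coeff (D q) n ≈⟨ coeff-⊕ (D p) (D q) n ⟨
    coeff (D p P.+ D q) n ∎

  D-C : ∀ a → D (C a) ≋ P.0#
  D-C a = ext λ n → trans (coeff-D (C a) n) (zeroʳ _)

  D-C* : ∀ a p → D (C a P.* p) ≋ C a P.* D p
  D-C* a p = ext λ n → begin⟨ setoid ⟩
    coeff (D (C a P.* p)) n ≈⟨ coeff-D _ n ⟩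
    ι (suc n) * coeff (C a P.* p) (suc n) ≈⟨ *-congˡ (coeff-C* a p _) ⟩
    ι (suc n) * (a * coeff p (suc n)) ≈⟨ solve 3 (λ a b c → a :* (b :* c) := b :* (a :* c)) refl _ _ _ ⟩
    a * (ι (suc n) * coeff p (suc n)) ≈⟨ *-congˡ (coeff-D p n) ⟨
    a * coeff (D p) n ≈⟨ coeff-C* a (D p) n ⟨
    coeff (C a P.* D p) n ∎

  0∷ : ∀ p → 0# ∷ p ≋ X P.* p
  0∷ p = P.trans (∷-split 0# p) (P.trans (P.+-congʳ (Hom.0-homo C-hom)) (P.+-identityˡ _))

  D-∷ : ∀ a p → D (a ∷ p) ≋ p P.+ X P.* D p
  D-∷ a p = P.trans (ext λ n → trans (coeff-D (a ∷ p) n) (trans (lem n) (sym (coeff-⊕ p (0# ∷ D p) n)))) (P.+-congˡ (0∷ (D p)))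
    where
    lem : ∀ n → ι (suc n) * coeff p n ≈ coeff p n + coeff (0# ∷ D p) n
    lem zero = trans (*-congʳ (+-identityʳ 1#)) (trans (*-identityˡ _) (sym (+-identityʳ _)))
    lem (suc n) = trans (solve 2 (λ a b → (a :^ 0 :+ b) :* a := a :+ b :* a) refl _ _) (+-congˡ (sym (coeff-D p n)))

  D-0 : D P.0# ≋ P.0#
  D-0 = ext λ n → trans (coeff-D P.0# n) (zeroʳ _)

  D-X : D X ≋ P.1#
  D-X = ext λ { zero → trans (coeff-D X 0) (trans (*-identityʳ _) (+-identityʳ 1#)) ; (suc n) → trans (coeff-D X (suc n)) (zeroʳ _) }

  D-X* : ∀ p → D (X P.* p) ≋ p P.+ X P.* D p
  D-X* p = P.trans (D-cong (P.sym (0∷ p))) (D-∷ 0# p)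

  D-* : ∀ p q → D (p P.* q) ≋ D p P.* q P.+ p P.* D q
  D-* [] q = begin⟨ P.setoid ⟩
    D (P.0# P.* q) ≈⟨ D-cong (P.zeroˡ q) ⟩
    D P.0# ≈⟨ D-0 ⟩
    P.0# ≈⟨ P.trans (P.+-cong (P.trans (P.*-congʳ D-0) (P.zeroˡ q)) (P.zeroˡ (D q))) (P.+-identityˡ _) ⟨
    D P.0# P.* q P.+ P.0# P.* D q ∎
  D-* (a ∷ p) q = begin⟨ P.setoid ⟩
    D ((a ∷ p) P.* q) ≈⟨ D-cong (P.trans (P.*-congʳ (∷-split a p)) (P.solve 4 (λ a x p q → (a P.:+ x P.:* p) P.:* q P.:= a P.:* q P.:+ x P.:* (p P.:* q)) P.refl (C a) X p q)) ⟩
    D (C a P.* q P.+ X P.* (p P.* q)) ≈⟨ D-+ (C a P.* q) (X P.* (p P.* q)) ⟩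
    D (C a P.* q) P.+ D (X P.* (p P.* q)) ≈⟨ P.+-cong (D-C* a q) (D-X* (p P.* q)) ⟩
    C a P.* D q P.+ (p P.* q P.+ X P.* D (p P.* q)) ≈⟨ P.+-congˡ (P.+-congˡ (P.*-congˡ (D-* p q))) ⟩
    C a P.* D q P.+ (p P.* q P.+ X P.* (D p P.* q P.+ p P.* D q))
      ≈⟨ P.solve 6 (λ a x p q p′ q′ → a P.:* q′ P.:+ (p P.:* q P.:+ x P.:* (p′ P.:* q P.:+ p P.:* q′)) P.:= (p P.:+ x P.:* p′) P.:* q P.:+ (a P.:+ x P.:* p) P.:* q′) P.refl (C a) X p q (D p) (D q) ⟩
    (p P.+ X P.* D p) P.* q P.+ (C a P.+ X P.* p) P.* D q ≈⟨ P.+-cong (P.*-congʳ (D-∷ a p)) (P.*-congʳ (∷-split a p)) ⟨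
    D (a ∷ p) P.* q P.+ (a ∷ p) P.* D q ∎

  D-^ : ∀ p n → D (p P.^ suc n) ≋ P.ι (suc n) P.* (p P.^ n P.* D p)
  D-^ p zero = P.trans (D-* p P.1#) (P.trans (P.+-congˡ (P.*-congˡ (D-C 1#)))
    (P.solve 2 (λ p p′ → p′ P.:* p P.:^ 0 P.:+ p P.:* P.con (+ 0) P.:= (p P.:^ 0 P.:+ P.con (+ 0)) P.:* (p P.:^ 0 P.:* p′)) P.refl p (D p)))
  D-^ p (suc n) = begin⟨ P.setoid ⟩
    D (p P.* p P.^ suc n) ≈⟨ D-* p _ ⟩
    D p P.* p P.^ suc n P.+ p P.* D (p P.^ suc n) ≈⟨ P.+-congˡ (P.*-congˡ (D-^ p n)) ⟩
    D p P.* (p P.* p P.^ n) P.+ p P.* (P.ι (suc n) P.* (p P.^ n P.* D p))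
      ≈⟨ P.solve 4 (λ p p′ q k → p′ P.:* (p P.:* q) P.:+ p P.:* (k P.:* (q P.:* p′)) P.:= (p P.:^ 0 P.:+ k) P.:* ((p P.:* q) P.:* p′)) P.refl p (D p) (p P.^ n) (P.ι (suc n)) ⟩
    P.ι (suc (suc n)) P.* (p P.^ suc n P.* D p) ∎

module Evaluation {R S : CommutativeRing 0ℓ 0ℓ} (φ : Hom R S) (s : CommutativeRing.Carrier S) where
  private
    module R = RingTheory R
    module S = RingTheory S
    module φ = Hom φ
  open PolyTheory R

  ev : Poly → S.Carrier
  ev [] = S.0#
  ev (a ∷ p) = φ.⟦ a ⟧ S.+ s S.* ev p

  private
    ev-0 : ∀ p → (∀ n → coeff p n R.≈ R.0#) → ev p S.≈ S.0#
    ev-0 [] e = S.refl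
    ev-0 (a ∷ p) e = S.trans (S.+-cong (S.trans (φ.cong (e 0)) φ.0-homo) (S.trans (S.*-congˡ (ev-0 p (e ∘ suc))) (S.zeroʳ s))) (S.+-identityˡ _)

    ev-cong : ∀ p q → (∀ n → coeff p n R.≈ coeff q n) → ev p S.≈ ev q
    ev-cong [] q e = S.sym (ev-0 q (R.sym ∘ e))
    ev-cong (a ∷ p) [] e = ev-0 (a ∷ p) e
    ev-cong (a ∷ p) (b ∷ q) e = S.+-cong (φ.cong (e 0)) (S.*-congˡ (ev-cong p q (e ∘ suc)))

    opaque
      unfolding _⊕_

      ev-+ : ∀ p q → ev (p ⊕ q) S.≈ ev p S.+ ev q
      ev-+ [] q = S.sym (S.+-identityˡ _)
      ev-+ (a ∷ p) [] = S.sym (S.+-identityʳ _)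
      ev-+ (a ∷ p) (b ∷ q) = S.trans (S.+-cong (φ.+-homo a b) (S.*-congˡ (ev-+ p q)))
        (S.solve 5 (λ a b x p q → (a S.:+ b) S.:+ x S.:* (p S.:+ q) S.:= (a S.:+ x S.:* p) S.:+ (b S.:+ x S.:* q)) S.refl _ _ s _ _)

      ev-scale : ∀ a q → ev (map (a R.*_) q) S.≈ φ.⟦ a ⟧ S.* ev q
      ev-scale a [] = S.sym (S.zeroʳ _)
      ev-scale a (b ∷ q) = S.trans (S.+-cong (φ.*-homo a b) (S.*-congˡ (ev-scale a q)))
        (S.solve 4 (λ a b x q → a S.:* b S.:+ x S.:* (a S.:* q) S.:= a S.:* (b S.:+ x S.:* q)) S.refl _ _ s _)

      ev-* : ∀ p q → ev (p ⊛ q) S.≈ ev p S.* ev q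
      ev-* [] q = S.sym (S.zeroˡ _)
      ev-* (a ∷ p) q = begin⟨ S.setoid ⟩
        ev (map (a R.*_) q ⊕ (R.0# ∷ (p ⊛ q))) ≈⟨ ev-+ (map (a R.*_) q) _ ⟩
        ev (map (a R.*_) q) S.+ (φ.⟦ R.0# ⟧ S.+ s S.* ev (p ⊛ q)) ≈⟨ S.+-cong (ev-scale a q) (S.+-cong φ.0-homo (S.*-congˡ (ev-* p q))) ⟩
        φ.⟦ a ⟧ S.* ev q S.+ (S.0# S.+ s S.* (ev p S.* ev q))
          ≈⟨ S.solve 4 (λ a q x p → a S.:* q S.:+ (S.con (+ 0) S.:+ x S.:* (p S.:* q)) S.:= (a S.:+ x S.:* p) S.:* q) S.refl _ _ s _ ⟩
        (φ.⟦ a ⟧ S.+ s S.* ev p) S.* ev q ∎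

  ev-hom : Hom (R [X]) S
  ev-hom = record
    { ⟦_⟧ = ev ; cong = λ {p} {q} e → ev-cong p q (at e) ; +-homo = ev-+ ; *-homo = ev-*
    ; 1-homo = S.trans (S.+-cong φ.1-homo (S.zeroʳ s)) (S.+-identityʳ _) }

  ev-C : ∀ a → ev (C a) S.≈ φ.⟦ a ⟧
  ev-C a = S.trans (S.+-congˡ (S.zeroʳ s)) (S.+-identityʳ _)

  ev-X : ev X S.≈ s
  ev-X = begin⟨ S.setoid ⟩
    φ.⟦ R.0# ⟧ S.+ s S.* ev (C R.1#) ≈⟨ S.+-cong φ.0-homo (S.*-congˡ (S.trans (ev-C R.1#) φ.1-homo)) ⟩
    S.0# S.+ s S.* S.1# ≈⟨ S.trans (S.+-identityˡ _) (S.*-identityʳ _) ⟩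
    s ∎

  -- The universal property of the polynomial ring. It reduces every identity between substitutions
  -- to a check on constants and on `X`.
  ev-unique : (h : Hom (R [X]) S) → (∀ a → Hom.⟦ h ⟧ (C a) S.≈ φ.⟦ a ⟧) → Hom.⟦ h ⟧ X S.≈ s → ∀ p → Hom.⟦ h ⟧ p S.≈ ev p
  ev-unique h eC eX [] = Hom.0-homo h
  ev-unique h eC eX (a ∷ p) = begin⟨ S.setoid ⟩
    h.⟦ a ∷ p ⟧ ≈⟨ h.cong (∷-split a p) ⟩
    h.⟦ C a P.+ X P.* p ⟧ ≈⟨ h.+-homo (C a) (X P.* p) ⟩
    h.⟦ C a ⟧ S.+ h.⟦ X P.* p ⟧ ≈⟨ S.+-cong (eC a) (S.trans (h.*-homo X p) (S.*-cong eX (ev-unique h eC eX p))) ⟩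
    φ.⟦ a ⟧ S.+ s S.* ev p ∎
    where module h = Hom h

module _ {R S : CommutativeRing 0ℓ 0ℓ} (φ : Hom R S) where
  private
    module R = PolyTheory R
    module S = RingTheory S
    module SX = PolyTheory S
    module φ = Hom φ

  coeff-map-hom : ∀ p n → SX.coeff (map φ.⟦_⟧ p) n S.≈ φ.⟦ R.coeff p n ⟧
  coeff-map-hom [] n = S.sym φ.0-homo
  coeff-map-hom (a ∷ p) zero = S.refl
  coeff-map-hom (a ∷ p) (suc n) = coeff-map-hom p n

  private
    conv-hom : ∀ f g n → φ.⟦ Convolution.conv R f g n ⟧ S.≈ Convolution.conv S (φ.⟦_⟧ ∘ f) (φ.⟦_⟧ ∘ g) n
    conv-hom f g zero = φ.*-homo _ _
    conv-hom f g (suc n) = S.trans (φ.+-homo _ _) (S.+-cong (φ.*-homo _ _) (conv-hom (f ∘ suc) g n))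

  map-hom : Hom (R [X]) (S [X])
  map-hom = record
    { ⟦_⟧ = map φ.⟦_⟧
    ; cong = λ {p} {q} e → SX.ext λ n → S.trans (coeff-map-hom p n) (S.trans (φ.cong (R.at e n)) (S.sym (coeff-map-hom q n)))
    ; +-homo = λ p q → SX.ext λ n → S.trans (coeff-map-hom (p R.⊕ q) n) (S.trans (φ.cong (R.coeff-⊕ p q n)) (S.trans (φ.+-homo _ _)
        (S.sym (S.trans (SX.coeff-⊕ (map φ.⟦_⟧ p) (map φ.⟦_⟧ q) n) (S.+-cong (coeff-map-hom p n) (coeff-map-hom q n))))))
    ; *-homo = λ p q → SX.ext λ n → S.trans (coeff-map-hom (p R.⊛ q) n) (S.trans (φ.cong (R.coeff-⊛ p q n)) (S.trans (conv-hom (R.coeff p) (R.coeff q) n)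
        (S.sym (S.trans (SX.coeff-⊛ (map φ.⟦_⟧ p) (map φ.⟦_⟧ q) n) (Convolution.conv-cong S (coeff-map-hom p) (coeff-map-hom q) n)))))
    ; 1-homo = Hom.cong SX.C-hom φ.1-homo }

-- Polynomials over a field

record IsDiscreteField (R : CommutativeRing 0ℓ 0ℓ) : Set where
  open CommutativeRing R
  field
    -- Points are counted in lists without repetition, where membership and uniqueness refer to `≡`.
    ≈⇒≡ : ∀ {x y} → x ≈ y → x ≡ y
    _≟_ : ∀ x y → Dec (x ≈ y)
    0≉1 : ¬ 0# ≈ 1#
    inverse : ∀ x → ¬ x ≈ 0# → ∃ λ y → x * y ≈ 1#

module FieldTheory (R : CommutativeRing 0ℓ 0ℓ) (isField : IsDiscreteField R) where
  open RingTheory R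
  open PolyTheory R
  open IsDiscreteField isField public

  inv : ∀ x → ¬ x ≈ 0# → Carrier
  inv x x≉0 = proj₁ (inverse x x≉0)

  *-inv : ∀ x x≉0 → x * inv x x≉0 ≈ 1#
  *-inv x x≉0 = proj₂ (inverse x x≉0)

  *-cancel-0 : ∀ {x y} → ¬ x ≈ 0# → x * y ≈ 0# → y ≈ 0#
  *-cancel-0 {x} {y} x≉0 e = begin⟨ setoid ⟩
    y ≈⟨ *-identityˡ y ⟨
    1# * y ≈⟨ *-congʳ (*-inv x x≉0) ⟨
    x * x⁻¹ * y ≈⟨ solve 3 (λ x i y → x :* i :* y := i :* (x :* y)) refl x x⁻¹ y ⟩
    x⁻¹ * (x * y) ≈⟨ *-congˡ e ⟩
    x⁻¹ * 0# ≈⟨ zeroʳ _ ⟩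
    0# ∎
    where x⁻¹ = inv x x≉0

  *≉0 : ∀ {x y} → ¬ x ≈ 0# → ¬ y ≈ 0# → ¬ x * y ≈ 0#
  *≉0 x≉0 y≉0 e = y≉0 (*-cancel-0 x≉0 e)

  ^≉0 : ∀ {x} n → ¬ x ≈ 0# → ¬ x ^ n ≈ 0#
  ^≉0 zero x≉0 e = 0≉1 (sym e)
  ^≉0 (suc n) x≉0 = *≉0 x≉0 (^≉0 n x≉0)

  infix 4 _≉0
  _≉0 : Poly → Set
  p ≉0 = ¬ p ≋ P.0#

  HasDegree : Poly → ℕ → Set
  HasDegree p d = p ≺ suc d × ¬ coeff p d ≈ 0#

  degree : ∀ p → p ≋ P.0# ⊎ ∃ (HasDegree p)
  degree p = go (length p) (≺-length p)
    where
    go : ∀ n → p ≺ n → p ≋ P.0# ⊎ ∃ (HasDegree p)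
    go zero b = inj₁ (≺0⇒≋0 b)
    go (suc n) b with coeff p n ≟ 0#
    ... | yes e = go n (≺-pred b e)
    ... | no e = inj₂ (n , b , e)

  degree≥ : ∀ {p d n} → HasDegree p d → p ≺ n → d < n
  degree≥ {d = d} {n} (_ , e) b with d ℕP.<? n
  ... | yes d<n = d<n
  ... | no d≮n = ⊥-elim (e (vanish b d (ℕP.≮⇒≥ d≮n)))

  -- Descent on a bound for `v`: a top coefficient at or beyond `K` would survive in the product,
  -- because the leading coefficient of `f` is invertible.
  ≺-cancel : ∀ {f d} → HasDegree f d → ∀ {v} K → f P.* v ≺ d ℕ.+ K → v ≺ K
  ≺-cancel {f} {d} (bf , ef) {v} K b = go (length v) (≺-length v)
    where
    go : ∀ n → v ≺ n → v ≺ K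
    go zero bv = ≺-mono z≤n bv
    go (suc n) bv with suc n ℕP.≤? K
    ... | yes le = ≺-mono le bv
    ... | no nle = go n (≺-pred bv (*-cancel-0 ef (trans (sym (coeff-top d n bf bv)) (vanish b _ (ℕP.+-monoʳ-≤ d (ℕ.s≤s⁻¹ (ℕP.≰⇒> nle)))))))

  domain : ∀ {p q} → p P.* q ≋ P.0# → p ≋ P.0# ⊎ q ≋ P.0#
  domain {p} {q} e with degree p
  ... | inj₁ p≋0 = inj₁ p≋0
  ... | inj₂ (d , deg) = inj₂ (≺0⇒≋0 (≺-cancel deg 0 (≺-cong (P.sym e) ≺-0)))

  P-cancel : ∀ {p q r} → p ≉0 → p P.* q ≋ p P.* r → q ≋ r
  P-cancel {p} {q} {r} p≉0 e = [ (λ p≋0 → ⊥-elim (p≉0 p≋0)) , P.x-y≈0⇒x≈y ]′ (domain p[q-r]≋0)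
    where
    p[q-r]≋0 : p P.* (q P.- r) ≋ P.0#
    p[q-r]≋0 = P.trans (P.solve 3 (λ p q r → p P.:* (q P.:- r) P.:= p P.:* q P.:- p P.:* r) P.refl p q r) (P.x≈y⇒x-y≈0 e)

  degree⇒≉0 : ∀ {p d} → HasDegree p d → p ≉0
  degree⇒≉0 {d = d} (_ , e) p≋0 = e (at p≋0 d)

  P^≉0 : ∀ {p} n → p ≉0 → p P.^ n ≉0
  P^≉0 zero p≉0 e = 0≉1 (sym (at e 0))
  P^≉0 (suc n) p≉0 e with domain e
  ... | inj₁ e′ = p≉0 e′
  ... | inj₂ e′ = P^≉0 n p≉0 e′

  divMod : ∀ {f d} → HasDegree f (suc d) → ∀ g → ∃₂ λ Q r → g ≋ f P.* Q P.+ r × r ≺ suc d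
  divMod {f} {d} deg [] = P.0# , P.0# , P.sym (P.trans (P.+-identityʳ _) (P.zeroʳ f)) , ≺-0
  divMod {f} {d} (bf , ef) (a ∷ g) with divMod (bf , ef) g
  ... | Q , r , e , br = X P.* Q P.+ C c , r′ P.- C c P.* f , eq , ≺-pred b top
    where
    r′ = C a P.+ X P.* r
    c = coeff r d * inv (coeff f (suc d)) ef
    eq : a ∷ g ≋ f P.* (X P.* Q P.+ C c) P.+ (r′ P.- C c P.* f)
    eq = P.trans (∷-split a g) (P.trans (P.+-congˡ (P.*-congˡ e))
      (P.solve 6 (λ a x f q r c → a P.:+ x P.:* (f P.:* q P.:+ r) P.:= f P.:* (x P.:* q P.:+ c) P.:+ (a P.:+ x P.:* r P.:- c P.:* f)) P.refl (C a) X f Q r (C c)))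
    br′ : r′ ≺ suc (suc d)
    br′ = ≺-cong (∷-split a r) (bound λ { (suc i) (s≤s le) → vanish br i le })
    b : r′ P.- C c P.* f ≺ suc (suc d)
    b = ≺-+ br′ (≺-neg (≺-* 1 (suc d) ≺-C bf))
    top : coeff (r′ P.- C c P.* f) (suc d) ≈ 0#
    top = begin⟨ setoid ⟩
      coeff (r′ P.- C c P.* f) (suc d) ≈⟨ coeff-sub r′ (C c P.* f) (suc d) ⟩
      coeff r′ (suc d) - coeff (C c P.* f) (suc d) ≈⟨ +-cong (sym (at (∷-split a r) (suc d))) (-‿cong (coeff-C* c f (suc d))) ⟩
      coeff r d - coeff r d * inv _ ef * coeff f (suc d) ≈⟨ solve 3 (λ r i f → r :- r :* i :* f := r :* (r :^ 0 :- f :* i)) refl (coeff r d) (inv _ ef) (coeff f (suc d)) ⟩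
      coeff r d * (1# - coeff f (suc d) * inv _ ef) ≈⟨ *-congˡ (x≈y⇒x-y≈0 (sym (*-inv _ ef))) ⟩
      coeff r d * 0# ≈⟨ zeroʳ _ ⟩
      0# ∎

  Coprime : Poly → Poly → Set
  Coprime f g = ∃₂ λ a b → a P.* f P.+ b P.* g ≋ P.1#

  -- A square root of 0 modulo a separable f vanishes: if f v = r u then differentiating gives f ∣ r v,
  -- so u, v, … is a sequence of multiples of r/f whose degrees decrease.
  radical² : ∀ {f d} → HasDegree f (suc d) → Coprime f (D f) → ∀ g → f P.∣ g P.* g → f P.∣ g
  radical² {f} {d} deg (a , b , ab) g f∣g² =
    let Q , r , e , br = divMod deg g in
    P.∣-cong (P.sym e) (P.∣-+ (Q , P.refl) (P.∣-cong (P.sym (remainder Q r e br)) P.∣0))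
    where
    module _ (Q r : Poly) (e : g ≋ f P.* Q P.+ r) (br : r ≺ suc d) where
      f∣r² : f P.∣ r P.* r
      f∣r² = P.∣-cong (P.trans (P.+-cong (P.*-cong e e) P.refl)
        (P.solve 3 (λ f q r → (f P.:* q P.:+ r) P.:* (f P.:* q P.:+ r) P.:- f P.:* (q P.:* (f P.:* q P.:+ P.con (+ 2) P.:* r)) P.:= r P.:* r) P.refl f Q r))
        (P.∣-- f∣g² (Q P.* (f P.* Q P.+ P.ι 2 P.* r) , P.refl))
      next : ∀ u v → r P.* u ≋ f P.* v → f P.∣ r P.* v
      next u v e = P.∣-cong (P.trans (P.sym (P.solve 5 (λ a f b f′ w → (a P.:* f P.:+ b P.:* f′) P.:* w P.:= f P.:* (a P.:* w) P.:+ b P.:* (f′ P.:* w)) P.refl a f b (D f) (r P.* v)))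
          (P.trans (P.*-congʳ ab) (P.*-identityˡ _)))
        (P.∣-+ (a P.* (r P.* v) , P.refl) (P.∣-*ˡ b f∣f′rv))
        where
        deriv : D r P.* u P.+ r P.* D u ≋ D f P.* v P.+ f P.* D v
        deriv = P.trans (P.sym (D-* r u)) (P.trans (D-cong e) (D-* f v))
        f∣f′rv : f P.∣ D f P.* (r P.* v)
        f∣f′rv = P.∣-cong (begin⟨ P.setoid ⟩
          (D r P.* (r P.* u) P.+ D u P.* (r P.* r)) P.- f P.* (r P.* D v)
            ≈⟨ P.solve 6 (λ r r′ u u′ f v′ → (r′ P.:* (r P.:* u) P.:+ u′ P.:* (r P.:* r)) P.:- f P.:* (r P.:* v′) P.:= r P.:* (r′ P.:* u P.:+ r P.:* u′) P.:- f P.:* (r P.:* v′)) P.refl r (D r) u (D u) f (D v) ⟩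
          r P.* (D r P.* u P.+ r P.* D u) P.- f P.* (r P.* D v) ≈⟨ P.+-congʳ (P.*-congˡ deriv) ⟩
          r P.* (D f P.* v P.+ f P.* D v) P.- f P.* (r P.* D v)
            ≈⟨ P.solve 5 (λ r f f′ v v′ → r P.:* (f′ P.:* v P.:+ f P.:* v′) P.:- f P.:* (r P.:* v′) P.:= f′ P.:* (r P.:* v)) P.refl r f (D f) v (D v) ⟩
          D f P.* (r P.* v) ∎)
          (P.∣-- (P.∣-+ (P.∣-*ˡ (D r) (v , e)) (P.∣-*ˡ (D u) f∣r²)) (r P.* D v , P.refl))
      descent : ∀ n u → u ≺ n → f P.∣ r P.* u → u ≋ P.0# ⊎ r ≋ P.0#
      descent zero u bu _ = inj₁ (≺0⇒≋0 bu)
      descent (suc n) u bu (v , e) =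
        [ (λ v≋0 → swap (domain (P.trans e (P.trans (P.*-congˡ v≋0) (P.zeroʳ f))))) , inj₂ ]′
          (descent n v (≺-cancel deg n (≺-cong e (≺-* (suc d) n br bu))) (next u v e))
      remainder : r ≋ P.0#
      -- The descent starts from `u = r`, so both of its outcomes say that `r` vanishes.
      remainder = reduce (descent (length r) r (≺-length r) f∣r²)

  -- Squares suffice, since `g ^ n` divides `g ^ (2 ^ n)` and `radical²` undoes one squaring at a
  -- time.
  radical : ∀ {f d} → HasDegree f (suc d) → Coprime f (D f) → ∀ n g → f P.∣ g P.^ n → f P.∣ g
  radical {f} deg cop n g f∣gⁿ = go n g (P.∣-trans f∣gⁿ (P.∣-^ g (n≤2^n n)))
    where
    n≤2^n : ∀ n → n ≤ 2 ℕ.^ n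
    n≤2^n zero = z≤n
    n≤2^n (suc n) = ℕP.+-mono-≤ (ℕP.^-monoʳ-≤ 2 (z≤n {n})) (ℕP.≤-trans (n≤2^n n) (ℕP.m≤m+n (2 ℕ.^ n) 0))
    go : ∀ n g → f P.∣ g P.^ (2 ℕ.^ n) → f P.∣ g
    go zero g d = P.∣-cong (P.*-identityʳ g) d
    go (suc n) g d = radical² deg cop g (go n (g P.* g) (P.∣-cong (P.trans (P.sym (P.^-assocʳ g 2 (2 ℕ.^ n))) (P.^-congˡ (2 ℕ.^ n) (P.*-congˡ (P.*-identityʳ g)))) d))

  module At (x : Carrier) = Evaluation {R} id-hom x

  eval : Carrier → Poly → Carrier
  eval x = At.ev x

  lin : Carrier → Poly
  lin x = X P.- C x

  eval-lin : ∀ x y → eval y (lin x) ≈ y - x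
  eval-lin x y = trans (Hom.sub-homo (At.ev-hom y) X (C x)) (+-cong (At.ev-X y) (-‿cong (At.ev-C y x)))

  lin-degree : ∀ x → HasDegree (lin x) 1
  lin-degree x = ≺-+ ≺-X (≺-neg (≺-mono (s≤s z≤n) ≺-C)) ,
    λ e → 0≉1 (trans (sym e) (trans (coeff-sub X (C x) 1) (trans (+-congˡ -0≈0) (+-identityʳ _))))

  degree-^ : ∀ {p d} n → HasDegree p d → HasDegree (p P.^ n) (n ℕ.* d)
  degree-^ zero deg = ≺-C , λ e → 0≉1 (sym e)
  degree-^ {p} {d} (suc n) deg@(b , e) with degree-^ n deg
  ... | b′ , e′ = ≺-* (suc d) (n ℕ.* d) b b′ , λ e″ → *≉0 e e′ (trans (sym (coeff-top d (n ℕ.* d) b b′)) e″)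

  factor : ∀ x p → eval x p ≈ 0# → lin x P.∣ p
  factor x p px≈0 =
    let Q , r , e , br = divMod (lin-degree x) p in
    Q , P.trans e (P.trans (P.+-congˡ (remainder Q r e br)) (P.+-identityʳ _))
    where
    module _ (Q r : Poly) (e : p ≋ lin x P.* Q P.+ r) (br : r ≺ 1) where
      r≋C : r ≋ C (coeff r 0)
      r≋C = ext λ { zero → refl ; (suc i) → vanish br (suc i) (s≤s z≤n) }
      r0 : coeff r 0 ≈ 0#
      r0 = begin⟨ setoid ⟩
        coeff r 0 ≈⟨ At.ev-C x _ ⟨
        eval x (C (coeff r 0)) ≈⟨ Hom.cong (At.ev-hom x) r≋C ⟨
        eval x r ≈⟨ trans (+-congʳ (trans (*-congʳ (trans (eval-lin x x) (-‿inverseʳ x))) (zeroˡ (eval x Q)))) (+-identityˡ _) ⟨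
        eval x (lin x) * eval x Q + eval x r ≈⟨ +-congʳ (Hom.*-homo (At.ev-hom x) (lin x) Q) ⟨
        eval x (lin x P.* Q) + eval x r ≈⟨ Hom.+-homo (At.ev-hom x) (lin x P.* Q) r ⟨
        eval x (lin x P.* Q P.+ r) ≈⟨ Hom.cong (At.ev-hom x) e ⟨
        eval x p ≈⟨ px≈0 ⟩
        0# ∎
      remainder : r ≋ P.0#
      remainder = P.trans r≋C (P.trans (Hom.cong C-hom r0) (Hom.0-homo C-hom))

  -- One factor at a time: evaluation at `x` gives `(x - y) p(x) = 0`, hence `p(x) = 0`, and a
  -- factor `lin x` cancels on both sides.
  lin-coprime : ∀ {x y} → ¬ x ≈ y → ∀ l p → lin x P.^ l P.∣ lin y P.* p → lin x P.^ l P.∣ p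
  lin-coprime x≉y zero p _ = p , P.sym (P.*-identityˡ p)
  lin-coprime {x} {y} x≉y (suc l) p (u , e) =
    let p′ , e′ = factor x p (*-cancel-0 (λ e′ → x≉y (x-y≈0⇒x≈y e′)) px)
        w , e″ = lin-coprime x≉y l p′ (u , P-cancel (degree⇒≉0 (lin-degree x)) (shift p′ e′))
    in w , P.trans e′ (P.trans (P.*-congˡ e″) (P.sym (P.*-assoc _ _ _)))
    where
    px : (x - y) * eval x p ≈ 0#
    px = begin⟨ setoid ⟩
      (x - y) * eval x p ≈⟨ *-congʳ (eval-lin y x) ⟨
      eval x (lin y) * eval x p ≈⟨ Hom.*-homo (At.ev-hom x) (lin y) p ⟨
      eval x (lin y P.* p) ≈⟨ Hom.cong (At.ev-hom x) (P.trans e (P.*-assoc _ _ _)) ⟩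
      eval x (lin x P.* (lin x P.^ l P.* u)) ≈⟨ Hom.*-homo (At.ev-hom x) (lin x) _ ⟩
      eval x (lin x) * _ ≈⟨ trans (*-congʳ (trans (eval-lin x x) (-‿inverseʳ x))) (zeroˡ _) ⟩
      0# ∎
    shift : ∀ p′ → p ≋ lin x P.* p′ → lin x P.* (lin y P.* p′) ≋ lin x P.* (lin x P.^ l P.* u)
    shift p′ e′ = begin⟨ P.setoid ⟩
      lin x P.* (lin y P.* p′) ≈⟨ P.solve 3 (λ x y p → x P.:* (y P.:* p) P.:= y P.:* (x P.:* p)) P.refl (lin x) (lin y) p′ ⟩
      lin y P.* (lin x P.* p′) ≈⟨ P.*-congˡ e′ ⟨
      lin y P.* p ≈⟨ P.trans e (P.*-assoc _ _ _) ⟩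
      lin x P.* (lin x P.^ l P.* u) ∎

  lin-coprime-^ : ∀ {x y} → ¬ x ≈ y → ∀ l k p → lin x P.^ l P.∣ lin y P.^ k P.* p → lin x P.^ l P.∣ p
  lin-coprime-^ x≉y l zero p d = P.∣-cong (P.*-identityˡ p) d
  lin-coprime-^ x≉y l (suc k) p d = lin-coprime-^ x≉y l k p (lin-coprime x≉y l _ (P.∣-cong (P.*-assoc _ _ _) d))

  roots-bound : ∀ l {xs} → Unique xs → ∀ p → (∀ x → x ∈ xs → lin x P.^ l P.∣ p) → p ≺ length xs ℕ.* l → p ≋ P.0#
  roots-bound l [] p _ b = ≺0⇒≋0 b
  roots-bound l {x ∷ xs} (x∉xs ∷ uniq) p div b = let p′ , e = div x (here ≡.refl) in P.trans e (P.trans (P.*-congˡ (roots-bound l uniq p′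
      (λ y y∈xs → lin-coprime-^ (λ y≈x → All.lookup x∉xs y∈xs (≈⇒≡ (sym y≈x))) l l p′ (P.∣-cong e (div y (there y∈xs))))
      (≺-cancel (≡.subst (HasDegree (lin x P.^ l)) (ℕP.*-identityʳ l) (degree-^ l (lin-degree x))) _ (≺-cong e b))))
      (P.zeroʳ _))

  roots-bound₁ : ∀ {xs} → Unique xs → ∀ p → p ≉0 → (∀ x → x ∈ xs → eval x p ≈ 0#) → ∀ {n} → p ≺ suc n → length xs ≤ n
  roots-bound₁ {xs} uniq p p≉0 z {n} b with length xs ℕP.≤? n
  ... | yes le = le
  ... | no nle = ⊥-elim (p≉0 (roots-bound 1 uniq p
      (λ x x∈ → let c , e = factor x p (z x x∈) in c , P.trans e (P.*-congʳ (P.sym (P.*-identityʳ _))))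
      (≺-mono (ℕP.≤-trans (ℕP.≰⇒> nle) (ℕP.≤-reflexive (≡.sym (ℕP.*-identityʳ _)))) b)))

-- Independence of the terms of the auxiliary polynomial

module _ (R : CommutativeRing 0ℓ 0ℓ) where
  open RingTheory R

  ∣-isolate : ∀ {e} m (t : ℕ → Carrier) i → i < m → e ∣ ∑ m t → (∀ j → j < m → j ≢ i → e ∣ t j) → e ∣ t i
  ∣-isolate (suc m) t zero i<m d d′ = ∣-cong (solve 2 (λ a b → (a :+ b) :- b := a) refl _ _)
    (∣-- d (∣-∑ m (t ∘ suc) λ j j<m → d′ (suc j) (s≤s j<m) λ ()))
    where
    ∣-∑ : ∀ {e} m (t : ℕ → Carrier) → (∀ j → j < m → e ∣ t j) → e ∣ ∑ m t
    ∣-∑ zero t d = ∣0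
    ∣-∑ (suc m) t d = ∣-+ (d 0 (s≤s z≤n)) (∣-∑ m (t ∘ suc) λ j j<m → d (suc j) (s≤s j<m))
  ∣-isolate (suc m) t (suc i) (s≤s i<m) d d′ = ∣-isolate m (t ∘ suc) i i<m
    (∣-cong (solve 2 (λ a b → (a :+ b) :- a := b) refl _ _) (∣-- d (d′ 0 (s≤s z≤n) λ ())))
    (λ j j<m j≢i → d′ (suc j) (s≤s j<m) (j≢i ∘ ℕP.suc-injective))

module _ {R S : CommutativeRing 0ℓ 0ℓ} (ψ : Hom R S) where
  private
    module R = PolyTheory R
    module S = PolyTheory S
    module SR = RingTheory S

  C∘_ : Hom R (S [X])
  C∘_ = S.C-hom ∘ʰ ψ

  ev-≺ : ∀ {s} → s S.≺ 2 → ∀ G {c} → G R.≺ c → Evaluation.ev C∘_ s G S.≺ c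
  ev-≺ b [] _ = S.≺-0
  ev-≺ {s} b (a ∷ G) {zero} bG = S.≺-cong (S.P.sym (S.P.trans (E.cong (R.≺0⇒≋0 bG)) E.0-homo)) S.≺-0
    where module E = Hom (Evaluation.ev-hom C∘_ s)
  ev-≺ {s} b (a ∷ G) {suc c} bG = S.≺-+ (S.≺-mono (s≤s z≤n) S.≺-C)
    (S.≺-cong (S.P.*-comm _ s) (≡.subst (Evaluation.ev C∘_ s G S.P.* s S.≺_) (ℕP.+-comm c 1)
      (S.≺-* c 1 (ev-≺ b G (R.bound λ i le → R.vanish bG (suc i) (s≤s le))) b)))

  ev-X≋map : ∀ G → Evaluation.ev C∘_ S.X G S.≋ Hom.⟦ map-hom ψ ⟧ G
  ev-X≋map G = S.P.sym (Evaluation.ev-unique C∘_ S.X (map-hom ψ) (λ _ → S.P.refl)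
    (S.ext λ { zero → Hom.0-homo ψ ; (suc zero) → Hom.1-homo ψ ; (suc (suc _)) → SR.refl }) G)

hom-ext-mod : ∀ {R S : CommutativeRing 0ℓ 0ℓ} (let open PolyTheory R; module S = RingTheory S) (g h : Hom (R [X]) S) {e} →
              (∀ a → e S.∣ Hom.⟦ g ⟧ (C a) S.- Hom.⟦ h ⟧ (C a)) → e S.∣ Hom.⟦ g ⟧ X S.- Hom.⟦ h ⟧ X →
              ∀ p → e S.∣ Hom.⟦ g ⟧ p S.- Hom.⟦ h ⟧ p
hom-ext-mod {R} {S} g h {e} eC eX = go
  where
  open PolyTheory R
  module S = RingTheory S
  module g = Hom g
  module h = Hom h
  split : (k : Hom (R [X]) S) → ∀ a p → Hom.⟦ k ⟧ (a ∷ p) S.≈ Hom.⟦ k ⟧ (C a) S.+ Hom.⟦ k ⟧ X S.* Hom.⟦ k ⟧ p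
  split k a p = S.trans (Hom.cong k (∷-split a p)) (S.trans (Hom.+-homo k (C a) (X P.* p)) (S.+-congˡ (Hom.*-homo k X p)))
  go : ∀ p → e S.∣ g.⟦ p ⟧ S.- h.⟦ p ⟧
  go [] = S.∣-cong (S.sym (S.x≈y⇒x-y≈0 (S.trans g.0-homo (S.sym h.0-homo)))) S.∣0
  go (a ∷ p) = S.∣-cong (S.trans
      (S.solve 6 (λ a b x y p q → (a S.:- b) S.:+ (p S.:* (x S.:- y) S.:+ y S.:* (p S.:- q)) S.:= (a S.:+ x S.:* p) S.:- (b S.:+ y S.:* q)) S.refl
        g.⟦ C a ⟧ h.⟦ C a ⟧ g.⟦ X ⟧ h.⟦ X ⟧ g.⟦ p ⟧ h.⟦ p ⟧)
      (S.sym (S.+-cong (split g a p) (S.-‿cong (split h a p)))))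
    (S.∣-+ (eC a) (S.∣-+ (S.∣-*ˡ _ eX) (S.∣-*ˡ _ (go p))))

-- If f ^ c divides Σ γₐ^q X^a with c terms, c ≤ q, then the Taylor expansion of the sum at X + ε, modulo ε^c and f,
-- is Σ γₐ^q (X + ε)^a; it has degree less than c in ε, so it vanishes, and so do the γₐ^q modulo f.
module Taylor (R Q : CommutativeRing 0ℓ 0ℓ) (quot : Hom (R [X]) Q) (f : CommutativeRing.Carrier (R [X]))
  (f≈0 : CommutativeRing._≈_ Q (Hom.⟦ quot ⟧ f) (CommutativeRing.0# Q))
  {p} (pr : Prime p) (P-ch : RingTheory.CharP (R [X]) p) (k : ℕ) where
  open PolyTheory R
  private
    module PP = PolyTheory (R [X])
    module Qε = PolyTheory Q
    module Q = RingTheory Q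
    module quot = Hom quot
    q = p ℕ.^ k
    ε = Qε.X

  frob : Hom (R [X]) (R [X])
  frob = frobenius-hom (R [X]) pr P-ch k

  module E = Evaluation frob X

  private
    x : Q.Carrier
    x = quot.⟦ X ⟧

    x+ε : Qε.Poly
    x+ε = Qε.C x Qε.P.+ ε

    module T = Evaluation (Qε.C-hom ∘ʰ quot ∘ʰ C-hom) x+ε
    module T-hom = Hom T.ev-hom
    module Ev0 = Evaluation {Q} id-hom Q.0#
    module Ev0-hom = Hom Ev0.ev-hom

    Ev0≈coeff : ∀ h → Ev0.ev h Q.≈ Qε.coeff h 0
    Ev0≈coeff [] = Q.refl
    Ev0≈coeff (a ∷ h) = Q.trans (Q.+-congˡ (Q.zeroˡ _)) (Q.+-identityʳ a)

    -- Setting `ε = 0` in the Taylor expansion gives back the reduction of `g`; both are the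
    -- substitution of `x` for `X`.
    T-const : ∀ g → Qε.coeff (T.ev g) 0 Q.≈ quot.⟦ g ⟧
    T-const g = Q.trans (Q.sym (Ev0≈coeff (T.ev g))) (Q.trans
      (Evaluation.ev-unique (quot ∘ʰ C-hom) x (Ev0.ev-hom ∘ʰ T.ev-hom) (λ a → Q.trans (Ev0-hom.cong (T.ev-C a)) (Ev0.ev-C _))
        (Q.trans (Ev0-hom.cong T.ev-X) (Q.trans (Ev0-hom.+-homo (Qε.C x) ε) (Q.trans (Q.+-cong (Ev0.ev-C x) Ev0.ev-X) (Q.+-identityʳ x)))) g)
      (Q.sym (Evaluation.ev-unique (quot ∘ʰ C-hom) x quot (λ _ → Q.refl) Q.refl g)))

    ε∣ : ∀ h → Qε.coeff h 0 Q.≈ Q.0# → ε Qε.P.∣ h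
    ε∣ h e = Qε.P.∣-trans (Qε.P.1# , Qε.P.refl) (Qε.coeff≈0⇒X^∣ 1 h λ { zero _ → e ; (suc _) (s≤s ()) })

    ε^∣ : ∀ n h → ε Qε.P.∣ h → ε Qε.P.^ n Qε.P.∣ h Qε.P.^ n
    ε^∣ n h (w , e) = w Qε.P.^ n , Qε.P.trans (Qε.P.^-congˡ n e) (Qε.P.^-distrib-* ε w n)

    C-quot : Hom (R [X]) (Q [X])
    C-quot = Qε.C-hom ∘ʰ quot

    -- By Frobenius, the difference is the `q`-th power of `T g` minus its constant term, which is
    -- divisible by `ε`. So `q`-th powers are constants modulo `ε ^ q`.
    εq : ∀ g → ε Qε.P.^ q Qε.P.∣ T.ev (g P.^ q) Qε.P.- Qε.C quot.⟦ g P.^ q ⟧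
    εq g = Qε.P.∣-cong (Qε.P.trans (Hom.sub-homo frobε (T.ev g) (Qε.C quot.⟦ g ⟧))
        (Qε.P.sym (Qε.P.+-cong (T-hom.^-homo g q) (Qε.P.-‿cong (Hom.^-homo C-quot g q)))))
      (ε^∣ q (T.ev g Qε.P.- Qε.C quot.⟦ g ⟧) (ε∣ _ (Q.trans (Qε.coeff-sub (T.ev g) (Qε.C quot.⟦ g ⟧) 0) (Q.x≈y⇒x-y≈0 (T-const g)))))
      where
      frobε : Hom (Q [X]) (Q [X])
      frobε = frobenius-hom (Q [X]) pr (Hom.CharP-homo C-quot {p} P-ch) k

    U-coeff : Hom (R [X]) Q
    U-coeff = quot ∘ʰ frob

    -- The expansion with every `γ^q` frozen at `ε = 0`: a polynomial in `x + ε` over `Q`, whose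
    -- degree in `ε` is therefore less than `c`.
    module U = Evaluation (C∘ U-coeff) x+ε

  module _ {c} (c≤q : c ≤ q) (G : PP.Poly) (bG : G PP.≺ c) (d : f P.^ c P.∣ E.ev G) where
    private
      T∘E≈U : ε Qε.P.^ c Qε.P.∣ T.ev (E.ev G) Qε.P.- U.ev G
      T∘E≈U = hom-ext-mod (T.ev-hom ∘ʰ E.ev-hom) U.ev-hom
        (λ g → Qε.P.∣-cong (Qε.P.sym (Qε.P.+-cong (T-hom.cong (E.ev-C g)) (Qε.P.-‿cong (U.ev-C g)))) (Qε.P.∣-trans (Qε.P.∣-^ ε c≤q) (εq g)))
        (Qε.P.∣-cong (Qε.P.sym (Qε.P.x≈y⇒x-y≈0 (Qε.P.trans (T-hom.cong E.ev-X) (Qε.P.trans T.ev-X (Qε.P.sym U.ev-X))))) Qε.P.∣0)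
        G

      εc∣TE : ε Qε.P.^ c Qε.P.∣ T.ev (E.ev G)
      εc∣TE = let w , e = d in Qε.P.∣-cong (Qε.P.sym (Qε.P.trans (T-hom.cong e) (T-hom.*-homo (f P.^ c) w)))
        (Qε.P.∣-*ʳ _ (Qε.P.∣-cong (Qε.P.sym (T-hom.^-homo f c)) (ε^∣ c (T.ev f) (ε∣ _ (Q.trans (T-const f) f≈0)))))

      εc∣U : ε Qε.P.^ c Qε.P.∣ U.ev G
      εc∣U = Qε.P.∣-cong (Qε.P.solve 2 (λ a b → a Qε.P.:- (a Qε.P.:- b) Qε.P.:= b) Qε.P.refl _ _) (Qε.P.∣-- εc∣TE T∘E≈U)

      bU : U.ev G Qε.≺ c
      bU = ev-≺ U-coeff (Qε.≺-+ (Qε.≺-mono (s≤s z≤n) Qε.≺-C) Qε.≺-X) G bG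

      U≋0 : U.ev G Qε.≋ Qε.P.0#
      U≋0 = Qε.ext coeff0
        where
        coeff0 : ∀ n → Qε.coeff (U.ev G) n Q.≈ Q.0#
        coeff0 n with n ℕP.<? c
        ... | yes n<c = Qε.X^∣⇒coeff≈0 εc∣U n n<c
        ... | no n≮c = Qε.vanish bU n (ℕP.≮⇒≥ n≮c)

      -- Replacing `ε` by `ε - x` undoes the translation and exposes the reduced `γ^q` as
      -- coefficients.
      module Shift = Evaluation Qε.C-hom (ε Qε.P.- Qε.C x)
      module Shift-hom = Hom Shift.ev-hom

      Shift∘U : Shift.ev (U.ev G) Qε.≋ Evaluation.ev (C∘ U-coeff) ε G
      Shift∘U = Evaluation.ev-unique (C∘ U-coeff) ε (Shift.ev-hom ∘ʰ U.ev-hom)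
        (λ g → Qε.P.trans (Shift-hom.cong (U.ev-C g)) (Shift.ev-C _))
        (Qε.P.trans (Shift-hom.cong U.ev-X) (Qε.P.trans (Shift-hom.+-homo (Qε.C x) ε)
          (Qε.P.trans (Qε.P.+-cong (Shift.ev-C x) Shift.ev-X) (Qε.P.solve 2 (λ x e → x Qε.P.:+ (e Qε.P.:- x) Qε.P.:= e) Qε.P.refl (Qε.C x) ε)))) G

    γ^q≈0 : ∀ n → quot.⟦ PP.coeff G n P.^ q ⟧ Q.≈ Q.0#
    γ^q≈0 n = Q.trans (Q.sym (coeff-map-hom U-coeff G n)) (Qε.at (Qε.P.trans (Qε.P.sym (ev-X≋map U-coeff G))
      (Qε.P.trans (Qε.P.sym Shift∘U) (Qε.P.trans (Shift-hom.cong U≋0) Shift-hom.0-homo))) n)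

module Independence (R : CommutativeRing 0ℓ 0ℓ) (isField : IsDiscreteField R)
  {p} (pr : Prime p) (P-ch : RingTheory.CharP (R [X]) p) (k : ℕ) where
  open RingTheory R
  open PolyTheory R
  open FieldTheory R isField
  private
    module PP = PolyTheory (R [X])
    q = p ℕ.^ k

  frob : Hom (R [X]) (R [X])
  frob = frobenius-hom (R [X]) pr P-ch k

  module E = Evaluation frob X
  private module E-hom = Hom E.ev-hom

  module _ {f d} (deg : HasDegree f (suc d)) (cop : Coprime f (D f)) where
    private
      f≉0 : f ≉0
      f≉0 = degree⇒≉0 deg

      f∣γ : ∀ {c} → c ≤ q → ∀ G → G PP.≺ c → f P.^ c P.∣ E.ev G → ∀ n → f P.∣ PP.coeff G n
      f∣γ c≤q G bG d n = radical deg cop q (PP.coeff G n)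
        (P.∣-cong (P.trans (P.+-congˡ P.-0≈0) (P.+-identityʳ _)) (Taylor.γ^q≈0 R ((R [X]) /⟨ f ⟩) (quotient-hom (R [X]) f) f
          (P.1# , P.trans (P.trans (P.+-congˡ P.-0≈0) (P.+-identityʳ f)) (P.sym (P.*-identityʳ f))) pr P-ch k c≤q G bG d n))

      divAll : ∀ G → (∀ n → f P.∣ PP.coeff G n) → ∃ λ δ → G PP.≋ PP.C f PP.P.* δ
      divAll [] _ = PP.P.0# , PP.P.sym (PP.P.zeroʳ _)
      divAll (γ ∷ G) div = let δ₀ , e₀ = div 0 ; δ , e = divAll G (λ n → div (suc n)) in
        δ₀ ∷ δ , PP.ext λ
          { zero → P.trans e₀ (P.sym (PP.coeff-C* f (δ₀ ∷ δ) 0))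
          ; (suc n) → P.trans (PP.at e n) (P.trans (PP.coeff-C* f δ n) (P.sym (PP.coeff-C* f (δ₀ ∷ δ) (suc n)))) }

      -- `E` raises coefficients to the `q`-th power, so a common factor `f` leaves as `f ^ q`.
      E-scale : ∀ {G δ} → G PP.≋ PP.C f PP.P.* δ → E.ev G ≋ f P.^ q P.* E.ev δ
      E-scale {G} {δ} e = P.trans (E-hom.cong e) (P.trans (E-hom.*-homo (PP.C f) δ) (P.*-congʳ (E.ev-C f)))

    module _ (c m : ℕ) (mc≤q : m ℕ.* c ≤ q) where
      private
        term : (ℕ → PP.Poly) → ℕ → Poly
        term G i = (f P.^ c) P.^ i P.* E.ev (G i)

        c≤q : ∀ {i} → i < m → c ≤ q
        c≤q {i} i<m = ℕP.≤-trans (ℕP.≤-trans (ℕP.m≤m+n c _) (ℕP.*-monoˡ-≤ c {suc i} {m} i<m)) mc≤q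

        -- Strong induction on `i`, working modulo `f ^ (c (i + 1))`. Later terms carry this power
        -- explicitly; earlier ones are divisible by `f ^ q` through `E-scale`, and
        -- `c (i + 1) ≤ m c ≤ q`. Hence `f ^ c` divides `E (G i)`, which is what the Taylor argument
        -- needs.
        all-divisible : ∀ G → (∀ i → i < m → G i PP.≺ c) → P.∑ m (term G) ≋ P.0# → ∀ i → i < m → ∀ n → f P.∣ PP.coeff (G i) n
        all-divisible G bG e = <-rec _ step
          where
          step : ∀ i → (∀ {j} → j < i → j < m → ∀ n → f P.∣ PP.coeff (G j) n) → i < m → ∀ n → f P.∣ PP.coeff (G i) n
          step i rec i<m = f∣γ (c≤q i<m) (G i) (bG i i<m) (cancel (∣-isolate (R [X]) m (term G) i i<m (P.∣-cong (P.sym e) P.∣0) others))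
            where
            cancel : (f P.^ c) P.^ suc i P.∣ term G i → f P.^ c P.∣ E.ev (G i)
            cancel (w , e) = w , P-cancel (P^≉0 i (P^≉0 c f≉0)) (P.trans e (P.solve 3 (λ a b w → a P.:* b P.:* w P.:= b P.:* (a P.:* w)) P.refl _ _ w))
            others : ∀ j → j < m → j ≢ i → (f P.^ c) P.^ suc i P.∣ term G j
            others j j<m j≢i with ℕP.<-cmp j i
            ... | tri≈ _ j≡i _ = ⊥-elim (j≢i j≡i)
            ... | tri> _ _ i<j = P.∣-*ʳ _ (P.∣-^ (f P.^ c) i<j)
            ... | tri< j<i _ _ = P.∣-*ˡ _ (P.∣-cong (P.sym (E-scale (proj₂ (divAll (G j) (rec j<i j<m))))) (P.∣-*ʳ _
              (P.∣-trans (P.1# , P.trans (P.sym (P.^-assocʳ f c (suc i))) (P.sym (P.*-identityʳ _)))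
                (P.∣-^ f (ℕP.≤-trans (ℕP.≤-reflexive (ℕP.*-comm c (suc i))) (ℕP.≤-trans (ℕP.*-monoˡ-≤ c i<m) mc≤q))))))

        -- Infinite descent: all coefficients are divisible by `f`, and the quotients satisfy the
        -- same relation with a smaller bound `B` on their degrees.
        go : ∀ B G → (∀ i → i < m → G i PP.≺ c) → (∀ i → i < m → ∀ n → PP.coeff (G i) n ≺ B) →
             P.∑ m (term G) ≋ P.0# → ∀ i → i < m → G i PP.≋ PP.P.0#
        go zero G bG bγ e i i<m = PP.ext λ n → ≺0⇒≋0 (bγ i i<m n)
        go (suc B) G bG bγ e i i<m = PP.P.trans (G≋fδ i i<m) (PP.P.trans (PP.P.*-congˡ (go B δ bδ bδγ e′ i i<m)) (PP.P.zeroʳ _))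
          where
          quotient : ∀ i → ∃ λ δ → i < m → G i PP.≋ PP.C f PP.P.* δ
          quotient i with i ℕP.<? m
          ... | yes i<m = let δ , e″ = divAll (G i) (all-divisible G bG e i i<m) in δ , λ _ → e″
          ... | no i≮m = PP.P.0# , λ i<m → ⊥-elim (i≮m i<m)
          δ : ℕ → PP.Poly
          δ i = proj₁ (quotient i)
          G≋fδ : ∀ i → i < m → G i PP.≋ PP.C f PP.P.* δ i
          G≋fδ i = proj₂ (quotient i)
          fδ : ∀ i → i < m → ∀ n → f P.* PP.coeff (δ i) n ≋ PP.coeff (G i) n
          fδ i i<m n = P.trans (P.sym (PP.coeff-C* f (δ i) n)) (P.sym (PP.at (G≋fδ i i<m) n))
          bδ : ∀ i → i < m → δ i PP.≺ c
          bδ i i<m = PP.bound λ n c≤n → P-cancel f≉0 (P.trans (fδ i i<m n) (P.trans (PP.vanish (bG i i<m) n c≤n) (P.sym (P.zeroʳ f))))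
          bδγ : ∀ i → i < m → ∀ n → PP.coeff (δ i) n ≺ B
          bδγ i i<m n = ≺-cancel deg B (≺-cong (P.sym (fδ i i<m n)) (≺-mono (s≤s (ℕP.m≤n+m B d)) (bγ i i<m n)))
          e′ : P.∑ m (term δ) ≋ P.0#
          e′ = P-cancel (P^≉0 q f≉0) (P.trans (P.sym (P.∑-*ˡ m (f P.^ q) (term δ)))
            (P.trans (P.∑-cong m λ i i<m → P.trans (P.solve 3 (λ a b w → a P.:* (b P.:* w) P.:= b P.:* (a P.:* w)) P.refl _ _ _) (P.*-congˡ (P.sym (E-scale (G≋fδ i i<m)))))
              (P.trans e (P.sym (P.zeroʳ _)))))

        height : ∀ G → ∃ λ B → ∀ n → PP.coeff G n ≺ B
        height [] = 0 , λ n → ≺-0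
        height (γ ∷ G) = let B , b = height G in length γ ℕ.+ B , λ
          { zero → ≺-mono (ℕP.m≤m+n _ B) (≺-length γ)
          ; (suc n) → ≺-mono (ℕP.m≤n+m B _) (b n) }

        heights : ∀ n (G : ℕ → PP.Poly) → ∃ λ B → ∀ i → i < n → ∀ j → PP.coeff (G i) j ≺ B
        heights zero G = 0 , λ i ()
        heights (suc n) G = let B , b = height (G 0) ; B′ , b′ = heights n (G ∘ suc) in B ℕ.+ B′ , λ
          { zero _ j → ≺-mono (ℕP.m≤m+n B B′) (b j)
          ; (suc i) (s≤s i<n) j → ≺-mono (ℕP.m≤n+m B′ B) (b′ i i<n j) }

      -- The powers of `f ^ c` below the `m`-th are independent over the polynomials in `x` of
      -- degree less than `c` whose coefficients are `q`-th powers. This makes the auxiliary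
      -- polynomial nonzero.
      independent : ∀ G → (∀ i → i < m → G i PP.≺ c) → P.∑ m (λ i → (f P.^ c) P.^ i P.* E.ev (G i)) ≋ P.0# → ∀ i → i < m → G i PP.≋ PP.P.0#
      independent G bG = let B , b = heights m G in go B G bG b

-- Linear algebra by counting

module Blocks (R : CommutativeRing 0ℓ 0ℓ) where
  open RingTheory R
  open PolyTheory R

  -- block u j is the j-th block of u, the blocks having lengths K 0, …, K (J − 1).
  block : ∀ K J → (Fin (total K J) → Carrier) → ∀ j → Fin (K j) → Carrier
  block K zero u j a = 0#
  block K (suc J) u zero a = u (a ↑ˡ _)
  block K (suc J) u (suc j) a = block (K ∘ suc) J (λ k → u (K 0 ↑ʳ k)) j a

  flat : ∀ K J → (∀ j → Fin (K j) → Carrier) → Fin (total K J) → Carrier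
  flat K (suc J) h k = [ h 0 , flat (K ∘ suc) J (h ∘ suc) ]′ (splitAt (K 0) k)

  block-sub : ∀ K J {u v w} → (∀ k → w k ≈ u k - v k) → ∀ j a → block K J w j a ≈ block K J u j a - block K J v j a
  block-sub K zero e j a = sym (-‿inverseʳ 0#)
  block-sub K (suc J) e zero a = e _
  block-sub K (suc J) e (suc j) a = block-sub (K ∘ suc) J (e ∘ (K 0 ↑ʳ_)) j a

  block-0 : ∀ K J {u} → (∀ j → j < J → ∀ a → block K J u j a ≈ 0#) → ∀ k → u k ≈ 0#
  block-0 K (suc J) {u} e k with splitAt (K 0) k in eq
  ... | inj₁ a = trans (reflexive (≡.cong u (≡.sym (FinP.splitAt⁻¹-↑ˡ eq)))) (e 0 (s≤s z≤n) a)
  ... | inj₂ k′ = trans (reflexive (≡.cong u (≡.sym (FinP.splitAt⁻¹-↑ʳ eq)))) (block-0 (K ∘ suc) J (λ j j<J → e (suc j) (s≤s j<J)) k′)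

  flat-sub : ∀ K J {f g h} → (∀ j a → h j a ≈ f j a - g j a) → ∀ k → flat K J h k ≈ flat K J f k - flat K J g k
  flat-sub K (suc J) e k with splitAt (K 0) k
  ... | inj₁ a = e 0 a
  ... | inj₂ k′ = flat-sub (K ∘ suc) J (e ∘ suc) k′

  flat-0 : ∀ K J {h} → (∀ k → flat K J h k ≈ 0#) → ∀ j → j < J → ∀ a → h j a ≈ 0#
  flat-0 K (suc J) {h} e zero _ a with e (a ↑ˡ _)
  ... | e′ rewrite FinP.splitAt-↑ˡ (K 0) a (total (K ∘ suc) J) = e′
  flat-0 K (suc J) {h} e (suc j) (s≤s j<J) a = flat-0 (K ∘ suc) J lem j j<J a
    where
    lem : ∀ k → flat (K ∘ suc) J (h ∘ suc) k ≈ 0#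
    lem k with e (K 0 ↑ʳ k)
    ... | e′ rewrite FinP.splitAt-↑ʳ (K 0) (total (K ∘ suc) J) k = e′

  poly : ∀ {n} → (Fin n → Carrier) → Poly
  poly = List.tabulate

  coeff-poly : ∀ {n} (u : Fin n → Carrier) a → coeff (poly u) (toℕ a) ≈ u a
  coeff-poly u Fin.zero = refl
  coeff-poly u (Fin.suc a) = coeff-poly (u ∘ Fin.suc) a

  ≺-poly : ∀ {n} (u : Fin n → Carrier) → poly u ≺ n
  ≺-poly {n} u = ≡.subst (poly u ≺_) (ListP.length-tabulate u) (≺-length (poly u))

  coeff-poly-sub : ∀ {n} {u v w : Fin n → Carrier} → (∀ a → w a ≈ u a - v a) → poly w ≋ poly u P.- poly v
  coeff-poly-sub {u = u} {v} {w} e = ext λ i → trans (go e i) (sym (coeff-sub (poly u) (poly v) i))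
    where
    go : ∀ {n} {u v w : Fin n → Carrier} → (∀ a → w a ≈ u a - v a) → ∀ i → coeff (poly w) i ≈ coeff (poly u) i - coeff (poly v) i
    go {zero} e i = sym (-‿inverseʳ 0#)
    go {suc n} e zero = e Fin.zero
    go {suc n} e (suc i) = go (e ∘ Fin.suc) i

lookup-injective : ∀ {A : Set} {xs : List A} → Unique xs → ∀ i j → List.lookup xs i ≡ List.lookup xs j → i ≡ j
lookup-injective (_ ∷ _) Fin.zero Fin.zero _ = ≡.refl
lookup-injective (x∉xs ∷ _) Fin.zero (Fin.suc j) e = ⊥-elim (All.lookup x∉xs (∈-lookup j) e)
lookup-injective (x∉xs ∷ _) (Fin.suc i) Fin.zero e = ⊥-elim (All.lookup x∉xs (∈-lookup i) (≡.sym e))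
lookup-injective (_ ∷ uniq) (Fin.suc i) (Fin.suc j) e = ≡.cong Fin.suc (lookup-injective uniq i j e)

module Kernel (R : CommutativeRing 0ℓ 0ℓ) (isField : IsDiscreteField R)
  {elements : List (CommutativeRing.Carrier R)} (unique : Unique elements) (complete : ∀ x → x ∈ elements) where
  open RingTheory R
  open IsDiscreteField isField
  private
    q = length elements
    enc : Carrier → Fin q
    enc x = Any.index (complete x)
    dec : Fin q → Carrier
    dec = List.lookup elements
    dec-enc : ∀ x → dec (enc x) ≡ x
    dec-enc x = ≡.sym (lookup-index (complete x))

  -- The pigeonhole principle replaces elimination: `q ^ U` inputs meet only `q ^ V` outputs, and
  -- the difference of two distinct inputs with equal output lies in the kernel.
  kernel : 1 < q → ∀ {U V} → V < U → (Φ : (Fin U → Carrier) → Fin V → Carrier) →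
           (∀ u v k → Φ (λ i → u i - v i) k ≈ Φ u k - Φ v k) →
           ∃ λ u → (∃ λ i → ¬ u i ≈ 0#) × (∀ k → Φ u k ≈ 0#)
  kernel 1<q {U} {V} V<U Φ additive
    with FinP.pigeonhole (ℕP.^-monoʳ-< q 1<q V<U) (λ i → Fin.funToFin (λ k → enc (Φ (dec ∘ Fin.finToFun i) k)))
  ... | i , j , i<j , e = (λ k → u k - v k) , (proj₁ differ , λ d → proj₂ differ (≈⇒≡ (x-y≈0⇒x≈y d))) , λ k → trans (additive u v k) (x≈y⇒x-y≈0 (agree k))
    where
    u v : Fin U → Carrier
    u = dec ∘ Fin.finToFun i
    v = dec ∘ Fin.finToFun j
    agree : ∀ k → Φ u k ≈ Φ v k
    agree k = reflexive (≡.trans (≡.sym (dec-enc _)) (≡.trans (≡.cong dec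
      (≡.trans (≡.sym (FinP.finToFun-funToFin _ k)) (≡.trans (≡.cong (λ w → Fin.finToFun w k) e) (FinP.finToFun-funToFin _ k)))) (dec-enc _)))
    differ : ∃ λ k → u k ≢ v k
    differ = let k , ne = FinP.¬∀⟶∃¬ U (λ k → Fin.finToFun i k ≡ Fin.finToFun j k) (λ k → Fin.finToFun i k FinP.≟ Fin.finToFun j k)
                   (λ same → FinP.<⇒≢ i<j (≡.trans (≡.sym (FinP.funToFin-finToFin {U} i)) (≡.trans (funToFin-cong same) (FinP.funToFin-finToFin {U} j))))
             in k , ne ∘ lookup-injective unique _ _
      where
      funToFin-cong : ∀ {m n} {f g : Fin m → Fin n} → (∀ k → f k ≡ g k) → Fin.funToFin f ≡ Fin.funToFin g
      funToFin-cong {zero} e = ≡.refl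
      funToFin-cong {suc m} e = ≡.cong₂ Fin.combine (e Fin.zero) (funToFin-cong (e ∘ Fin.suc))

-- The substitution of `x + f(x) ε`

module Substitution (R : CommutativeRing 0ℓ 0ℓ) {f d} (f≺ : PolyTheory._≺_ R f (suc d)) where
  open RingTheory R
  open PolyTheory R
  private
    module PP = PolyTheory (R [X])
    ε = PP.X

  -- The substitution x ↦ x + f(x) ε: it multiplies f by the unit V.
  fε : PP.Poly
  fε = PP.C f PP.P.* ε

  module T = Evaluation (PP.C-hom ∘ʰ C-hom) (PP.C X PP.P.+ fε)
  module T-hom = Hom T.ev-hom

  private
    -- The difference quotient `(g(x + f ε) - g(x)) / (f ε)`, defined by recursion so that no
    -- division occurs.
    W : Poly → PP.Poly
    W [] = PP.P.0#
    W (a ∷ g) = PP.C X PP.P.* W g PP.P.+ T.ev g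

    T≋ : ∀ g → T.ev g PP.≋ PP.C g PP.P.+ fε PP.P.* W g
    T≋ [] = PP.P.sym (PP.P.trans (PP.P.+-cong (Hom.0-homo PP.C-hom) (PP.P.zeroʳ fε)) (PP.P.+-identityˡ _))
    T≋ (a ∷ g) = begin⟨ PP.P.setoid ⟩
      PP.C (C a) PP.P.+ (PP.C X PP.P.+ fε) PP.P.* T.ev g
        ≈⟨ PP.P.solve 4 (λ a x e t → a PP.P.:+ (x PP.P.:+ e) PP.P.:* t PP.P.:= a PP.P.:+ x PP.P.:* t PP.P.:+ e PP.P.:* t) PP.P.refl (PP.C (C a)) (PP.C X) fε (T.ev g) ⟩
      PP.C (C a) PP.P.+ PP.C X PP.P.* T.ev g PP.P.+ fε PP.P.* T.ev g ≈⟨ PP.P.+-congʳ (PP.P.+-congˡ (PP.P.*-congˡ (T≋ g))) ⟩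
      PP.C (C a) PP.P.+ PP.C X PP.P.* (PP.C g PP.P.+ fε PP.P.* W g) PP.P.+ fε PP.P.* T.ev g
        ≈⟨ PP.P.solve 6 (λ a x e t g w → a PP.P.:+ x PP.P.:* (g PP.P.:+ e PP.P.:* w) PP.P.:+ e PP.P.:* t PP.P.:= (a PP.P.:+ x PP.P.:* g) PP.P.:+ e PP.P.:* (x PP.P.:* w PP.P.:+ t)) PP.P.refl (PP.C (C a)) (PP.C X) fε (T.ev g) (PP.C g) (W g) ⟩
      (PP.C (C a) PP.P.+ PP.C X PP.P.* PP.C g) PP.P.+ fε PP.P.* W (a ∷ g)
        ≈⟨ PP.P.+-congʳ (PP.P.sym (PP.P.trans (Hom.cong PP.C-hom (∷-split a g)) (PP.P.trans (Hom.+-homo PP.C-hom (C a) (X P.* g)) (PP.P.+-congˡ (Hom.*-homo PP.C-hom X g))))) ⟩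
      PP.C (a ∷ g) PP.P.+ fε PP.P.* W (a ∷ g) ∎

  V : PP.Poly
  V = PP.P.1# PP.P.+ ε PP.P.* W f

  T-f : T.ev f PP.≋ PP.C f PP.P.* V
  T-f = PP.P.trans (T≋ f) (PP.P.solve 3 (λ f e w → f PP.P.:+ f PP.P.:* e PP.P.:* w PP.P.:= f PP.P.:* (f PP.P.:^ 0 PP.P.:+ e PP.P.:* w)) PP.P.refl (PP.C f) ε (W f))

  -- Each `ε` comes with a factor `f`, so it may raise the degree in `x` by `d`. The bounds are
  -- multiplicative (`Filt-*`), and powers of `V` cost nothing beyond them: this is why the
  -- conditions have degree growing like `s * d`, whatever the exponent of `f`.
  Filt : ℕ → PP.Poly → Set
  Filt K g = ∀ s → PP.coeff g s ≺ K ℕ.+ s ℕ.* d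

  Filt-cong : ∀ {K g h} → g PP.≋ h → Filt K g → Filt K h
  Filt-cong e b s = ≺-cong (PP.at e s) (b s)

  Filt-+ : ∀ {K g h} → Filt K g → Filt K h → Filt K (g PP.P.+ h)
  Filt-+ {g = g} {h} b b′ s = ≺-cong (P.sym (PP.coeff-⊕ g h s)) (≺-+ (b s) (b′ s))

  Filt-0 : ∀ {K} → Filt K PP.P.0#
  Filt-0 s = ≺-0

  Filt-C : ∀ {K g} → g ≺ K → Filt K (PP.C g)
  Filt-C {K} b zero = ≺-mono (ℕP.≤-reflexive (≡.sym (ℕP.+-identityʳ K))) b
  Filt-C b (suc s) = ≺-0

  Filt-* : ∀ {a b g h} → Filt (suc a) g → Filt b h → Filt (a ℕ.+ b) (g PP.P.* h)
  Filt-* {a} {b} {g} {h} bg bh s = ≺-cong (P.sym (PP.coeff-⊛ g h s)) (go a s bg)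
    where
    go : ∀ a s {F : ℕ → Poly} → (∀ i → F i ≺ suc a ℕ.+ i ℕ.* d) → Convolution.conv (R [X]) F (PP.coeff h) s ≺ a ℕ.+ b ℕ.+ s ℕ.* d
    go a zero bF = ≺-cong (P.*-comm _ _) (≺-mono (ℕP.≤-reflexive lemma) (≺-* (b ℕ.+ 0) (a ℕ.+ 0) (bh 0) (bF 0)))
      where
      lemma : (b ℕ.+ 0) ℕ.+ (a ℕ.+ 0) ≡ a ℕ.+ b ℕ.+ 0
      lemma = ℕSolver.solve (a ∷ b ∷ [])
    go a (suc s) bF = ≺-+ (≺-cong (P.*-comm _ _) (≺-mono (ℕP.≤-reflexive lemma₁) (≺-* (b ℕ.+ suc s ℕ.* d) (a ℕ.+ 0) (bh (suc s)) (bF 0))))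
      (≺-mono (ℕP.≤-reflexive lemma₂) (go (a ℕ.+ d) s (λ i → ≺-mono (ℕP.≤-reflexive (lemma₃ i)) (bF (suc i)))))
      where
      lemma₁ : (b ℕ.+ (d ℕ.+ s ℕ.* d)) ℕ.+ (a ℕ.+ 0) ≡ a ℕ.+ b ℕ.+ (d ℕ.+ s ℕ.* d)
      lemma₁ = ℕSolver.solve (a ∷ b ∷ s ∷ d ∷ [])
      lemma₂ : a ℕ.+ d ℕ.+ b ℕ.+ s ℕ.* d ≡ a ℕ.+ b ℕ.+ (d ℕ.+ s ℕ.* d)
      lemma₂ = ℕSolver.solve (a ∷ b ∷ s ∷ d ∷ [])
      lemma₃ : ∀ i → suc a ℕ.+ (d ℕ.+ i ℕ.* d) ≡ suc (a ℕ.+ d) ℕ.+ i ℕ.* d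
      lemma₃ i = ℕSolver.solve (a ∷ i ∷ d ∷ [])

  private
    Filt-ε : ∀ {K g} → Filt K g → ∀ s → PP.coeff (ε PP.P.* g) (suc s) ≺ K ℕ.+ s ℕ.* d
    Filt-ε {g = g} b s = ≺-cong (P.sym (PP.coeff-X*-suc g s)) (b s)

    Filt-fε : ∀ {K g} → Filt K g → Filt K (fε PP.P.* g)
    Filt-fε {K} {g} b = Filt-cong (PP.P.sym (PP.P.*-assoc (PP.C f) ε g)) λ
      { zero → ≺-cong (P.sym (P.trans (PP.coeff-C* f (ε PP.P.* g) 0) (P.trans (P.*-congˡ (PP.coeff-X*-0 g)) (P.zeroʳ f)))) ≺-0
      ; (suc s) → ≺-cong (P.trans (P.*-comm _ f) (P.sym (PP.coeff-C* f (ε PP.P.* g) (suc s))))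
          (≺-mono (ℕP.≤-reflexive (lemma s)) (≺-* (K ℕ.+ s ℕ.* d) d (Filt-ε b s) f≺)) }
      where
      lemma : ∀ s → (K ℕ.+ s ℕ.* d) ℕ.+ d ≡ K ℕ.+ (d ℕ.+ s ℕ.* d)
      lemma s = ℕSolver.solve (K ∷ s ∷ d ∷ [])

    Filt-X : ∀ {K g} → Filt K g → Filt (suc K) (PP.C X PP.P.* g)
    Filt-X {K} b = Filt-* {1} {K} (Filt-C ≺-X) b

    tail≺ : ∀ {a g n} → a ∷ g ≺ suc n → g ≺ n
    tail≺ b = bound λ i le → vanish b (suc i) (s≤s le)

    W-0 : ∀ g → g ≺ 0 → W g PP.≋ PP.P.0#
    W-0 [] _ = PP.P.refl
    W-0 (a ∷ g) b = PP.P.trans (PP.P.+-cong (PP.P.trans (PP.P.*-congˡ (W-0 g g≺0)) (PP.P.zeroʳ _)) (PP.P.trans (T-hom.cong (≺0⇒≋0 g≺0)) T-hom.0-homo)) (PP.P.+-identityˡ _)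
      where
      g≺0 : g ≺ 0
      g≺0 = bound λ i _ → vanish b (suc i) z≤n

  Filt-T : ∀ g {n} → g ≺ n → Filt n (T.ev g)
  Filt-T [] b = Filt-0
  Filt-T (a ∷ g) {zero} b = Filt-cong (PP.P.sym (PP.P.trans (T-hom.cong (≺0⇒≋0 b)) T-hom.0-homo)) Filt-0
  Filt-T (a ∷ g) {suc n} b = Filt-+ {g = PP.C (C a)} (Filt-C (≺-mono (s≤s z≤n) ≺-C))
    (Filt-cong (PP.P.sym (PP.P.distribʳ (T.ev g) (PP.C X) fε))
      (Filt-+ {g = PP.C X PP.P.* T.ev g} (Filt-X rec) (λ s → ≺-mono (ℕP.n≤1+n _) (Filt-fε rec s))))
    where
    rec : Filt n (T.ev g)
    rec = Filt-T g (tail≺ b)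

  private
    Filt-W : ∀ g {n} → g ≺ suc n → Filt n (W g)
    Filt-W [] b = Filt-0
    Filt-W (a ∷ g) {zero} b = Filt-+ {g = PP.C X PP.P.* W g} (Filt-cong (PP.P.sym (PP.P.trans (PP.P.*-congˡ (W-0 g (tail≺ b))) (PP.P.zeroʳ _))) Filt-0) (Filt-T g (tail≺ b))
    Filt-W (a ∷ g) {suc n} b = Filt-+ {g = PP.C X PP.P.* W g} (Filt-X (Filt-W g (tail≺ b))) (Filt-T g (tail≺ b))

    Filt-V : Filt 1 V
    Filt-V = Filt-+ {g = PP.P.1#} (Filt-C ≺-C) λ
      { zero → ≺-cong (P.sym (PP.coeff-X*-0 (W f))) ≺-0
      ; (suc s) → ≺-mono (ℕP.n≤1+n _) (Filt-ε (Filt-W f f≺) s) }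

  Filt-V^ : ∀ n → Filt 1 (V PP.P.^ n)
  Filt-V^ zero = Filt-C ≺-C
  Filt-V^ (suc n) = Filt-* {0} {1} Filt-V (Filt-V^ n)

-- Stepanov's auxiliary polynomial

module _ (R : CommutativeRing 0ℓ 0ℓ) where
  open RingTheory R
  open PolyTheory R

  ≺-map : ∀ {S : CommutativeRing 0ℓ 0ℓ} (φ : Hom R S) {p n} → p ≺ n → PolyTheory._≺_ S (Hom.⟦ map-hom φ ⟧ p) n
  ≺-map {S} φ {p} b = PolyTheory.bound λ i le → S.trans (coeff-map-hom φ p i) (S.trans (Hom.cong φ (vanish b i le)) (Hom.0-homo φ))
    where module S = CommutativeRing S

  ∑-X^-C≋0 : ∀ J (u : ℕ → Carrier) → P.∑ J (λ j → X P.^ j P.* C (u j)) ≋ P.0# → ∀ j → j < J → u j ≈ 0#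
  ∑-X^-C≋0 (suc J) u e = λ
    { zero _ → trans (sym (trans (coeff-⊕ (C (u 0)) (X P.* S) 0) (trans (+-congˡ (coeff-X*-0 S)) (+-identityʳ _)))) (at e′ 0)
    ; (suc j) (s≤s j<J) → ∑-X^-C≋0 J (u ∘ suc) (ext λ n →
        trans (sym (trans (coeff-⊕ (C (u 0)) (X P.* S) (suc n)) (trans (+-identityˡ _) (coeff-X*-suc S n)))) (at e′ (suc n))) j j<J }
    where
    S = P.∑ J (λ j → X P.^ j P.* C (u (suc j)))
    e′ : C (u 0) P.+ X P.* S ≋ P.0#
    e′ = P.trans (P.+-cong (P.sym (P.*-identityˡ _)) (P.trans (P.sym (P.∑-*ˡ J X (λ j → X P.^ j P.* C (u (suc j))))) (P.∑-cong J λ j _ → P.sym (P.*-assoc X (X P.^ j) (C (u (suc j))))))) e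

  ∣-pow : ∀ {e a b} n → e ∣ a - b → e ∣ a ^ n - b ^ n
  ∣-pow zero d = ∣-cong (sym (-‿inverseʳ 1#)) ∣0
  ∣-pow {e} {a} {b} (suc n) d = ∣-cong (solve 4 (λ a b x y → (a :- b) :* x :+ b :* (x :- y) := a :* x :- b :* y) refl a b (a ^ n) (b ^ n))
    (∣-+ (∣-*ʳ _ d) (∣-*ˡ b (∣-pow n d)))

  ∑-sub : ∀ n f g → ∑ n (λ i → f i - g i) ≈ ∑ n f - ∑ n g
  ∑-sub zero f g = sym (-‿inverseʳ 0#)
  ∑-sub (suc n) f g = trans (+-congˡ (∑-sub n (f ∘ suc) (g ∘ suc)))
    (solve 4 (λ a b c d → a :- b :+ (c :- d) := (a :+ c) :- (b :+ d)) refl _ _ _ _)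

  ∣-∑-sub : ∀ {e} n f g → (∀ i → i < n → e ∣ f i - g i) → e ∣ ∑ n f - ∑ n g
  ∣-∑-sub zero f g d = ∣-cong (sym (-‿inverseʳ 0#)) ∣0
  ∣-∑-sub (suc n) f g d = ∣-cong (solve 4 (λ a b c d → a :- b :+ (c :- d) := (a :+ c) :- (b :+ d)) refl _ _ _ _)
    (∣-+ (d 0 (s≤s z≤n)) (∣-∑-sub n (f ∘ suc) (g ∘ suc) λ i i<n → d (suc i) (s≤s i<n)))

hom-ext : ∀ {R S : CommutativeRing 0ℓ 0ℓ} (let open PolyTheory R; open CommutativeRing S) (g h : Hom (R [X]) S) →
          (∀ a → Hom.⟦ g ⟧ (C a) ≈ Hom.⟦ h ⟧ (C a)) → Hom.⟦ g ⟧ X ≈ Hom.⟦ h ⟧ X → ∀ p → Hom.⟦ g ⟧ p ≈ Hom.⟦ h ⟧ p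
hom-ext {R} {S} g h eC eX p = trans (ev-unique g eC eX p) (sym (ev-unique h (λ _ → refl) refl p))
  where
  open CommutativeRing S
  open Evaluation (h ∘ʰ PolyTheory.C-hom R) (Hom.⟦ h ⟧ (PolyTheory.X R))

-- A h = Σ f^(ic) (x − x^q)^j f^(e_j) h_ij is nonzero as soon as some h_ij is. At a point x₀ where f(x₀)^c is one of the z values ζ,
-- substituting x₀ + f(x₀) ε turns A h, modulo ε^l and up to a power of f(x₀), into cond ζ h evaluated at x₀;
-- its coefficients are linear in the h_ij and have degree less than L s. Hence if the m Σ K j unknowns outnumber the
-- z Σ L s equations, some nonzero A h vanishes to order l at all the points, and the degree bound N limits their number.
module Stepanov (R : CommutativeRing 0ℓ 0ℓ) (isField : IsDiscreteField R)
  {elements : List (CommutativeRing.Carrier R)} (unique : Unique elements) (complete : ∀ x → x ∈ elements) (1<F : 1 < length elements)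
  {p} (pr : Prime p) (P-ch : RingTheory.CharP (R [X]) p) (k : ℕ)
  (x^q≈x : ∀ x → CommutativeRing._≈_ R (RingTheory._^_ R x (p ℕ.^ k)) x)
  {f d-1} (deg : FieldTheory.HasDegree R isField f (suc d-1)) (cop : FieldTheory.Coprime R isField f (PolyTheory.D R f)) where
  open RingTheory R
  open PolyTheory R
  open FieldTheory R isField
  open Blocks R
  private
    module PP = PolyTheory (R [X])
    module Ind = Independence R isField pr P-ch k
    module E = Ind.E
    module E-hom = Hom E.ev-hom
    module Sub = Substitution R (proj₁ deg)
    q = p ℕ.^ k
    d = suc d-1
    ε = PP.X

    lift-hom : Hom (R [X]) ((R [X]) [X])
    lift-hom = map-hom C-hom
    module lift = Hom lift-hom

    lift-X : lift.⟦ X ⟧ PP.≋ PP.X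
    lift-X = PP.ext λ { zero → Hom.0-homo C-hom ; (suc zero) → P.refl ; (suc (suc _)) → P.refl }

    -- A lifted polynomial has constants as coefficients, and these are fixed by the `q`-th power;
    -- so `E` merely renames the outer variable to `x`.
    E-lift : ∀ g → E.ev lift.⟦ g ⟧ ≋ g
    E-lift = hom-ext (E.ev-hom ∘ʰ lift-hom) id-hom
      (λ a → P.trans (E.ev-C (C a)) (P.trans (P.sym (Hom.^-homo C-hom a q)) (Hom.cong C-hom (x^q≈x a))))
      (P.trans (E-hom.cong lift-X) E.ev-X)

    -- y ↦ x − z, so that x − y ↦ z
    ψ : Hom (R [X]) ((R [X]) [X])
    ψ = Evaluation.ev-hom (PP.C-hom ∘ʰ C-hom) (PP.C X PP.P.- ε)
    module Ψ = Evaluation ψ (PP.C X)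
    module Ψ-hom = Hom Ψ.ev-hom

    Ψ-lift : ∀ g → Ψ.ev lift.⟦ g ⟧ PP.≋ PP.C g
    Ψ-lift = hom-ext (Ψ.ev-hom ∘ʰ lift-hom) PP.C-hom
      (λ a → PP.P.trans (Ψ.ev-C (C a)) (Evaluation.ev-C (PP.C-hom ∘ʰ C-hom) (PP.C X PP.P.- ε) a))
      (PP.P.trans (Ψ-hom.cong lift-X) Ψ.ev-X)

    -- The outer variable plays the role of `x`, the inner one that of `y`. Since `E` sends `y` to
    -- `x^q`, this is the generic form of `x - x^q`.
    x-y : PP.Poly
    x-y = PP.X PP.P.- PP.C X

    Ψ-x-y : Ψ.ev x-y PP.≋ ε
    Ψ-x-y = PP.P.trans (Ψ-hom.sub-homo PP.X (PP.C X)) (PP.P.trans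
      (PP.P.+-cong Ψ.ev-X (PP.P.-‿cong (PP.P.trans (Ψ.ev-C X) (Evaluation.ev-X (PP.C-hom ∘ʰ C-hom) (PP.C X PP.P.- ε)))))
      (PP.P.solve 2 (λ x z → x PP.P.:- (x PP.P.:- z) PP.P.:= z) PP.P.refl (PP.C X) ε))

    Θ : Poly
    Θ = X P.- X P.^ q

    E-x-y : E.ev x-y ≋ Θ
    E-x-y = P.trans (E-hom.sub-homo PP.X (PP.C X)) (P.+-cong E.ev-X (P.-‿cong (E.ev-C X)))

    x-y≺ : x-y PP.≺ 2
    x-y≺ = PP.≺-+ PP.≺-X (PP.≺-neg (PP.≺-mono (s≤s z≤n) PP.≺-C))

  -- The exponents `i` and `j` run below `m` and `J`; `h_ij` has degree less than `K j`. At a point,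
  -- `f^(e_j) (x - x^q)^j` contributes `f(x₀)^(e_j + j)`; by `exponents` a common factor `f(x₀)^E₀`
  -- splits off and only `w j` burdens the conditions. `inner` is the degree restriction of
  -- `independent`, `outer` bounds the degree of the whole polynomial, and `conditions` bounds the
  -- coefficient of `ε^s`.
  module _ (m c J l z N E₀ : ℕ) (K L e w : ℕ → ℕ) (ζ : ℕ → Carrier)
    (mc≤q : m ℕ.* c ≤ q) (l≤q : l ≤ q)
    (exponents : ∀ j → e j ℕ.+ j ≡ E₀ ℕ.+ w j)
    (inner : ∀ j → j < J → K j ℕ.+ e j ℕ.* d ℕ.+ j ≤ c)
    (outer : ∀ i j → i < m → j < J → K j ℕ.+ e j ℕ.* d ℕ.+ j ℕ.* q ℕ.+ i ℕ.* (c ℕ.* d) ≤ N)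
    (conditions : ∀ j s → j < J → j ≤ s → s < l → w j ℕ.* d ℕ.+ K j ℕ.+ (s ∸ j) ℕ.* d ≤ L s)
    (count : total (λ _ → total L l) z < total (λ _ → total K J) m)
    {xs : List Carrier} (uniq : Unique xs) (f≉0 : ∀ x → x ∈ xs → ¬ eval x f ≈ 0#)
    (values : ∀ x → x ∈ xs → ∃ λ i → i < z × eval x f ^ c ≈ ζ i) where

    private
      G : (ℕ → ℕ → Poly) → ℕ → PP.Poly
      G h i = PP.P.∑ J (λ j → x-y PP.P.^ j PP.P.* lift.⟦ f P.^ e j P.* h i j ⟧)

      aux : (ℕ → ℕ → Poly) → ℕ → Poly
      aux h i = P.∑ J (λ j → Θ P.^ j P.* (f P.^ e j P.* h i j))

      A : (ℕ → ℕ → Poly) → Poly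
      A h = P.∑ m (λ i → (f P.^ c) P.^ i P.* aux h i)

      E-G : ∀ h i → E.ev (G h i) ≋ aux h i
      E-G h i = P.trans (E-hom.∑-homo J (λ j → x-y PP.P.^ j PP.P.* lift.⟦ f P.^ e j P.* h i j ⟧))
        (P.∑-cong J λ j _ → P.trans (E-hom.*-homo (x-y PP.P.^ j) _) (P.*-cong (P.trans (E-hom.^-homo x-y j) (P.^-congˡ j E-x-y)) (E-lift _)))

      module _ (h : ℕ → ℕ → Poly) (h≺ : ∀ i j → h i j ≺ K j) where

        fh≺ : ∀ i j → f P.^ e j P.* h i j ≺ K j ℕ.+ e j ℕ.* d
        fh≺ i j = ≺-cong (P.*-comm (h i j) (f P.^ e j)) (≺-* (K j) (e j ℕ.* d) (h≺ i j) (≺-^ d (e j) (proj₁ deg)))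

        G≺ : ∀ i → G h i PP.≺ c
        G≺ i = PP.≺-∑ J λ j j<J → PP.≺-cong (PP.P.*-comm _ (x-y PP.P.^ j)) (PP.≺-mono (inner j j<J)
          (PP.≺-* (K j ℕ.+ e j ℕ.* d) j (≺-map R C-hom (fh≺ i j)) (≡.subst (λ n → x-y PP.P.^ j PP.≺ suc n) (ℕP.*-identityʳ j) (PP.≺-^ 1 j x-y≺))))

        Θ≺ : 1 ≤ q → Θ ≺ suc q
        Θ≺ 1≤q = ≺-+ (≺-mono (s≤s 1≤q) ≺-X) (≺-neg (≡.subst (λ n → X P.^ q ≺ suc n) (ℕP.*-identityʳ q) (≺-^ 1 q ≺-X)))

        A≺ : 1 ≤ q → A h ≺ N
        A≺ 1≤q = ≺-∑ m λ i i<m → ≺-cong (P.∑-*ˡ J ((f P.^ c) P.^ i) (λ j → Θ P.^ j P.* (f P.^ e j P.* h i j))) (≺-∑ J λ j j<J →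
          ≺-cong (P.solve 3 (λ a b c → c P.:* b P.:* a P.:= a P.:* (b P.:* c)) P.refl ((f P.^ c) P.^ i) (Θ P.^ j) _)
            (≺-mono (outer i j i<m j<J) (≺-* (K j ℕ.+ e j ℕ.* d ℕ.+ j ℕ.* q) (i ℕ.* (c ℕ.* d))
              (≺-* (K j ℕ.+ e j ℕ.* d) (j ℕ.* q) (fh≺ i j) (≺-^ q j (Θ≺ 1≤q))) (≺-^ (c ℕ.* d) i (≺-^ d c (proj₁ deg))))))

        -- Independence gives `G h i = 0` for each `i`. After the change of variables `Ψ` the powers
        -- of `x - y` become powers of a free variable, with coefficients `f^(e_j) h_ij`.
        A≋0⇒h≋0 : A h ≋ P.0# → ∀ i → i < m → ∀ j → j < J → h i j ≋ P.0#
        A≋0⇒h≋0 e₀ i i<m j j<J = P-cancel (P^≉0 (e j) (degree⇒≉0 deg)) (P.trans (∑-X^-C≋0 (R [X]) J (λ j → f P.^ e j P.* h i j) ΨG≋0 j j<J) (P.sym (P.zeroʳ _)))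
          where
          G≋0 : G h i PP.≋ PP.P.0#
          G≋0 = Ind.independent deg cop c m mc≤q (G h) (λ i _ → G≺ i) (P.trans (P.∑-cong m λ i _ → P.*-congˡ (E-G h i)) e₀) i i<m
          ΨG≋0 : PP.P.∑ J (λ j → ε PP.P.^ j PP.P.* PP.C (f P.^ e j P.* h i j)) PP.≋ PP.P.0#
          ΨG≋0 = PP.P.trans (PP.P.sym (PP.P.trans (Ψ-hom.∑-homo J (λ j → x-y PP.P.^ j PP.P.* lift.⟦ f P.^ e j P.* h i j ⟧))
              (PP.P.∑-cong J λ j _ → PP.P.trans (Ψ-hom.*-homo (x-y PP.P.^ j) _) (PP.P.*-cong (PP.P.trans (Ψ-hom.^-homo x-y j) (PP.P.^-congˡ j Ψ-x-y)) (Ψ-lift _)))))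
            (PP.P.trans (Ψ-hom.cong G≋0) Ψ-hom.0-homo)

      -- What `f^(ic) (x - x^q)^j f^(e_j)` becomes at `x + f(x) ε` when `f^c` is replaced by the
      -- prescribed value and `f^E₀` is removed.
      factor-ij : ℕ → ℕ → ℕ → PP.Poly
      factor-ij zi i j = PP.C (C (ζ zi ^ i)) PP.P.* (PP.C (f P.^ w j) PP.P.* (ε PP.P.^ j PP.P.* Sub.V PP.P.^ (c ℕ.* i ℕ.+ e j)))

      cond : ℕ → (ℕ → ℕ → Poly) → PP.Poly
      cond zi h = PP.P.∑ m (λ i → PP.P.∑ J (λ j → factor-ij zi i j PP.P.* Sub.T.ev (h i j)))

      cond-sub : ∀ zi {h g g′} → (∀ i j → h i j ≋ g i j P.- g′ i j) → cond zi h PP.≋ cond zi g PP.P.- cond zi g′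
      cond-sub zi {h} {g} {g′} e₀ = PP.P.trans (PP.P.∑-cong m λ i _ → PP.P.trans (PP.P.∑-cong J λ j _ →
            PP.P.trans (PP.P.*-congˡ (PP.P.trans (Sub.T-hom.cong (e₀ i j)) (Sub.T-hom.sub-homo (g i j) (g′ i j))))
              (PP.P.solve 3 (λ a b c → a PP.P.:* (b PP.P.:- c) PP.P.:= a PP.P.:* b PP.P.:- a PP.P.:* c) PP.P.refl (factor-ij zi i j) _ _))
          (∑-sub ((R [X]) [X]) J (λ j → factor-ij zi i j PP.P.* Sub.T.ev (g i j)) (λ j → factor-ij zi i j PP.P.* Sub.T.ev (g′ i j))))
        (∑-sub ((R [X]) [X]) m (λ i → PP.P.∑ J (λ j → factor-ij zi i j PP.P.* Sub.T.ev (g i j))) (λ i → PP.P.∑ J (λ j → factor-ij zi i j PP.P.* Sub.T.ev (g′ i j))))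

      cond≺ : ∀ zi h → (∀ i j → h i j ≺ K j) → ∀ s → s < l → PP.coeff (cond zi h) s ≺ L s
      cond≺ zi h h≺ s s<l = ≺-cong (P.sym (PP.coeff-∑ m _ s)) (≺-∑ m λ i _ → ≺-cong (P.sym (PP.coeff-∑ J _ s)) (≺-∑ J λ j j<J → term≺ i j j<J))
        where
        module _ (i j : ℕ) (j<J : j < J) where
          core : PP.Poly
          core = PP.C (f P.^ w j) PP.P.* (Sub.V PP.P.^ (c ℕ.* i ℕ.+ e j) PP.P.* Sub.T.ev (h i j))
          core≺ : Sub.Filt (w j ℕ.* d ℕ.+ K j) core
          core≺ = Sub.Filt-* {w j ℕ.* d} {K j} (Sub.Filt-C (≺-^ d (w j) (proj₁ deg))) (Sub.Filt-* {0} {K j} (Sub.Filt-V^ (c ℕ.* i ℕ.+ e j)) (Sub.Filt-T (h i j) (h≺ i j)))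
          εcore≺ : PP.coeff (ε PP.P.^ j PP.P.* core) s ≺ L s
          εcore≺ with j ℕP.≤? s
          ... | yes j≤s = ≺-mono (conditions j s j<J j≤s s<l)
                (≺-cong (P.sym (P.trans (P.reflexive (≡.cong (PP.coeff (ε PP.P.^ j PP.P.* core)) (≡.sym (ℕP.m+[n∸m]≡n j≤s)))) (PP.coeff-X^*-+ j core (s ∸ j)))) (core≺ (s ∸ j)))
          ... | no j≰s = ≺-cong (P.sym (PP.coeff-X^*-< (ℕP.≰⇒> j≰s) core)) ≺-0
          term≺ : PP.coeff (factor-ij zi i j PP.P.* Sub.T.ev (h i j)) s ≺ L s
          term≺ = ≺-cong (PP.at (PP.P.solve 5 (λ a b c d e → a PP.P.:* (c PP.P.:* (b PP.P.:* (d PP.P.:* e))) PP.P.:= a PP.P.:* (b PP.P.:* (c PP.P.:* d)) PP.P.:* e) PP.P.refl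
              (PP.C (C (ζ zi ^ i))) (PP.C (f P.^ w j)) (ε PP.P.^ j) (Sub.V PP.P.^ (c ℕ.* i ℕ.+ e j)) (Sub.T.ev (h i j))) s)
            (≺-cong (P.sym (PP.coeff-C* (C (ζ zi ^ i)) (ε PP.P.^ j PP.P.* core) s))
              (≺-cong (P.*-comm _ (C (ζ zi ^ i))) (≺-mono (ℕP.≤-reflexive (ℕP.+-identityʳ (L s))) (≺-* (L s) 0 εcore≺ ≺-C))))

      module Vanishing {x₀} (x₀∈ : x₀ ∈ xs) (h : ℕ → ℕ → Poly) (zi : ℕ) (ζ-value : eval x₀ f ^ c ≈ ζ zi) where
        y₀ = eval x₀ f
        a = C y₀
        module ev₀ = Hom (At.ev-hom x₀)

        σ-hom : Hom ((R [X]) [X]) (R [X])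
        σ-hom = map-hom (At.ev-hom x₀)
        module σ = Hom σ-hom

        σ-ε : σ.⟦ ε ⟧ ≋ X
        σ-ε = ext λ { zero → refl ; (suc zero) → ev₀.1-homo ; (suc (suc _)) → refl }

        x₀+y₀ε : Poly
        x₀+y₀ε = C x₀ P.+ a P.* X
        module B = Evaluation C-hom x₀+y₀ε
        module B-hom = Hom B.ev-hom

        -- Expansion at the point `x₀` is the generic expansion with its coefficients evaluated at
        -- `x₀`.
        B≋σT : ∀ g → B.ev g ≋ σ.⟦ Sub.T.ev g ⟧
        B≋σT = hom-ext B.ev-hom (σ-hom ∘ʰ Sub.T.ev-hom)
          (λ u → P.trans (B.ev-C u) (P.sym (P.trans (σ.cong (Sub.T.ev-C u)) (Hom.cong C-hom (At.ev-C x₀ u)))))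
          (P.trans B.ev-X (P.sym (P.trans (σ.cong Sub.T.ev-X) (P.trans (σ.+-homo (PP.C X) Sub.fε)
            (P.+-cong (Hom.cong C-hom (At.ev-X x₀)) (P.trans (σ.*-homo (PP.C f) ε) (P.*-congˡ σ-ε)))))))

        σV = σ.⟦ Sub.V ⟧

        B-f : B.ev f ≋ a P.* σV
        B-f = P.trans (B≋σT f) (P.trans (σ.cong Sub.T-f) (σ.*-homo (PP.C f) Sub.V))

        -- As `x₀^q = x₀`, the constant terms cancel and `x - x^q` becomes `y₀ ε - (y₀ ε)^q`; the
        -- second term vanishes modulo `ε^l` because `l ≤ q`.
        B-Θ : X P.^ l P.∣ B.ev Θ P.- a P.* X
        B-Θ = P.∣-cong (begin⟨ P.setoid ⟩
          P.- (a P.^ q P.* X P.^ q) ≈⟨ P.solve 3 (λ x y z → P.:- z P.:= (x P.:+ y) P.:- (x P.:+ z) P.:- y) P.refl (C x₀) (a P.* X) _ ⟩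
          x₀+y₀ε P.- (C x₀ P.+ a P.^ q P.* X P.^ q) P.- a P.* X
            ≈⟨ P.+-congʳ (P.+-congˡ (P.-‿cong (P.+-cong (P.trans (Hom.cong C-hom (sym (x^q≈x x₀))) (Hom.^-homo C-hom x₀ q)) (P.sym (P.^-distrib-* a X q))))) ⟩
          x₀+y₀ε P.- (C x₀ P.^ q P.+ (a P.* X) P.^ q) P.- a P.* X
            ≈⟨ P.+-congʳ (P.+-congˡ (P.-‿cong (P.sym (Hom.+-homo Ind.frob (C x₀) (a P.* X))))) ⟩
          x₀+y₀ε P.- x₀+y₀ε P.^ q P.- a P.* X
            ≈⟨ P.+-congʳ (P.trans (B-hom.sub-homo X (X P.^ q)) (P.+-cong B.ev-X (P.-‿cong (P.trans (B-hom.^-homo X q) (P.^-congˡ q B.ev-X))))) ⟨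
          B.ev Θ P.- a P.* X ∎)
          (P.∣-neg (P.∣-*ˡ (a P.^ q) (P.∣-^ X l≤q)))

        module _ (i j : ℕ) where
          t : Poly
          t = (f P.^ c) P.^ i P.* (Θ P.^ j P.* (f P.^ e j P.* h i j))

          n = c ℕ.* i ℕ.+ e j
          Z = C (ζ zi ^ i)
          H = B.ev (h i j)

          B-t : B.ev t ≋ B.ev f P.^ n P.* (B.ev Θ P.^ j P.* H)
          B-t = begin⟨ P.setoid ⟩
            B.ev t ≈⟨ P.trans (B-hom.*-homo ((f P.^ c) P.^ i) _) (P.*-congˡ (P.trans (B-hom.*-homo (Θ P.^ j) _) (P.*-congˡ (B-hom.*-homo (f P.^ e j) (h i j))))) ⟩
            B.ev ((f P.^ c) P.^ i) P.* (B.ev (Θ P.^ j) P.* (B.ev (f P.^ e j) P.* H))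
              ≈⟨ P.*-cong (P.trans (B-hom.cong (P.^-assocʳ f c i)) (B-hom.^-homo f (c ℕ.* i))) (P.*-cong (B-hom.^-homo Θ j) (P.*-congʳ (B-hom.^-homo f (e j)))) ⟩
            B.ev f P.^ (c ℕ.* i) P.* (B.ev Θ P.^ j P.* (B.ev f P.^ e j P.* H))
              ≈⟨ P.solve 4 (λ a b c d → a P.:* (b P.:* (c P.:* d)) P.:= (a P.:* c) P.:* (b P.:* d)) P.refl _ _ _ _ ⟩
            (B.ev f P.^ (c ℕ.* i) P.* B.ev f P.^ e j) P.* (B.ev Θ P.^ j P.* H) ≈⟨ P.*-congʳ (P.^-homo-* (B.ev f) (c ℕ.* i) (e j)) ⟨
            B.ev f P.^ n P.* (B.ev Θ P.^ j P.* H) ∎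

          main : Poly
          main = (a P.* σV) P.^ n P.* ((a P.* X) P.^ j P.* H)

          Z≋ : Z ≋ a P.^ (c ℕ.* i)
          Z≋ = P.trans (Hom.cong C-hom (trans (^-congˡ i (sym ζ-value)) (^-assocʳ y₀ c i))) (Hom.^-homo C-hom y₀ (c ℕ.* i))

          σ-factor : σ.⟦ factor-ij zi i j PP.P.* Sub.T.ev (h i j) ⟧ ≋ Z P.* (a P.^ w j P.* (X P.^ j P.* σV P.^ n)) P.* H
          σ-factor = P.trans (σ.*-homo (factor-ij zi i j) _) (P.*-cong
            (P.trans (σ.*-homo (PP.C (C (ζ zi ^ i))) _) (P.*-cong (Hom.cong C-hom (At.ev-C x₀ _))
              (P.trans (σ.*-homo (PP.C (f P.^ w j)) _) (P.*-cong (P.trans (Hom.cong C-hom (ev₀.^-homo f (w j))) (Hom.^-homo C-hom y₀ (w j)))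
                (P.trans (σ.*-homo (ε PP.P.^ j) _) (P.*-cong (P.trans (σ.^-homo ε j) (P.^-congˡ j σ-ε)) (σ.^-homo Sub.V n)))))))
            (P.sym (B≋σT (h i j))))

          -- Collecting the powers of `a = f(x₀)`: `a^(ci)` is the prescribed `ζ^i`, and
          -- `a^(e_j + j)` splits as `a^E₀ a^(w_j)`.
          main≋ : main ≋ a P.^ E₀ P.* σ.⟦ factor-ij zi i j PP.P.* Sub.T.ev (h i j) ⟧
          main≋ = begin⟨ P.setoid ⟩
            (a P.* σV) P.^ n P.* ((a P.* X) P.^ j P.* H) ≈⟨ P.*-cong (P.^-distrib-* a σV n) (P.*-congʳ (P.^-distrib-* a X j)) ⟩
            (a P.^ n P.* σV P.^ n) P.* ((a P.^ j P.* X P.^ j) P.* H) ≈⟨ P.*-congʳ (P.*-congʳ (P.trans (P.^-homo-* a (c ℕ.* i) (e j)) (P.*-congʳ (P.sym Z≋)))) ⟩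
            (Z P.* a P.^ e j P.* σV P.^ n) P.* ((a P.^ j P.* X P.^ j) P.* H)
              ≈⟨ P.solve 6 (λ Z ae V aj X H → (Z P.:* ae P.:* V) P.:* ((aj P.:* X) P.:* H) P.:= (ae P.:* aj) P.:* (Z P.:* (X P.:* V) P.:* H)) P.refl Z (a P.^ e j) (σV P.^ n) (a P.^ j) (X P.^ j) H ⟩
            (a P.^ e j P.* a P.^ j) P.* (Z P.* (X P.^ j P.* σV P.^ n) P.* H)
              ≈⟨ P.*-congʳ (P.trans (P.sym (P.^-homo-* a (e j) j)) (P.trans (P.reflexive (≡.cong (a P.^_) (exponents j))) (P.^-homo-* a E₀ (w j)))) ⟩
            (a P.^ E₀ P.* a P.^ w j) P.* (Z P.* (X P.^ j P.* σV P.^ n) P.* H)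
              ≈⟨ P.solve 5 (λ aE aw Z XV H → (aE P.:* aw) P.:* (Z P.:* XV P.:* H) P.:= aE P.:* (Z P.:* (aw P.:* XV) P.:* H)) P.refl (a P.^ E₀) (a P.^ w j) Z (X P.^ j P.* σV P.^ n) H ⟩
            a P.^ E₀ P.* (Z P.* (a P.^ w j P.* (X P.^ j P.* σV P.^ n)) P.* H) ≈⟨ P.*-congˡ (P.sym σ-factor) ⟩
            a P.^ E₀ P.* σ.⟦ factor-ij zi i j PP.P.* Sub.T.ev (h i j) ⟧ ∎

          B-t∣ : X P.^ l P.∣ B.ev t P.- a P.^ E₀ P.* σ.⟦ factor-ij zi i j PP.P.* Sub.T.ev (h i j) ⟧
          B-t∣ = P.∣-cong (begin⟨ P.setoid ⟩
            (a P.* σV) P.^ n P.* (H P.* (B.ev Θ P.^ j P.- (a P.* X) P.^ j))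
              ≈⟨ P.solve 4 (λ v H x y → v P.:* (H P.:* (x P.:- y)) P.:= v P.:* (x P.:* H) P.:- v P.:* (y P.:* H)) P.refl ((a P.* σV) P.^ n) H (B.ev Θ P.^ j) ((a P.* X) P.^ j) ⟩
            (a P.* σV) P.^ n P.* (B.ev Θ P.^ j P.* H) P.- main
              ≈⟨ P.+-cong (P.sym (P.trans B-t (P.*-congʳ (P.^-congˡ n B-f)))) (P.-‿cong main≋) ⟩
            B.ev t P.- a P.^ E₀ P.* σ.⟦ factor-ij zi i j PP.P.* Sub.T.ev (h i j) ⟧ ∎)
            (P.∣-*ˡ ((a P.* σV) P.^ n) (P.∣-*ˡ H (∣-pow (R [X]) j B-Θ)))

        A≋∑∑ : A h ≋ P.∑ m (λ i → P.∑ J (t i))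
        A≋∑∑ = P.∑-cong m λ i _ → P.sym (P.∑-*ˡ J ((f P.^ c) P.^ i) (λ j → Θ P.^ j P.* (f P.^ e j P.* h i j)))

        BA∣ : X P.^ l P.∣ B.ev (A h) P.- a P.^ E₀ P.* σ.⟦ cond zi h ⟧
        BA∣ = P.∣-cong (P.+-cong (P.sym left) (P.-‿cong (P.sym right))) (∣-∑-sub (R [X]) m (λ i → P.∑ J (λ j → B.ev (t i j))) (λ i → P.∑ J (s i))
            λ i _ → ∣-∑-sub (R [X]) J (λ j → B.ev (t i j)) (s i) λ j _ → B-t∣ i j)
          where
          s : ℕ → ℕ → Poly
          s i j = a P.^ E₀ P.* σ.⟦ factor-ij zi i j PP.P.* Sub.T.ev (h i j) ⟧
          left : B.ev (A h) ≋ P.∑ m (λ i → P.∑ J (λ j → B.ev (t i j)))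
          left = P.trans (B-hom.cong A≋∑∑) (P.trans (B-hom.∑-homo m (λ i → P.∑ J (t i))) (P.∑-cong m λ i _ → B-hom.∑-homo J (t i)))
          right : a P.^ E₀ P.* σ.⟦ cond zi h ⟧ ≋ P.∑ m (λ i → P.∑ J (s i))
          right = P.trans (P.*-congˡ (P.trans (σ.∑-homo m (λ i → PP.P.∑ J (λ j → factor-ij zi i j PP.P.* Sub.T.ev (h i j)))) (P.∑-cong m λ i _ → σ.∑-homo J (λ j → factor-ij zi i j PP.P.* Sub.T.ev (h i j)))))
            (P.trans (P.sym (P.∑-*ˡ m (a P.^ E₀) (λ i → P.∑ J (λ j → σ.⟦ factor-ij zi i j PP.P.* Sub.T.ev (h i j) ⟧))))
              (P.∑-cong m λ i _ → P.sym (P.∑-*ˡ J (a P.^ E₀) (λ j → σ.⟦ factor-ij zi i j PP.P.* Sub.T.ev (h i j) ⟧))))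

        -- The substitution `B` is invertible since `f(x₀) ≠ 0`: its inverse sends `ε` to
        -- `(x - x₀) / f(x₀)`, so divisibility by `ε^l` turns into divisibility by `(x - x₀)^l`.
        lin^l∣A : (∀ s → s < l → PP.coeff (cond zi h) s ≋ P.0#) → lin x₀ P.^ l P.∣ A h
        lin^l∣A cond0 = let w , e₀ = X^l∣BA in C y₀⁻¹ P.^ l P.* B⁻.ev w , (begin⟨ P.setoid ⟩
          A h ≈⟨ B⁻∘B (A h) ⟨
          B⁻.ev (B.ev (A h)) ≈⟨ P.trans (B⁻-hom.cong e₀) (B⁻-hom.*-homo (X P.^ l) w) ⟩
          B⁻.ev (X P.^ l) P.* B⁻.ev w ≈⟨ P.*-congʳ (P.trans (B⁻-hom.^-homo X l) (P.trans (P.^-congˡ l B⁻.ev-X) (P.^-distrib-* (C y₀⁻¹) (lin x₀) l))) ⟩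
          C y₀⁻¹ P.^ l P.* lin x₀ P.^ l P.* B⁻.ev w ≈⟨ P.solve 3 (λ a b c → a P.:* b P.:* c P.:= b P.:* (a P.:* c)) P.refl _ _ _ ⟩
          lin x₀ P.^ l P.* (C y₀⁻¹ P.^ l P.* B⁻.ev w) ∎)
          where
          y₀⁻¹ = inv y₀ (f≉0 x₀ x₀∈)
          module B⁻ = Evaluation C-hom (C y₀⁻¹ P.* lin x₀)
          module B⁻-hom = Hom B⁻.ev-hom
          a*a⁻¹ : a P.* C y₀⁻¹ ≋ P.1#
          a*a⁻¹ = P.trans (P.sym (Hom.*-homo C-hom y₀ y₀⁻¹)) (Hom.cong C-hom (*-inv y₀ (f≉0 x₀ x₀∈)))
          B⁻∘B : ∀ g → B⁻.ev (B.ev g) ≋ g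
          B⁻∘B = hom-ext (B⁻.ev-hom ∘ʰ B.ev-hom) id-hom (λ u → P.trans (B⁻-hom.cong (B.ev-C u)) (B⁻.ev-C u)) (begin⟨ P.setoid ⟩
            B⁻.ev (B.ev X) ≈⟨ P.trans (B⁻-hom.cong B.ev-X) (B⁻-hom.+-homo (C x₀) (a P.* X)) ⟩
            B⁻.ev (C x₀) P.+ B⁻.ev (a P.* X) ≈⟨ P.+-cong (B⁻.ev-C x₀) (P.trans (B⁻-hom.*-homo a X) (P.*-cong (B⁻.ev-C y₀) B⁻.ev-X)) ⟩
            C x₀ P.+ a P.* (C y₀⁻¹ P.* lin x₀) ≈⟨ P.+-congˡ (P.trans (P.sym (P.*-assoc a (C y₀⁻¹) (lin x₀))) (P.trans (P.*-congʳ a*a⁻¹) (P.*-identityˡ _))) ⟩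
            C x₀ P.+ (X P.- C x₀) ≈⟨ P.solve 2 (λ x c → c P.:+ (x P.:- c) P.:= x) P.refl X (C x₀) ⟩
            X ∎)
          X^l∣σcond : X P.^ l P.∣ σ.⟦ cond zi h ⟧
          X^l∣σcond = coeff≈0⇒X^∣ l _ λ s s<l → trans (coeff-map-hom (At.ev-hom x₀) (cond zi h) s) (trans (ev₀.cong (cond0 s s<l)) ev₀.0-homo)
          X^l∣BA : X P.^ l P.∣ B.ev (A h)
          X^l∣BA = P.∣-cong (P.solve 2 (λ a b → (a P.:- b) P.:+ b P.:= a) P.refl _ _) (P.∣-+ BA∣ (P.∣-*ˡ (a P.^ E₀) X^l∣σcond))

      h : (Fin (total (λ _ → total K J) m) → Carrier) → ℕ → ℕ → Poly
      h u i j = poly (block K J (block (λ _ → total K J) m u i) j)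

      Φ : (Fin (total (λ _ → total K J) m) → Carrier) → Fin (total (λ _ → total L l) z) → Carrier
      Φ u = flat (λ _ → total L l) z (λ zi → flat L l (λ s b → coeff (PP.coeff (cond zi (h u)) s) (toℕ b)))

      Φ-sub : ∀ u v n → Φ (λ i → u i - v i) n ≈ Φ u n - Φ v n
      Φ-sub u v = flat-sub (λ _ → total L l) z λ zi → flat-sub L l λ s b →
        trans (at (PP.at (cond-sub zi h-sub) s) (toℕ b)) (trans (at (PP.coeff-sub (cond zi (h u)) (cond zi (h v)) s) (toℕ b)) (coeff-sub _ _ (toℕ b)))
        where
        h-sub : ∀ i j → h (λ i → u i - v i) i j ≋ h u i j P.- h v i j
        h-sub i j = coeff-poly-sub (block-sub K J (block-sub (λ _ → total K J) m (λ _ → refl) i) j)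

      cond-0 : ∀ u → (∀ n → Φ u n ≈ 0#) → ∀ zi → zi < z → ∀ s → s < l → PP.coeff (cond zi (h u)) s ≋ P.0#
      cond-0 u Φ0 zi zi<z s s<l = ext coeff0
        where
        g = PP.coeff (cond zi (h u)) s
        zero-below : ∀ (b : Fin (L s)) → coeff g (toℕ b) ≈ 0#
        zero-below = flat-0 L l (flat-0 (λ _ → total L l) z Φ0 zi zi<z) s s<l
        coeff0 : ∀ n → coeff g n ≈ 0#
        coeff0 n with n ℕP.<? L s
        ... | yes n<L = ≡.subst (λ n → coeff g n ≈ 0#) (FinP.toℕ-fromℕ< n<L) (zero-below (Fin.fromℕ< n<L))
        ... | no n≮L = vanish (cond≺ zi (h u) (λ i j → ≺-poly _) s s<l) n (ℕP.≮⇒≥ n≮L)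

      A≋0 : N ≤ length xs ℕ.* l → 1 ≤ q → ∀ u → (∀ n → Φ u n ≈ 0#) → A (h u) ≋ P.0#
      A≋0 N≤ 1≤q u Φ0 = roots-bound l uniq (A (h u))
        (λ x x∈ → let zi , zi<z , v = values x x∈ in Vanishing.lin^l∣A x∈ (h u) zi v (cond-0 u Φ0 zi zi<z))
        (≺-mono N≤ (A≺ (h u) (λ i j → ≺-poly _) 1≤q))

    points-bound : 1 ≤ q → length xs ℕ.* l < N
    points-bound 1≤q = ℕP.≰⇒> λ N≤ →
      let u , (i , ui≉0) , Φ0 = Kernel.kernel R isField unique complete 1<F count Φ Φ-sub in
      ui≉0 (block-0 (λ _ → total K J) m (λ i i<m → block-0 K J λ j j<J b →
        trans (sym (coeff-poly _ b)) (at (A≋0⇒h≋0 (h u) (λ i j → ≺-poly _) (A≋0 N≤ 1≤q u Φ0) i i<m j j<J) (toℕ b))) i)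

-- Sums over lists and the Cartier operator

unique-↭ : ∀ {A : Set} {xs ys : List A} → Unique xs → Unique ys → (∀ {x} → x ∈ xs → x ∈ ys) → (∀ {x} → x ∈ ys → x ∈ xs) → xs ↭ ys
unique-↭ uxs uys to from = ∼bag⇒↭ (unique∧set⇒bag uxs uys (mk⇔ to from))

module ListFold (M : CommutativeMonoid 0ℓ 0ℓ) where
  open CommutativeMonoid M
  open import Algebra.Properties.CommutativeMonoid.Mult M using (×-distrib-+) public
  open import Algebra.Properties.CommutativeSemigroup commutativeSemigroup using (x∙yz≈y∙xz; interchange)

  fold : ∀ {A : Set} → List A → (A → Carrier) → Carrier
  fold [] f = ε
  fold (x ∷ xs) f = f x ∙ fold xs f

  module _ {A : Set} where
    fold-cong : ∀ (xs : List A) {f g} → (∀ x → x ∈ xs → f x ≈ g x) → fold xs f ≈ fold xs g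
    fold-cong [] e = refl
    fold-cong (x ∷ xs) e = ∙-cong (e x (here ≡.refl)) (fold-cong xs (λ y y∈ → e y (there y∈)))

    fold-∙ : ∀ (xs : List A) f g → fold xs (λ x → f x ∙ g x) ≈ fold xs f ∙ fold xs g
    fold-∙ [] f g = sym (identityˡ ε)
    fold-∙ (x ∷ xs) f g = trans (∙-congˡ (fold-∙ xs f g)) (interchange (f x) (g x) _ _)

    fold-↭ : ∀ {xs ys : List A} f → xs ↭ ys → fold xs f ≈ fold ys f
    fold-↭ f Perm.refl = refl
    fold-↭ f (Perm.prep x p) = ∙-congˡ (fold-↭ f p)
    fold-↭ f (Perm.swap x y p) = trans (x∙yz≈y∙xz _ _ _) (∙-congˡ (∙-congˡ (fold-↭ f p)))
    fold-↭ f (Perm.trans p p′) = trans (fold-↭ f p) (fold-↭ f p′)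

    fold-++ : ∀ (xs ys : List A) f → fold (xs ++ ys) f ≈ fold xs f ∙ fold ys f
    fold-++ [] ys f = sym (identityˡ _)
    fold-++ (x ∷ xs) ys f = trans (∙-congˡ (fold-++ xs ys f)) (sym (assoc _ _ _))

  fold-map : ∀ {A B : Set} (g : A → B) xs f → fold (map g xs) f ≡ fold xs (f ∘ g)
  fold-map g [] f = ≡.refl
  fold-map g (x ∷ xs) f = ≡.cong (f (g x) ∙_) (fold-map g xs f)

  fold-× : ∀ {A B : Set} (xs : List A) (ys : List B) f → fold (cartesianProduct xs ys) f ≈ fold xs (λ x → fold ys (λ y → f (x , y)))
  fold-× [] ys f = refl
  fold-× (x ∷ xs) ys f = trans (fold-++ (map (x ,_) ys) (cartesianProduct xs ys) f)
    (∙-cong (reflexive (fold-map (x ,_) ys f)) (fold-× xs ys f))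

module _ (R : CommutativeRing 0ℓ 0ℓ) where
  open RingTheory R

  ∑-single : ∀ n f i → i < n → (∀ j → j < n → j ≢ i → f j ≈ 0#) → ∑ n f ≈ f i
  ∑-single (suc n) f zero _ e = trans (+-congˡ (trans (∑-cong n λ j j<n → e (suc j) (s≤s j<n) λ ()) (∑-0 n))) (+-identityʳ _)
  ∑-single (suc n) f (suc i) (s≤s i<n) e = trans (+-cong (e 0 (s≤s z≤n) λ ())
    (∑-single n (f ∘ suc) i i<n λ j j<n j≢i → e (suc j) (s≤s j<n) (j≢i ∘ ℕP.suc-injective))) (+-identityˡ _)

  open PolyTheory R

  ev-∑ : ∀ x p {n} → p ≺ n → Evaluation.ev {R} id-hom x p ≈ ∑ n (λ i → coeff p i * x ^ i)
  ev-∑ x [] {n} b = sym (trans (∑-cong n λ i _ → zeroˡ _) (∑-0 n))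
  ev-∑ x (a ∷ p) {zero} b = trans (E.cong (≺0⇒≋0 b)) E.0-homo
    where module E = Hom (Evaluation.ev-hom {R} id-hom x)
  ev-∑ x (a ∷ p) {suc n} b = +-cong (sym (*-identityʳ a)) (trans (*-congˡ (ev-∑ x p {n} (bound λ i le → vanish b (suc i) (s≤s le))))
    (trans (sym (∑-*ˡ n x (λ i → coeff p i * x ^ i))) (∑-cong n λ i _ → solve 3 (λ x a y → x :* (a :* y) := a :* (x :* y)) refl x (coeff p i) (x ^ i))))

  -- Cartier operator: the coefficients of U^p V at indices ≡ −1 mod p.
  module _ {p} (pr : Prime p) (ch : CharP p) where
    private
      ∷-^p : ∀ a U → (a ∷ U) P.^ p ≋ C (a ^ p) P.+ X P.^ p P.* U P.^ p
      ∷-^p a U = P.trans (P.^-congˡ p (∷-split a U)) (P.trans (Frobenius.frobenius-+ (R [X]) pr (Hom.CharP-homo C-hom {p} ch) (C a) (X P.* U))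
        (P.+-cong (P.sym (Hom.^-homo C-hom a p)) (P.^-distrib-* X U p)))

    cartier : ∀ U V r → V ≺ r ℕ.+ p → r < p → ∀ i → coeff (U P.^ p P.* V) (r ℕ.+ p ℕ.* i) ≈ coeff U i ^ p * coeff V r
    cartier [] V r bV r<p i = trans (at (P.trans (P.*-congʳ (P.0^ 0<p)) (P.zeroˡ V)) _) (sym (trans (*-congʳ (0^ 0<p)) (zeroˡ _)))
      where
      0<p : 0 < p
      0<p = ℕP.≤-<-trans z≤n r<p
    cartier (a ∷ U) V r bV r<p i = trans (at split (r ℕ.+ p ℕ.* i)) (trans (coeff-⊕ (C (a ^ p) P.* V) (X P.^ p P.* (U P.^ p P.* V)) _)
      (trans (+-congʳ (coeff-C* (a ^ p) V _)) (go i)))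
      where
      split : (a ∷ U) P.^ p P.* V ≋ C (a ^ p) P.* V P.+ X P.^ p P.* (U P.^ p P.* V)
      split = P.trans (P.*-congʳ (∷-^p a U)) (P.solve 4 (λ a x u v → (a P.:+ x P.:* u) P.:* v P.:= a P.:* v P.:+ x P.:* (u P.:* v)) P.refl (C (a ^ p)) (X P.^ p) (U P.^ p) V)
      go : ∀ i → a ^ p * coeff V (r ℕ.+ p ℕ.* i) + coeff (X P.^ p P.* (U P.^ p P.* V)) (r ℕ.+ p ℕ.* i) ≈ coeff (a ∷ U) i ^ p * coeff V r
      go zero rewrite ℕP.*-zeroʳ p | ℕP.+-identityʳ r = trans (+-congˡ (coeff-X^*-< r<p _)) (+-identityʳ _)
      go (suc i) = trans (+-cong (trans (*-congˡ (vanish bV _ (ℕP.+-monoʳ-≤ r (ℕP.≤-trans (ℕP.m≤m+n p (p ℕ.* i)) (ℕP.≤-reflexive (≡.sym (ℕP.*-suc p i))))))) (zeroʳ _))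
          (trans (reflexive (≡.cong (coeff (X P.^ p P.* (U P.^ p P.* V))) index)) (trans (coeff-X^*-+ p (U P.^ p P.* V) (r ℕ.+ p ℕ.* i)) (cartier U V r bV r<p i))))
        (+-identityˡ _)
        where
        index : r ℕ.+ p ℕ.* suc i ≡ p ℕ.+ (r ℕ.+ p ℕ.* i)
        index = ℕSolver.solve (r ∷ p ∷ i ∷ [])

-- Finite fields

module FiniteFieldTheory (R : CommutativeRing 0ℓ 0ℓ) (isField : IsDiscreteField R)
  {elements : List (CommutativeRing.Carrier R)} (unique : Unique elements) (complete : ∀ x → x ∈ elements)
  {p k : ℕ} (pr : Prime p) (order : length elements ≡ p ℕ.^ k) where
  open RingTheory R
  open PolyTheory R
  open FieldTheory R isField
  module Sum = ListFold +-commutativeMonoid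
  private
    module Prod = ListFold *-commutativeMonoid
    q = p ℕ.^ k

  infix 4 _≈?_
  _≈?_ = _≟_

  Σ : (Carrier → Carrier) → Carrier
  Σ = Sum.fold elements

  Σ-*ˡ : ∀ {A : Set} (xs : List A) a f → Sum.fold xs (λ x → a * f x) ≈ a * Sum.fold xs f
  Σ-*ˡ [] a f = sym (zeroʳ a)
  Σ-*ˡ (x ∷ xs) a f = trans (+-congˡ (Σ-*ˡ xs a f)) (sym (distribˡ a _ _))

  Σ-const : ∀ {A : Set} (xs : List A) → Sum.fold xs (λ _ → 1#) ≈ ι (length xs)
  Σ-const [] = refl
  Σ-const (x ∷ xs) = +-congˡ (Σ-const xs)

  Σ-0 : ∀ {A : Set} (xs : List A) → Sum.fold xs (λ _ → 0#) ≈ 0#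
  Σ-0 [] = refl
  Σ-0 (x ∷ xs) = trans (+-identityˡ _) (Σ-0 xs)

  Σ-∑ : ∀ n (f : Carrier → ℕ → Carrier) → Σ (λ x → ∑ n (f x)) ≈ ∑ n (λ i → Σ (λ x → f x i))
  Σ-∑ zero f = Σ-0 elements
  Σ-∑ (suc n) f = trans (Sum.fold-∙ elements (λ x → f x 0) (λ x → ∑ n (f x ∘ suc))) (+-congˡ (Σ-∑ n (λ x → f x ∘ suc)))

  count-indicator : ∀ {A : Set} {P : Pred A 0ℓ} (P? : Decidable P) (g : A → Carrier) →
    (∀ x → P x → g x ≈ 1#) → (∀ x → ¬ P x → g x ≈ 0#) → ∀ xs → ι (length (filter P? xs)) ≈ Sum.fold xs g
  count-indicator P? g y n [] = refl
  count-indicator P? g y n (x ∷ xs) with P? x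
  ... | yes px = +-cong (sym (y x px)) (count-indicator P? g y n xs)
  ... | no ¬px = trans (count-indicator P? g y n xs) (trans (sym (+-identityˡ _)) (+-congʳ (sym (n x ¬px))))

  private
    translate : ∀ a → map (λ x → a + x) elements ↭ elements
    translate a = unique-↭ (UniqueP.map⁺ (λ {x} {y} e → ≈⇒≡ (begin⟨ setoid ⟩
        x ≈⟨ solve 2 (λ a x → x := (a :+ x) :- a) refl a x ⟩
        (a + x) - a ≈⟨ +-congʳ (reflexive e) ⟩
        (a + y) - a ≈⟨ solve 2 (λ a x → x := (a :+ x) :- a) refl a y ⟨
        y ∎)) unique) unique (λ _ → complete _)
      (λ {x} _ → ≡.subst (_∈ map (λ x → a + x) elements) (≈⇒≡ (solve 2 (λ a x → a :+ (x :- a) := x) refl a x)) (∈-map⁺ (λ x → a + x) (complete (x - a))))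

  -- Translation by 1 permutes the field, so the sum of all `1 + x` equals the sum of all `x`.
  ι-q : ι q ≈ 0#
  ι-q = begin⟨ setoid ⟩
    ι q ≈⟨ reflexive (≡.cong ι order) ⟨
    ι (length elements) ≈⟨ Σ-const elements ⟨
    Σ (λ _ → 1#) ≈⟨ solve 2 (λ a b → a := (a :+ b) :- b) refl _ (Σ (λ x → x)) ⟩
    (Σ (λ _ → 1#) + Σ (λ x → x)) - Σ (λ x → x) ≈⟨ +-congʳ (sym (Sum.fold-∙ elements (λ _ → 1#) (λ x → x))) ⟩
    Σ (λ x → 1# + x) - Σ (λ x → x) ≈⟨ +-congʳ (trans (reflexive (≡.sym (Sum.fold-map (λ x → 1# + x) elements (λ x → x)))) (Sum.fold-↭ (λ x → x) (translate 1#))) ⟩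
    Σ (λ x → x) - Σ (λ x → x) ≈⟨ -‿inverseʳ _ ⟩
    0# ∎

  ι-p : CharP p
  ι-p with ι p ≈? 0#
  ... | yes e = e
  ... | no ne = ⊥-elim (go k ι-q)
    where
    go : ∀ k → ¬ ι (p ℕ.^ k) ≈ 0#
    go zero e = 0≉1 (trans (sym e) (+-identityʳ 1#))
    go (suc k) e = *≉0 ne (go k) (trans (sym (×1-homo-* p (p ℕ.^ k))) e)

  -- A nonzero remainder modulo `p` would be coprime to `p` and also vanish in the field, and Bézout
  -- would give 0 = 1.
  ι≈0⇒∣ : ∀ n → ι n ≈ 0# → p ∣ⁿ n
  ι≈0⇒∣ n e = helper (n DivMod.% p) ≡.refl
    where
    instance _ = prime⇒nonZero pr
    ι-r : ι (n DivMod.% p) ≈ 0#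
    ι-r = begin⟨ setoid ⟩
      ι (n DivMod.% p) ≈⟨ +-identityʳ _ ⟨
      ι (n DivMod.% p) + 0# ≈⟨ +-congˡ (trans (×1-homo-* (n DivMod./ p) p) (trans (*-congˡ ι-p) (zeroʳ _))) ⟨
      ι (n DivMod.% p) + ι (n DivMod./ p ℕ.* p) ≈⟨ ×-homo-+ 1# (n DivMod.% p) _ ⟨
      ι (n DivMod.% p ℕ.+ n DivMod./ p ℕ.* p) ≈⟨ reflexive (≡.cong ι (DivMod.m≡m%n+[m/n]*n n p)) ⟨
      ι n ≈⟨ e ⟩
      0# ∎
    ι-multiple : ∀ {x} m → ι m ≈ 0# → ι (x ℕ.* m) ≈ 0#
    ι-multiple {x} m e = trans (×1-homo-* x m) (trans (*-congˡ e) (zeroʳ _))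
    ι1+≉0 : ∀ {a b x y} → ι a ≈ 0# → ι b ≈ 0# → 1 ℕ.+ y ℕ.* b ≡ x ℕ.* a → 0# ≈ 1#
    ι1+≉0 {a} {b} {x} {y} ea eb eq = begin⟨ setoid ⟩
      0# ≈⟨ ι-multiple {x} a ea ⟨
      ι (x ℕ.* a) ≈⟨ reflexive (≡.cong ι eq) ⟨
      1# + ι (y ℕ.* b) ≈⟨ trans (+-congˡ (ι-multiple {y} b eb)) (+-identityʳ 1#) ⟩
      1# ∎
    helper : ∀ r → n DivMod.% p ≡ r → p ∣ⁿ n
    helper zero r≡ = ℕD.m%n≡0⇒n∣m n p r≡
    helper (suc r) r≡ with coprime-Bézout (prime⇒coprime pr (≡.subst (_< p) r≡ (DivMod.m%n<n n p)))
    ... | Bézout.Identity.+- x y eq = ⊥-elim (0≉1 (ι1+≉0 {p} {suc r} {x} {y} ι-p (≡.subst (λ r → ι r ≈ 0#) r≡ ι-r) eq))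
    ... | Bézout.Identity.-+ x y eq = ⊥-elim (0≉1 (ι1+≉0 {suc r} {p} {y} {x} (≡.subst (λ r → ι r ≈ 0#) r≡ ι-r) ι-p eq))

  ι≉0 : ∀ n → 0 < n → n < p → ¬ ι n ≈ 0#
  ι≉0 n 0<n n<p e = ℕP.<⇒≱ n<p (ℕD.∣⇒≤ {{ℕ.>-nonZero 0<n}} (ι≈0⇒∣ n e))

  nonzero : List Carrier
  nonzero = filter (λ x → ¬? (x ≈? 0#)) elements

  nonzero-unique : Unique nonzero
  nonzero-unique = UniqueP.filter⁺ (λ x → ¬? (x ≈? 0#)) unique

  nonzero⁺ : ∀ {x} → ¬ x ≈ 0# → x ∈ nonzero
  nonzero⁺ x≉0 = ∈-filter⁺ (λ x → ¬? (x ≈? 0#)) (complete _) x≉0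

  nonzero⁻ : ∀ {x} → x ∈ nonzero → ¬ x ≈ 0#
  nonzero⁻ x∈ = proj₂ (∈-filter⁻ (λ x → ¬? (x ≈? 0#)) {xs = elements} x∈)

  elements-↭ : elements ↭ 0# ∷ nonzero
  elements-↭ = unique-↭ unique (All.tabulate (λ x∈ 0≡x → nonzero⁻ x∈ (reflexive (≡.sym 0≡x))) ∷ nonzero-unique)
    (λ {x} _ → cover x) (λ _ → complete _)
    where
    cover : ∀ x → x ∈ 0# ∷ nonzero
    cover x with x ≈? 0#
    ... | yes x≈0 = here (≈⇒≡ x≈0)
    ... | no x≉0 = there (nonzero⁺ x≉0)

  Q : ℕ
  Q = length nonzero

  1+Q≡q : suc Q ≡ q
  1+Q≡q = ≡.trans (≡.sym (↭-length elements-↭)) order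

  -- Multiplication by `x` permutes the nonzero elements, so `x ^ Q` fixes their product.
  x^Q≈1 : ∀ x → ¬ x ≈ 0# → x ^ Q ≈ 1#
  x^Q≈1 x x≉0 = x-y≈0⇒x≈y (*-cancel-0 prod≉0 (begin⟨ setoid ⟩
    prod * (x ^ Q - 1#) ≈⟨ solve 2 (λ p a → p :* (a :- p :^ 0) := a :* p :- p) refl prod (x ^ Q) ⟩
    x ^ Q * prod - prod ≈⟨ +-congʳ (trans (sym (prod-* nonzero)) (trans (reflexive (≡.sym (Prod.fold-map (x *_) nonzero (λ y → y)))) (Prod.fold-↭ (λ y → y) scale))) ⟩
    prod - prod ≈⟨ -‿inverseʳ _ ⟩
    0# ∎))
    where
    prod = Prod.fold nonzero (λ y → y)
    prod-* : ∀ xs → Prod.fold xs (x *_) ≈ x ^ length xs * Prod.fold xs (λ y → y)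
    prod-* [] = sym (*-identityˡ _)
    prod-* (y ∷ xs) = trans (*-congˡ (prod-* xs)) (solve 4 (λ x y a b → x :* y :* (a :* b) := x :* a :* (y :* b)) refl x y _ _)
    all≉0 : ∀ xs → (∀ y → y ∈ xs → ¬ y ≈ 0#) → ¬ Prod.fold xs (λ y → y) ≈ 0#
    all≉0 [] _ e = 0≉1 (sym e)
    all≉0 (y ∷ xs) ne = *≉0 (ne y (here ≡.refl)) (all≉0 xs (λ z z∈ → ne z (there z∈)))
    prod≉0 : ¬ prod ≈ 0#
    prod≉0 = all≉0 nonzero (λ y → nonzero⁻)
    x⁻¹ = inv x x≉0
    cancel : ∀ y → x * (x⁻¹ * y) ≈ y
    cancel y = trans (sym (*-assoc _ _ _)) (trans (*-congʳ (*-inv x x≉0)) (*-identityˡ y))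
    scale : map (x *_) nonzero ↭ nonzero
    scale = unique-↭ (UniqueP.map⁺ (λ {y} {z} e → ≈⇒≡ (x-y≈0⇒x≈y (*-cancel-0 x≉0
          (trans (solve 3 (λ x y z → x :* (y :- z) := x :* y :- x :* z) refl x y z) (x≈y⇒x-y≈0 (reflexive e)))))) nonzero-unique) nonzero-unique
      (λ y∈ → nonzero⁺ (map≉0 nonzero (λ y → nonzero⁻) y∈))
      (λ {y} y∈ → ≡.subst (_∈ map (x *_) nonzero) (≈⇒≡ (cancel y)) (∈-map⁺ (x *_) (nonzero⁺ (λ e → nonzero⁻ y∈ (trans (sym (cancel y)) (trans (*-congˡ e) (zeroʳ x)))))))
      where
      map≉0 : ∀ xs → (∀ y → y ∈ xs → ¬ y ≈ 0#) → ∀ {y} → y ∈ map (x *_) xs → ¬ y ≈ 0#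
      map≉0 (z ∷ xs) ne (here ≡.refl) = *≉0 x≉0 (ne z (here ≡.refl))
      map≉0 (z ∷ xs) ne (there y∈) = map≉0 xs (λ y y∈ → ne y (there y∈)) y∈

  x^q≈x : ∀ x → x ^ q ≈ x
  x^q≈x x = trans (reflexive (≡.cong (x ^_) (≡.sym 1+Q≡q))) lem
    where
    lem : x * x ^ Q ≈ x
    lem with x ≈? 0#
    ... | yes x≈0 = trans (*-congʳ x≈0) (trans (zeroˡ _) (sym x≈0))
    ... | no x≉0 = trans (*-congˡ (x^Q≈1 x x≉0)) (*-identityʳ x)

-- h j = (p^j − 1)/2, Q j = p^j − 1 and c j = (p^j − 1)/(p − 1) for p = 2n + 1.
module Exponents (n : ℕ) where
  p : ℕ
  p = suc (n ℕ.+ n)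

  h Qₑ c : ℕ → ℕ
  h zero = 0
  h (suc j) = p ℕ.* h j ℕ.+ n
  Qₑ zero = 0
  Qₑ (suc j) = (n ℕ.+ n) ℕ.+ p ℕ.* Qₑ j
  c zero = 0
  c (suc j) = suc (p ℕ.* c j)

  h+h≡Q : ∀ j → h j ℕ.+ h j ≡ Qₑ j
  h+h≡Q zero = ≡.refl
  h+h≡Q (suc j) rewrite ≡.sym (h+h≡Q j) = lemma (h j)
    where
    lemma : ∀ h → (suc (n ℕ.+ n) ℕ.* h ℕ.+ n) ℕ.+ (suc (n ℕ.+ n) ℕ.* h ℕ.+ n) ≡ (n ℕ.+ n) ℕ.+ suc (n ℕ.+ n) ℕ.* (h ℕ.+ h)
    lemma h = ℕSolver.solve (n ∷ h ∷ [])

  1+Q≡p^ : ∀ j → suc (Qₑ j) ≡ p ℕ.^ j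
  1+Q≡p^ zero = ≡.refl
  1+Q≡p^ (suc j) rewrite ≡.sym (1+Q≡p^ j) = lemma (Qₑ j)
    where
    lemma : ∀ q → suc ((n ℕ.+ n) ℕ.+ suc (n ℕ.+ n) ℕ.* q) ≡ suc (n ℕ.+ n) ℕ.* suc q
    lemma q = ℕSolver.solve (n ∷ q ∷ [])

  Q≡mc : ∀ j → Qₑ j ≡ (n ℕ.+ n) ℕ.* c j
  Q≡mc zero = ≡.sym (ℕP.*-zeroʳ (n ℕ.+ n))
  Q≡mc (suc j) rewrite Q≡mc j = lemma (c j)
    where
    lemma : ∀ c → (n ℕ.+ n) ℕ.+ suc (n ℕ.+ n) ℕ.* ((n ℕ.+ n) ℕ.* c) ≡ (n ℕ.+ n) ℕ.* suc (suc (n ℕ.+ n) ℕ.* c)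
    lemma c = ℕSolver.solve (n ∷ c ∷ [])

module _ (R : CommutativeRing 0ℓ 0ℓ) (n : ℕ) (pr : Prime (Exponents.p n)) (ch : RingTheory.CharP R (Exponents.p n)) where
  open Exponents n
  open RingTheory R
  open PolyTheory R

  -- One Cartier step for each digit of `q - 1` in base `p`: `V^h(j+1)` is `(V^h(j))^p V^n`, and
  -- every digit equals `p - 1`. Degree at most 3 keeps `V^n` short enough for a single coefficient
  -- of it to contribute.
  coeff-power : ∀ V → V ≺ 4 → ∀ j → coeff (V P.^ h j) (Qₑ j) ≈ coeff (V P.^ n) (n ℕ.+ n) ^ c j
  coeff-power V bV zero = refl
  coeff-power V bV (suc j) = begin⟨ setoid ⟩
    coeff (V P.^ (p ℕ.* h j ℕ.+ n)) i′ ≈⟨ at (P.trans (P.^-homo-* V (p ℕ.* h j) n) (P.*-congʳ (P.trans (P.reflexive (≡.cong (V P.^_) (ℕP.*-comm p (h j)))) (P.sym (P.^-assocʳ V (h j) p))))) i′ ⟩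
    coeff ((V P.^ h j) P.^ p P.* V P.^ n) i′ ≈⟨ cartier R pr ch (V P.^ h j) (V P.^ n) (n ℕ.+ n) (≺-mono le (≺-^ 3 n bV)) ℕP.≤-refl (Qₑ j) ⟩
    coeff (V P.^ h j) (Qₑ j) ^ p * H ≈⟨ *-congʳ (^-congˡ p (coeff-power V bV j)) ⟩
    (H ^ c j) ^ p * H ≈⟨ *-congʳ (trans (^-assocʳ H (c j) p) (reflexive (≡.cong (H ^_) (ℕP.*-comm (c j) p)))) ⟩
    H ^ (p ℕ.* c j) * H ≈⟨ *-comm _ _ ⟩
    H ^ c (suc j) ∎
    where
    i′ = Qₑ (suc j)
    H = coeff (V P.^ n) (n ℕ.+ n)
    le : suc (n ℕ.* 3) ≤ (n ℕ.+ n) ℕ.+ p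
    le = ≡.subst (suc (n ℕ.* 3) ≤_) lemma (ℕP.m≤m+n (suc (n ℕ.* 3)) n)
      where
      lemma : suc (n ℕ.* 3) ℕ.+ n ≡ (n ℕ.+ n) ℕ.+ suc (n ℕ.+ n)
      lemma = ℕSolver.solve (n ∷ [])

-- Counting points modulo p

module PowerSums (R : CommutativeRing 0ℓ 0ℓ) (isField : IsDiscreteField R)
  {elements : List (CommutativeRing.Carrier R)} (unique : Unique elements) (complete : ∀ x → x ∈ elements)
  {p k : ℕ} (pr : Prime p) (order : length elements ≡ p ℕ.^ k) where
  open RingTheory R
  open PolyTheory R
  open FieldTheory R isField
  open FiniteFieldTheory R isField unique complete {p} {k} pr order

  eval-X^-1 : ∀ x r → eval x (X P.^ r P.- P.1#) ≈ x ^ r - 1#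
  eval-X^-1 x r = trans (Ev.sub-homo (X P.^ r) P.1#) (+-cong (trans (Ev.^-homo X r) (^-congˡ r (At.ev-X x))) (-‿cong Ev.1-homo))
    where module Ev = Hom (At.ev-hom x)

  private
    psum : ℕ → Carrier
    psum r = Σ (λ x → x ^ r)

    psum-0 : psum 0 ≈ 0#
    psum-0 = trans (Σ-const elements) (trans (reflexive (≡.cong ι order)) ι-q)

  X^-1≉0 : ∀ r → 0 < r → (X P.^ r P.- P.1#) ≉0
  X^-1≉0 r 0<r e = 0≉1 (begin⟨ setoid ⟩
    0# ≈⟨ -0≈0 ⟨
    - 0# ≈⟨ -‿cong (Hom.cong (At.ev-hom 0#) e) ⟨
    - eval 0# (X P.^ r P.- P.1#) ≈⟨ -‿cong (trans (eval-X^-1 0# r) (+-congʳ (0^ 0<r))) ⟩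
    - (0# - 1#) ≈⟨ solve 1 (λ z → :- (con (ℤ.+ 0) :- z) := z) refl 1# ⟩
    1# ∎)

  X^-1≺ : ∀ r → X P.^ r P.- P.1# ≺ suc r
  X^-1≺ r = ≺-+ (≡.subst (λ n → X P.^ r ≺ suc n) (ℕP.*-identityʳ r) (≺-^ 1 r ≺-X)) (≺-neg (≺-mono (s≤s z≤n) ≺-C))

  non-root : ∀ r → 0 < r → r < Q → ∃ λ g → ¬ g ≈ 0# × ¬ g ^ r ≈ 1#
  non-root r 0<r r<Q = go (All.all? (λ x → x ^ r ≈? 1#) nonzero)
    where
    go : Dec (All (λ x → x ^ r ≈ 1#) nonzero) → ∃ λ g → ¬ g ≈ 0# × ¬ g ^ r ≈ 1#
    go (yes all) = ⊥-elim (ℕP.<⇒≱ r<Q (roots-bound₁ nonzero-unique (X P.^ r P.- P.1#) (X^-1≉0 r 0<r)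
      (λ x x∈ → trans (eval-X^-1 x r) (x≈y⇒x-y≈0 (All.lookup all x∈))) (X^-1≺ r)))
    go (no ¬all) = let g , g∈ , ne = find (¬All⇒Any¬ (λ x → x ^ r ≈? 1#) nonzero ¬all) in g , nonzero⁻ g∈ , ne

  private
    scale : ∀ {g} → ¬ g ≈ 0# → map (λ x → g * x) elements ↭ elements
    scale {g} g≉0 = unique-↭ (UniqueP.map⁺ (λ {y} {z} e → ≈⇒≡ (x-y≈0⇒x≈y (*-cancel-0 g≉0
          (trans (solve 3 (λ x y z → x :* (y :- z) := x :* y :- x :* z) refl g y z) (x≈y⇒x-y≈0 (reflexive e)))))) unique) unique
      (λ _ → complete _)
      (λ {y} _ → ≡.subst (_∈ map (λ x → g * x) elements) (≈⇒≡ (trans (sym (*-assoc _ _ _)) (trans (*-congʳ (*-inv g g≉0)) (*-identityˡ y)))) (∈-map⁺ (λ x → g * x) (complete (inv g g≉0 * y))))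

    -- Scaling by `g` permutes the field and multiplies the sum by `g ^ r`, which is not 1 for a
    -- suitable `g`.
    psum-mid : ∀ r → 0 < r → r < Q → psum r ≈ 0#
    psum-mid r 0<r r<Q = let g , g≉0 , gʳ≉1 = non-root r 0<r r<Q in
      *-cancel-0 (λ e → gʳ≉1 (x-y≈0⇒x≈y e)) (begin⟨ setoid ⟩
        (g ^ r - 1#) * psum r ≈⟨ solve 2 (λ a s → (a :- s :^ 0) :* s := a :* s :- s) refl (g ^ r) (psum r) ⟩
        g ^ r * psum r - psum r ≈⟨ +-congʳ (Σ-*ˡ elements (g ^ r) (λ x → x ^ r)) ⟨
        Σ (λ x → g ^ r * x ^ r) - psum r ≈⟨ +-congʳ (Sum.fold-cong elements λ x _ → sym (^-distrib-* g x r)) ⟩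
        Σ (λ x → (g * x) ^ r) - psum r ≈⟨ +-congʳ (trans (reflexive (≡.sym (Sum.fold-map (λ x → g * x) elements (λ x → x ^ r)))) (Sum.fold-↭ (λ x → x ^ r) (scale g≉0))) ⟩
        psum r - psum r ≈⟨ -‿inverseʳ _ ⟩
        0# ∎)

  module _ (0<Q : 0 < Q) where
    private
      psum-Q : psum Q ≈ - 1#
      psum-Q = begin⟨ setoid ⟩
        psum Q ≈⟨ Sum.fold-↭ (λ x → x ^ Q) elements-↭ ⟩
        0# ^ Q + Sum.fold nonzero (λ x → x ^ Q) ≈⟨ +-cong (0^ 0<Q) (trans (Sum.fold-cong nonzero λ x x∈ → x^Q≈1 x (nonzero⁻ x∈)) (Σ-const nonzero)) ⟩
        0# + ι Q ≈⟨ solve 2 (λ z a → con (ℤ.+ 0) :+ a := (z :+ a) :- z) refl 1# (ι Q) ⟩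
        ι (suc Q) - 1# ≈⟨ +-congʳ (trans (reflexive (≡.cong ι 1+Q≡q)) ι-q) ⟩
        0# - 1# ≈⟨ +-identityˡ _ ⟩
        - 1# ∎

      psum-shift : ∀ r → psum (suc r ℕ.+ Q) ≈ psum (suc r)
      psum-shift r = Sum.fold-cong elements λ x _ → begin⟨ setoid ⟩
        x ^ (suc r ℕ.+ Q) ≈⟨ reflexive (≡.cong (x ^_) (≡.trans (≡.sym (ℕP.+-suc r Q)) (≡.cong (r ℕ.+_) 1+Q≡q))) ⟩
        x ^ (r ℕ.+ p ℕ.^ k) ≈⟨ ^-homo-* x r (p ℕ.^ k) ⟩
        x ^ r * x ^ (p ℕ.^ k) ≈⟨ trans (*-congˡ (x^q≈x x)) (*-comm _ _) ⟩
        x ^ suc r ∎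

      psum≈0 : ∀ r → r < Q ℕ.+ Q → r ≢ Q → psum r ≈ 0#
      psum≈0 r r<2Q r≢Q with ℕP.<-cmp r Q
      ... | tri≈ _ r≡Q _ = ⊥-elim (r≢Q r≡Q)
      psum≈0 zero _ _ | tri< _ _ _ = psum-0
      psum≈0 (suc r) _ _ | tri< r<Q _ _ = psum-mid (suc r) (s≤s z≤n) r<Q
      psum≈0 r r<2Q _ | tri> _ _ Q<r = begin⟨ setoid ⟩
        psum r ≈⟨ reflexive (≡.cong psum r≡) ⟩
        psum (suc t ℕ.+ Q) ≈⟨ psum-shift t ⟩
        psum (suc t) ≈⟨ psum-mid (suc t) (s≤s z≤n) (ℕP.+-cancelʳ-< Q (suc t) Q (≡.subst (_< Q ℕ.+ Q) r≡ r<2Q)) ⟩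
        0# ∎
        where
        t = r ∸ suc Q
        r≡ : r ≡ suc t ℕ.+ Q
        r≡ = ≡.trans (≡.sym (ℕP.m∸n+n≡m Q<r)) (ℕP.+-suc t Q)

    -- Among the exponents below `2 Q` only `Q` has a nonzero power sum, namely `-1`. At `2 Q` the
    -- sum is nonzero again, whence the degree bound.
    Σ-eval : ∀ V → V ≺ Q ℕ.+ Q → Σ (λ x → eval x V) ≈ - coeff V Q
    Σ-eval V b = begin⟨ setoid ⟩
      Σ (λ x → eval x V) ≈⟨ Sum.fold-cong elements (λ x _ → ev-∑ R x V b) ⟩
      Σ (λ x → ∑ (Q ℕ.+ Q) (λ i → coeff V i * x ^ i)) ≈⟨ Σ-∑ (Q ℕ.+ Q) (λ x i → coeff V i * x ^ i) ⟩
      ∑ (Q ℕ.+ Q) (λ i → Σ (λ x → coeff V i * x ^ i)) ≈⟨ ∑-cong (Q ℕ.+ Q) (λ i _ → Σ-*ˡ elements (coeff V i) (λ x → x ^ i)) ⟩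
      ∑ (Q ℕ.+ Q) (λ i → coeff V i * psum i) ≈⟨ ∑-single R (Q ℕ.+ Q) (λ i → coeff V i * psum i) Q (ℕP.m<m+n Q 0<Q) (λ i i<2Q i≢Q → trans (*-congˡ (psum≈0 i i<2Q i≢Q)) (zeroʳ _)) ⟩
      coeff V Q * psum Q ≈⟨ *-congˡ psum-Q ⟩
      coeff V Q * - 1# ≈⟨ solve 1 (λ v → v :* :- (v :^ 0) := :- v) refl (coeff V Q) ⟩
      - coeff V Q ∎

    module _ (h : ℕ) (h+h≡Q : h ℕ.+ h ≡ Q) where
      private
        -- The quotient `((y²)^q - v^q) / (y² - v)`. Since `q`-th powers are trivial it equals 1
        -- where `y² ≠ v`; where `y² = v` it is a sum of `q` equal terms, hence 0. So `1 - S v y`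
        -- indicates the square roots of `v`.
        S : Carrier → Carrier → Carrier
        S v y = ∑ (suc Q) (λ i → (y * y) ^ i * v ^ (Q ∸ i))

        ^-split : ∀ v i → i ≤ Q → v ^ i * v ^ (Q ∸ i) ≈ v ^ Q
        ^-split v i i≤Q = trans (sym (^-homo-* v i (Q ∸ i))) (reflexive (≡.cong (v ^_) (ℕP.m+[n∸m]≡n i≤Q)))

        ∑-const : ∀ n a → ∑ n (λ _ → a) ≈ ι n * a
        ∑-const zero a = sym (zeroˡ a)
        ∑-const (suc n) a = trans (+-cong (sym (*-identityˡ a)) (∑-const n a)) (sym (distribʳ a 1# (ι n)))

        S-root : ∀ v y → y * y ≈ v → S v y ≈ 0#
        S-root v y e = begin⟨ setoid ⟩
          S v y ≈⟨ ∑-cong (suc Q) (λ i i≤Q → trans (*-congʳ (^-congˡ i e)) (^-split v i (ℕ.s≤s⁻¹ i≤Q))) ⟩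
          ∑ (suc Q) (λ _ → v ^ Q) ≈⟨ ∑-const (suc Q) (v ^ Q) ⟩
          ι (suc Q) * v ^ Q ≈⟨ trans (*-congʳ (trans (reflexive (≡.cong ι 1+Q≡q)) ι-q)) (zeroˡ _) ⟩
          0# ∎

        x^1+Q : ∀ x → x ^ suc Q ≈ x
        x^1+Q x = trans (reflexive (≡.cong (x ^_) 1+Q≡q)) (x^q≈x x)

        S-nonroot : ∀ v y → ¬ y * y ≈ v → S v y ≈ 1#
        S-nonroot v y ne = x-y≈0⇒x≈y (*-cancel-0 (λ e → ne (x-y≈0⇒x≈y e)) (begin⟨ setoid ⟩
          (y * y - v) * (S v y - 1#) ≈⟨ solve 2 (λ d s → d :* (s :- d :^ 0) := d :* s :- d) refl (y * y - v) (S v y) ⟩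
          (y * y - v) * S v y - (y * y - v) ≈⟨ +-congʳ (trans (geometric (y * y) v Q) (+-cong (x^1+Q (y * y)) (-‿cong (x^1+Q v)))) ⟩
          (y * y - v) - (y * y - v) ≈⟨ -‿inverseʳ _ ⟩
          0# ∎))

        -- Only `i = h` and `i = Q` survive, where the exponent `2 i` is `Q` or `2 Q`. The term
        -- `i = 0` drops out because its power sum counts all `q` elements.
        Σ-S : ∀ v → Σ (S v) ≈ - (v ^ h) - 1#
        Σ-S v = begin⟨ setoid ⟩
          Σ (S v) ≈⟨ Σ-∑ (suc Q) (λ y i → (y * y) ^ i * v ^ (Q ∸ i)) ⟩
          ∑ (suc Q) (λ i → Σ (λ y → (y * y) ^ i * v ^ (Q ∸ i))) ≈⟨ ∑-cong (suc Q) (λ i _ → trans (Sum.fold-cong elements λ y _ → trans (*-comm _ _) (*-congˡ (y²^ y i))) (Σ-*ˡ elements (v ^ (Q ∸ i)) (λ y → y ^ (i ℕ.+ i)))) ⟩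
          ∑ (suc Q) u ≈⟨ ∑-last Q u ⟩
          ∑ Q u + u Q ≈⟨ +-cong (∑-single R Q u h h<Q (λ i i<Q i≢h → trans (*-congˡ (psum≈0 (i ℕ.+ i) (ℕP.+-mono-< i<Q i<Q) (λ e → i≢h (halve (≡.trans e (≡.sym h+h≡Q)))))) (zeroʳ _))) (*-cong (reflexive (≡.cong (v ^_) (ℕP.n∸n≡0 Q))) psum-2Q) ⟩
          v ^ (Q ∸ h) * psum (h ℕ.+ h) + 1# * - 1# ≈⟨ +-cong (*-cong (reflexive (≡.cong (v ^_) Q∸h)) (trans (reflexive (≡.cong psum h+h≡Q)) psum-Q)) refl ⟩
          v ^ h * - 1# + 1# * - 1# ≈⟨ solve 2 (λ a z → a :* :- (z :^ 0) :+ z :^ 0 :* :- (z :^ 0) := :- a :- z :^ 0) refl (v ^ h) 0# ⟩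
          - (v ^ h) - 1# ∎
          where
          u : ℕ → Carrier
          u i = v ^ (Q ∸ i) * psum (i ℕ.+ i)
          y²^ : ∀ y i → (y * y) ^ i ≈ y ^ (i ℕ.+ i)
          y²^ y i = trans (^-distrib-* y y i) (sym (^-homo-* y i i))
          0<h : 0 < h
          0<h = ℕP.n≢0⇒n>0 (λ e → ℕP.<⇒≢ 0<Q (≡.trans (≡.cong (λ h → h ℕ.+ h) (≡.sym e)) h+h≡Q))
          h<Q : h < Q
          h<Q = ≡.subst (h <_) h+h≡Q (ℕP.m<m+n h 0<h)
          Q∸h : Q ∸ h ≡ h
          Q∸h = ≡.trans (≡.cong (_∸ h) (≡.sym h+h≡Q)) (ℕP.m+n∸n≡m h h)
          halve : ∀ {i j} → i ℕ.+ i ≡ j ℕ.+ j → i ≡ j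
          halve {i} {j} e with ℕP.<-cmp i j
          ... | tri< i<j _ _ = ⊥-elim (ℕP.<⇒≢ (ℕP.+-mono-< i<j i<j) e)
          ... | tri≈ _ i≡j _ = i≡j
          ... | tri> _ _ j<i = ⊥-elim (ℕP.<⇒≢ (ℕP.+-mono-< j<i j<i) (≡.sym e))
          psum-2Q : psum (Q ℕ.+ Q) ≈ - 1#
          psum-2Q = helper Q 0<Q ≡.refl
            where
            helper : ∀ Q′ → 0 < Q′ → Q′ ≡ Q → psum (Q ℕ.+ Q) ≈ - 1#
            helper (suc r) _ e = trans (reflexive (≡.cong (λ r → psum (r ℕ.+ Q)) (≡.sym e))) (trans (psum-shift r) (trans (reflexive (≡.cong psum e)) psum-Q))

      square-roots : ∀ v → Σ (λ y → 1# - S v y) ≈ v ^ h + 1#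
      square-roots v = begin⟨ setoid ⟩
        Σ (λ y → 1# - S v y) ≈⟨ Sum.fold-cong elements (λ y _ → +-congˡ (solve 2 (λ a z → :- a := (:- (z :^ 0)) :* a) refl (S v y) 0#)) ⟩
        Σ (λ y → 1# + - 1# * S v y) ≈⟨ Sum.fold-∙ elements (λ _ → 1#) (λ y → - 1# * S v y) ⟩
        Σ (λ _ → 1#) + Σ (λ y → - 1# * S v y) ≈⟨ +-cong psum-0 (trans (Σ-*ˡ elements (- 1#) (S v)) (*-congˡ (Σ-S v))) ⟩
        0# + - 1# * (- (v ^ h) - 1#) ≈⟨ solve 2 (λ a z → con (ℤ.+ 0) :+ :- (z :^ 0) :* (:- a :- z :^ 0) := a :+ z :^ 0) refl (v ^ h) 0# ⟩
        v ^ h + 1# ∎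

      points-mod-p : (g : Carrier → Carrier) {P : Pred (Carrier × Carrier) 0ℓ} (P? : Decidable P) →
        (∀ x y → P (x , y) → y * y ≈ g x) → (∀ x y → y * y ≈ g x → P (x , y)) →
        ι (length (filter P? (cartesianProduct elements elements))) ≈ Σ (λ x → g x ^ h)
      points-mod-p g P? to from = begin⟨ setoid ⟩
        ι (length (filter P? (cartesianProduct elements elements)))
          ≈⟨ count-indicator P? (λ { (x , y) → 1# - S (g x) y }) (λ { (x , y) e → trans (+-congˡ (trans (-‿cong (S-root (g x) y (to x y e))) -0≈0)) (+-identityʳ 1#) })
               (λ { (x , y) ne → x≈y⇒x-y≈0 (sym (S-nonroot (g x) y (λ e → ne (from x y e)))) }) (cartesianProduct elements elements) ⟩
        Sum.fold (cartesianProduct elements elements) (λ { (x , y) → 1# - S (g x) y }) ≈⟨ Sum.fold-× elements elements _ ⟩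
        Σ (λ x → Σ (λ y → 1# - S (g x) y)) ≈⟨ Sum.fold-cong elements (λ x _ → square-roots (g x)) ⟩
        Σ (λ x → g x ^ h + 1#) ≈⟨ Sum.fold-∙ elements (λ x → g x ^ h) (λ _ → 1#) ⟩
        Σ (λ x → g x ^ h) + Σ (λ _ → 1#) ≈⟨ trans (+-congˡ psum-0) (+-identityʳ _) ⟩
        Σ (λ x → g x ^ h) ∎

-- The Picard-Fuchs equation and separability of the Hasse invariant

module _ (S : CommutativeRing 0ℓ 0ℓ) where
  open RingTheory S

  private
    k : ∀ {m} → ℕ → Solver.Polynomial m
    k n = con (ℤ.+ n)

  -- The left side is 2 W′ F − 3 W F′ for F = x³ + a x + b and W = 15 x⁴ + 21 a x² + 6 b x + 4 a²; the coefficients of W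
  -- are found by comparing those of both sides.
  picard-fuchs : ∀ x a b →
    ι 2 * ((ι 6 * b + x * (ι 21 * a + x * (x * ι 15))) + x * ((ι 21 * a + x * (x * ι 15)) + x * (x * ι 15 + x * ι 15))) * (b + x * (a + x * x))
    - ι 3 * (ι 4 * a * a + x * (ι 6 * b + x * (ι 21 * a + x * (x * ι 15)))) * ((a + x * x) + x * (x + x * 1#))
    ≈ - (ι 3 * (ι 4 * (a * a * a) + ι 27 * (b * b)) - ι 108 * b * (b + x * (a + x * x)) + ι 15 * ((b + x * (a + x * x)) * (b + x * (a + x * x))))
  picard-fuchs = solve 3 (λ x a b →
    k 2 :* ((k 6 :* b :+ x :* (k 21 :* a :+ x :* (x :* k 15))) :+ x :* ((k 21 :* a :+ x :* (x :* k 15)) :+ x :* (x :* k 15 :+ x :* k 15))) :* (b :+ x :* (a :+ x :* x))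
    :- k 3 :* (k 4 :* a :* a :+ x :* (k 6 :* b :+ x :* (k 21 :* a :+ x :* (x :* k 15)))) :* ((a :+ x :* x) :+ x :* (x :+ x :* x :^ 0))
    := :- (k 3 :* (k 4 :* (a :* a :* a) :+ k 27 :* (b :* b)) :- k 108 :* b :* (b :+ x :* (a :+ x :* x)) :+ k 15 :* ((b :+ x :* (a :+ x :* x)) :* (b :+ x :* (a :+ x :* x))))) refl

module Cubic (R : CommutativeRing 0ℓ 0ℓ) (A B : CommutativeRing.Carrier R) where
  open RingTheory R
  open PolyTheory R

  cubic : Poly
  cubic = B ∷ A ∷ 0# ∷ 1# ∷ []

  cubic≋ : cubic ≋ C B P.+ X P.* (C A P.+ X P.* X)
  cubic≋ = P.trans (∷-split B _) (P.+-congˡ (P.*-congˡ (P.trans (∷-split A _) (P.+-congˡ (P.*-congˡ (ext λ { zero → refl ; (suc zero) → refl ; (suc (suc _)) → refl }))))))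

  cubic≺ : cubic ≺ 4
  cubic≺ = ≺-length cubic

  private
    D-linear : ∀ a g → D (C a P.+ X P.* g) ≋ g P.+ X P.* D g
    D-linear a g = P.trans (D-+ (C a) (X P.* g)) (P.trans (P.+-cong (D-C a) (D-X* g)) (P.+-identityˡ _))

    D-cubic : D cubic ≋ (C A P.+ X P.* X) P.+ X P.* (X P.+ X P.* P.1#)
    D-cubic = P.trans (D-cong cubic≋) (P.trans (D-linear B _) (P.+-congˡ (P.*-congˡ (P.trans (D-linear A X) (P.+-congˡ (P.*-congˡ D-X))))))

    u₃ u₂ u₁ W : Poly
    u₃ = X P.* C (ι 15)
    u₂ = C (ι 21 * A) P.+ X P.* u₃
    u₁ = C (ι 6 * B) P.+ X P.* u₂
    W = C (ι 4 * A * A) P.+ X P.* u₁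

    D-u₃ : D u₃ ≋ C (ι 15)
    D-u₃ = P.trans (D-X* (C (ι 15))) (P.trans (P.+-congˡ (P.trans (P.*-congˡ (D-C (ι 15))) (P.zeroʳ X))) (P.+-identityʳ _))

    D-W : D W ≋ u₁ P.+ X P.* (u₂ P.+ X P.* (u₃ P.+ X P.* C (ι 15)))
    D-W = P.trans (D-linear _ u₁) (P.+-congˡ (P.*-congˡ (P.trans (D-linear _ u₂) (P.+-congˡ (P.*-congˡ (P.trans (D-linear _ u₃) (P.+-congˡ (P.*-congˡ D-u₃))))))))

    C-ι : ∀ n → C (ι n) ≋ P.ι n
    C-ι = Hom.ι-homo C-hom

    CA = C A
    CB = C B

    C*ι : ∀ n a → C (ι n * a) ≋ P.ι n P.* C a
    C*ι n a = P.trans (Hom.*-homo C-hom (ι n) a) (P.*-congʳ (C-ι n))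

  Δ : Carrier
  Δ = ι 4 * (A * A * A) + ι 27 * (B * B)

  private
    C-Δ : C Δ ≋ P.ι 4 P.* (CA P.* CA P.* CA) P.+ P.ι 27 P.* (CB P.* CB)
    C-Δ = P.trans (Hom.+-homo C-hom _ _) (P.+-cong
      (P.trans (C*ι 4 _) (P.*-congˡ (P.trans (Hom.*-homo C-hom (A * A) A) (P.*-congʳ (Hom.*-homo C-hom A A)))))
      (P.trans (C*ι 27 _) (P.*-congˡ (Hom.*-homo C-hom B B))))

    Quad : Poly
    Quad = P.ι 3 P.* C Δ P.- P.ι 108 P.* CB P.* cubic P.+ P.ι 15 P.* (cubic P.* cubic)

    exact : P.ι 2 P.* D W P.* cubic P.- P.ι 3 P.* W P.* D cubic ≋ P.- Quad
    exact = P.trans (P.+-cong (P.*-cong (P.*-congˡ (P.trans D-W W′≋)) cubic≋) (P.-‿cong (P.*-cong (P.*-congˡ W≋) D-cubic)))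
      (P.trans (picard-fuchs (R [X]) X CA CB)
        (P.-‿cong (P.+-cong (P.+-cong (P.*-congˡ (P.sym C-Δ)) (P.-‿cong (P.*-congˡ (P.sym cubic≋)))) (P.*-congˡ (P.*-cong (P.sym cubic≋) (P.sym cubic≋))))))
      where
      u₃≋ : u₃ ≋ X P.* P.ι 15
      u₃≋ = P.*-congˡ (C-ι 15)
      u₂≋ : u₂ ≋ P.ι 21 P.* CA P.+ X P.* (X P.* P.ι 15)
      u₂≋ = P.+-cong (C*ι 21 A) (P.*-congˡ u₃≋)
      u₁≋ : u₁ ≋ P.ι 6 P.* CB P.+ X P.* (P.ι 21 P.* CA P.+ X P.* (X P.* P.ι 15))
      u₁≋ = P.+-cong (C*ι 6 B) (P.*-congˡ u₂≋)
      W≋ : W ≋ P.ι 4 P.* CA P.* CA P.+ X P.* (P.ι 6 P.* CB P.+ X P.* (P.ι 21 P.* CA P.+ X P.* (X P.* P.ι 15)))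
      W≋ = P.+-cong (P.trans (Hom.*-homo C-hom (ι 4 * A) A) (P.*-congʳ (C*ι 4 A))) (P.*-congˡ u₁≋)
      W′≋ : u₁ P.+ X P.* (u₂ P.+ X P.* (u₃ P.+ X P.* C (ι 15))) ≋
            (P.ι 6 P.* CB P.+ X P.* (P.ι 21 P.* CA P.+ X P.* (X P.* P.ι 15))) P.+ X P.* ((P.ι 21 P.* CA P.+ X P.* (X P.* P.ι 15)) P.+ X P.* ((X P.* P.ι 15) P.+ X P.* P.ι 15))
      W′≋ = P.+-cong u₁≋ (P.*-congˡ (P.+-cong u₂≋ (P.*-congˡ (P.+-cong u₃≋ (P.*-congˡ (C-ι 15))))))

  module _ (N : ℕ) (ch : CharP (suc (suc (suc N) ℕ.+ suc (suc N)))) where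
    private
      n : ℕ
      n = suc (suc N)

      c : ℕ → Carrier
      c M = coeff (cubic P.^ M) (n ℕ.+ n)

      2[N+1]≋-3 : P.ι 2 P.* P.ι (suc N) ≋ P.- P.ι 3
      2[N+1]≋-3 = begin⟨ P.setoid ⟩
        P.ι 2 P.* P.ι (suc N) ≈⟨ P.sym (P.×1-homo-* 2 (suc N)) ⟩
        P.ι (2 ℕ.* suc N) ≈⟨ P.solve 2 (λ a b → a P.:= (a P.:+ b) P.:- b) P.refl _ (P.ι 3) ⟩
        (P.ι (2 ℕ.* suc N) P.+ P.ι 3) P.- P.ι 3 ≈⟨ P.+-congʳ (P.trans (P.sym (P.×-homo-+ P.1# (2 ℕ.* suc N) 3)) (P.trans (P.reflexive (≡.cong P.ι index)) (Hom.CharP-homo C-hom {suc (n ℕ.+ n)} ch))) ⟩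
        P.0# P.- P.ι 3 ≈⟨ P.+-identityˡ _ ⟩
        P.- P.ι 3 ∎
        where
        index : 2 ℕ.* suc N ℕ.+ 3 ≡ suc (suc (suc N) ℕ.+ suc (suc N))
        index = ℕSolver.solve (N ∷ [])

      G : Poly
      G = W P.* cubic P.^ suc N

      2DG : P.ι 2 P.* D G ≋ P.- (Quad P.* cubic P.^ N)
      2DG = begin⟨ P.setoid ⟩
        P.ι 2 P.* D G ≈⟨ P.*-congˡ (P.trans (D-* W (cubic P.^ suc N)) (P.+-congˡ (P.*-congˡ (D-^ cubic N)))) ⟩
        P.ι 2 P.* (D W P.* (cubic P.* cubic P.^ N) P.+ W P.* (P.ι (suc N) P.* (cubic P.^ N P.* D cubic)))
          ≈⟨ P.solve 7 (λ k w′ f g w j f′ → k P.:* (w′ P.:* (f P.:* g) P.:+ w P.:* (j P.:* (g P.:* f′))) P.:= (k P.:* w′ P.:* f P.:+ (k P.:* j) P.:* w P.:* f′) P.:* g) P.refl (P.ι 2) (D W) cubic (cubic P.^ N) W (P.ι (suc N)) (D cubic) ⟩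
        (P.ι 2 P.* D W P.* cubic P.+ (P.ι 2 P.* P.ι (suc N)) P.* W P.* D cubic) P.* cubic P.^ N ≈⟨ P.*-congʳ (P.+-congˡ (P.*-congʳ (P.*-congʳ 2[N+1]≋-3))) ⟩
        (P.ι 2 P.* D W P.* cubic P.+ (P.- P.ι 3) P.* W P.* D cubic) P.* cubic P.^ N
          ≈⟨ P.*-congʳ (P.+-congˡ (P.solve 3 (λ k w f′ → P.:- k P.:* w P.:* f′ P.:= P.:- (k P.:* w P.:* f′)) P.refl (P.ι 3) W (D cubic))) ⟩
        (P.ι 2 P.* D W P.* cubic P.- P.ι 3 P.* W P.* D cubic) P.* cubic P.^ N ≈⟨ P.*-congʳ exact ⟩
        P.- Quad P.* cubic P.^ N ≈⟨ P.solve 2 (λ q g → P.:- q P.:* g P.:= P.:- (q P.:* g)) P.refl Quad (cubic P.^ N) ⟩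
        P.- (Quad P.* cubic P.^ N) ∎

      coeff-ι* : ∀ j g i → coeff (P.ι j P.* g) i ≈ ι j * coeff g i
      coeff-ι* j g i = trans (at (P.*-congʳ (P.sym (C-ι j))) i) (coeff-C* (ι j) g i)

    -- Since `2 (N + 1) = -3` in characteristic `p`, `Quad` times the `N`-th power of the cubic is,
    -- up to sign, twice the derivative of `G`; and a derivative has no term in `x^(p-1)`. As the
    -- three coefficients are derivatives in `B` of the Hasse invariant up to constants, this is its
    -- Picard-Fuchs equation.
    relation : ι 3 * (Δ * c N) - ι 108 * (B * c (suc N)) + ι 15 * c n ≈ 0#
    relation = begin⟨ setoid ⟩
      ι 3 * (Δ * c N) - ι 108 * (B * c (suc N)) + ι 15 * c n ≈⟨ sym Quad-coeff ⟩
      coeff (Quad P.* cubic P.^ N) i ≈⟨ solve 1 (λ a → a := :- (:- a)) refl _ ⟩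
      - (- coeff (Quad P.* cubic P.^ N) i) ≈⟨ -‿cong (sym (coeff-neg _ i)) ⟩
      - coeff (P.- (Quad P.* cubic P.^ N)) i ≈⟨ -‿cong (at (P.sym 2DG) i) ⟩
      - coeff (P.ι 2 P.* D G) i ≈⟨ -‿cong (trans (coeff-ι* 2 (D G) i) (*-congˡ (trans (coeff-D G i) (trans (*-congʳ ch) (zeroˡ _))))) ⟩
      - (ι 2 * 0#) ≈⟨ trans (-‿cong (zeroʳ _)) -0≈0 ⟩
      0# ∎
      where
      i = n ℕ.+ n
      Quad-coeff : coeff (Quad P.* cubic P.^ N) i ≈ ι 3 * (Δ * c N) - ι 108 * (B * c (suc N)) + ι 15 * c n
      Quad-coeff = begin⟨ setoid ⟩
        coeff (Quad P.* cubic P.^ N) i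
          ≈⟨ at (P.solve 7 (λ k₁ k₂ k₃ d b f g → (k₁ P.:* d P.:- k₂ P.:* b P.:* f P.:+ k₃ P.:* (f P.:* f)) P.:* g P.:= (k₁ P.:* (d P.:* g) P.:- k₂ P.:* (b P.:* (f P.:* g))) P.:+ k₃ P.:* (f P.:* (f P.:* g))) P.refl (P.ι 3) (P.ι 108) (P.ι 15) (C Δ) CB cubic (cubic P.^ N)) i ⟩
        coeff ((P.ι 3 P.* (C Δ P.* cubic P.^ N) P.- P.ι 108 P.* (CB P.* cubic P.^ suc N)) P.+ P.ι 15 P.* cubic P.^ n) i
          ≈⟨ trans (coeff-⊕ _ _ i) (+-congʳ (coeff-sub _ _ i)) ⟩
        coeff (P.ι 3 P.* (C Δ P.* cubic P.^ N)) i - coeff (P.ι 108 P.* (CB P.* cubic P.^ suc N)) i + coeff (P.ι 15 P.* cubic P.^ n) i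
          ≈⟨ +-cong (+-cong (trans (coeff-ι* 3 _ i) (*-congˡ (coeff-C* Δ _ i))) (-‿cong (trans (coeff-ι* 108 _ i) (*-congˡ (coeff-C* B _ i))))) (coeff-ι* 15 _ i) ⟩
        ι 3 * (Δ * c N) - ι 108 * (B * c (suc N)) + ι 15 * c n ∎

-- The coefficients of (x³ + A x + B)^N as polynomials in the variable B.
module HasseFamily (R : CommutativeRing 0ℓ 0ℓ) (A : CommutativeRing.Carrier R) where
  open RingTheory R
  open PolyTheory R
  private
    module PP = PolyTheory (R [X])
  open Cubic (R [X]) (C A) X public using () renaming (cubic to F; cubic≋ to F≋)

  hasse : ℕ → ℕ → Poly
  hasse N i = PP.coeff (F PP.P.^ N) i

  private
    ∂ : PP.Poly → PP.Poly
    ∂ = map D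

    coeff-∂ : ∀ g n → PP.coeff (∂ g) n ≋ D (PP.coeff g n)
    coeff-∂ = PP.coeff-map D-0

    D-conv : ∀ f g n → D (Convolution.conv (R [X]) f g n) ≋ Convolution.conv (R [X]) (D ∘ f) g n P.+ Convolution.conv (R [X]) f (D ∘ g) n
    D-conv f g zero = D-* (f 0) (g 0)
    D-conv f g (suc n) = P.trans (D-+ _ _) (P.trans (P.+-cong (D-* (f 0) (g (suc n))) (D-conv (f ∘ suc) g n))
      (P.solve 4 (λ a b c d → (a P.:+ b) P.:+ (c P.:+ d) P.:= (a P.:+ c) P.:+ (b P.:+ d)) P.refl _ _ _ _))

    ∂-* : ∀ g h → ∂ (g PP.P.* h) PP.≋ ∂ g PP.P.* h PP.P.+ g PP.P.* ∂ h
    ∂-* g h = PP.ext λ n → begin⟨ P.setoid ⟩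
      PP.coeff (∂ (g PP.P.* h)) n ≈⟨ P.trans (coeff-∂ (g PP.P.* h) n) (P.trans (D-cong (PP.coeff-⊛ g h n)) (D-conv (PP.coeff g) (PP.coeff h) n)) ⟩
      _ ≈⟨ P.+-cong (Convolution.conv-cong (R [X]) (coeff-∂ g) (λ _ → P.refl) n) (Convolution.conv-cong (R [X]) (λ _ → P.refl) (coeff-∂ h) n) ⟨
      _ ≈⟨ P.+-cong (PP.coeff-⊛ (∂ g) h n) (PP.coeff-⊛ g (∂ h) n) ⟨
      PP.coeff (∂ g PP.P.* h) n P.+ PP.coeff (g PP.P.* ∂ h) n ≈⟨ PP.coeff-⊕ (∂ g PP.P.* h) (g PP.P.* ∂ h) n ⟨
      PP.coeff (∂ g PP.P.* h PP.P.+ g PP.P.* ∂ h) n ∎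

    ∂F : ∂ F PP.≋ PP.P.1#
    ∂F = PP.ext λ { zero → D-X ; (suc zero) → D-C A ; (suc (suc zero)) → D-0 ; (suc (suc (suc zero))) → D-C 1# ; (suc (suc (suc (suc _)))) → P.refl }

    ∂1 : ∂ PP.P.1# PP.≋ PP.P.0#
    ∂1 = PP.ext λ { zero → D-C 1# ; (suc _) → P.refl }

    ∂F^ : ∀ N → ∂ (F PP.P.^ suc N) PP.≋ PP.P.ι (suc N) PP.P.* F PP.P.^ N
    ∂F^ zero = PP.P.trans (∂-* F PP.P.1#) (PP.P.trans (PP.P.+-cong (PP.P.*-congʳ ∂F) (PP.P.*-congˡ ∂1))
      (PP.P.solve 1 (λ f → f PP.P.:^ 0 PP.P.:* f PP.P.:^ 0 PP.P.:+ f PP.P.:* PP.P.con (ℤ.+ 0) PP.P.:= (f PP.P.:^ 0 PP.P.:+ PP.P.con (ℤ.+ 0)) PP.P.:* f PP.P.:^ 0) PP.P.refl F))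
    ∂F^ (suc N) = PP.P.trans (∂-* F (F PP.P.^ suc N)) (PP.P.trans (PP.P.+-cong (PP.P.*-congʳ ∂F) (PP.P.*-congˡ (∂F^ N)))
      (PP.P.solve 3 (λ f g k → f PP.P.:^ 0 PP.P.:* (f PP.P.:* g) PP.P.:+ f PP.P.:* (k PP.P.:* g) PP.P.:= (f PP.P.:^ 0 PP.P.:+ k) PP.P.:* (f PP.P.:* g)) PP.P.refl F (F PP.P.^ N) (PP.P.ι (suc N))))

  -- The derivative of `x³ + A x + B` in `B` is 1, so differentiating a power in `B` only lowers its
  -- exponent.
  D-hasse : ∀ N i → D (hasse (suc N) i) ≋ P.ι (suc N) P.* hasse N i
  D-hasse N i = P.trans (P.sym (coeff-∂ (F PP.P.^ suc N) i)) (P.trans (PP.at (∂F^ N) i)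
    (P.trans (PP.at (PP.P.*-congʳ (PP.P.sym (Hom.ι-homo PP.C-hom (suc N)))) i) (PP.coeff-C* (P.ι (suc N)) (F PP.P.^ N) i)))

  private
    -- Weighted degree at most w, for x of weight 1 and B of weight 3.
    Wt : ℕ → PP.Poly → Set
    Wt w g = ∀ r t → w < r ℕ.+ 3 ℕ.* t → PP.coeff g r ≺ t

    Wt-cong : ∀ {w g h} → g PP.≋ h → Wt w g → Wt w h
    Wt-cong e b r t lt = ≺-cong (PP.at e r) (b r t lt)

    Wt-mono : ∀ {v w g} → v ≤ w → Wt v g → Wt w g
    Wt-mono v≤w b r t lt = b r t (ℕP.≤-<-trans v≤w lt)

    Wt-+ : ∀ {w g h} → Wt w g → Wt w h → Wt w (g PP.P.+ h)
    Wt-+ {g = g} {h} b b′ r t lt = ≺-cong (P.sym (PP.coeff-⊕ g h r)) (≺-+ (b r t lt) (b′ r t lt))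

    Wt-x : ∀ {w g} → Wt w g → Wt (suc w) (PP.X PP.P.* g)
    Wt-x {g = g} b zero t lt = ≺-cong (P.sym (PP.coeff-X*-0 g)) ≺-0
    Wt-x {g = g} b (suc r) t (s≤s lt) = ≺-cong (P.sym (PP.coeff-X*-suc g r)) (b r t lt)

    Wt-A : ∀ {w g} → Wt w g → Wt w (PP.C (C A) PP.P.* g)
    Wt-A {g = g} b r t lt = ≺-cong (P.sym (PP.coeff-C* (C A) g r)) (≺-cong (P.*-comm _ (C A)) (≡.subst (PP.coeff g r P.* C A ≺_) (ℕP.+-identityʳ t) (≺-* t 0 (b r t lt) ≺-C)))

    Wt-B : ∀ {w g} → Wt w g → Wt (3 ℕ.+ w) (PP.C X PP.P.* g)
    Wt-B {w} {g} b r zero lt = ≺-cong (P.sym (P.trans (PP.coeff-C* X g r) (P.trans (P.*-congˡ (≺0⇒≋0 (b r 0 (ℕP.≤-<-trans (ℕP.m≤n+m w 3) lt)))) (P.zeroʳ X)))) ≺-0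
    Wt-B {w} {g} b r (suc t) lt = ≺-cong (P.trans (P.*-comm _ X) (P.sym (PP.coeff-C* X g r)))
      (≡.subst (PP.coeff g r P.* X ≺_) (ℕP.+-comm t 1) (≺-* t 1 (b r t (ℕP.+-cancelˡ-< 3 w _ (≡.subst (3 ℕ.+ w <_) lemma lt))) ≺-X))
      where
      lemma : r ℕ.+ 3 ℕ.* suc t ≡ 3 ℕ.+ (r ℕ.+ 3 ℕ.* t)
      lemma = ℕSolver.solve (r ∷ t ∷ [])

    Wt-F : ∀ {w g} → Wt w g → Wt (3 ℕ.+ w) (F PP.P.* g)
    Wt-F {w} {g} b = Wt-cong
      (PP.P.trans (PP.P.solve 4 (λ b x a g → b PP.P.:* g PP.P.:+ (x PP.P.:* (a PP.P.:* g) PP.P.:+ x PP.P.:* (x PP.P.:* (x PP.P.:* g))) PP.P.:= (b PP.P.:+ x PP.P.:* (a PP.P.:+ x PP.P.:* x)) PP.P.:* g) PP.P.refl (PP.C X) PP.X (PP.C (C A)) g)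
        (PP.P.*-congʳ (PP.P.sym F≋)))
      (Wt-+ {g = PP.C X PP.P.* g} (Wt-B {g = g} b) (Wt-+ {g = PP.X PP.P.* Ag} (Wt-mono {g = PP.X PP.P.* Ag} (ℕP.m≤n+m (suc w) 2) (Wt-x {g = Ag} (Wt-A {g = g} b)))
        (Wt-x {g = PP.X PP.P.* (PP.X PP.P.* g)} (Wt-x {g = PP.X PP.P.* g} (Wt-x {g = g} b)))))
      where Ag = PP.C (C A) PP.P.* g

  hasse≺ : ∀ N i t → 3 ℕ.* N < i ℕ.+ 3 ℕ.* t → hasse N i ≺ t
  hasse≺ N i t lt = go N i t (≡.subst (_< i ℕ.+ 3 ℕ.* t) (ℕP.*-comm 3 N) lt)
    where
    go : ∀ N → Wt (N ℕ.* 3) (F PP.P.^ N)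
    go zero zero (suc t) lt = ≺-mono (s≤s z≤n) ≺-C
    go zero (suc r) t lt = ≺-0
    go (suc N) = Wt-F {g = F PP.P.^ N} (go N)

  eval-hasse : ∀ b N i → Evaluation.ev {R} id-hom b (hasse N i) ≈ coeff (Cubic.cubic R A b P.^ N) i
  eval-hasse b N i = trans (sym (coeff-map-hom (Evaluation.ev-hom {R} id-hom b) (F PP.P.^ N) i))
    (at (P.trans (σ.^-homo F N) (P.^-congˡ N σF)) i)
    where
    module E = Evaluation {R} id-hom b
    module σ = Hom (map-hom E.ev-hom)
    σF : σ.⟦ F ⟧ ≋ Cubic.cubic R A b
    σF = ext λ { zero → E.ev-X ; (suc zero) → E.ev-C A ; (suc (suc zero)) → refl ; (suc (suc (suc zero))) → Hom.1-homo E.ev-hom ; (suc (suc (suc (suc _)))) → refl }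

  -- At B = 0 the cubic is x (x² + A); γ N j is the coefficient of x^j in (x² + A)^N.
  x²+A : Poly
  x²+A = C A P.+ X P.* X

  γ : ℕ → ℕ → Carrier
  γ N j = coeff (x²+A P.^ N) j

  private
    x²+A*-suc : ∀ g j → coeff (x²+A P.* g) (suc (suc j)) ≈ A * coeff g (suc (suc j)) + coeff g j
    x²+A*-suc g j = trans (at (P.solve 3 (λ a x g → (a P.:+ x P.:* x) P.:* g P.:= a P.:* g P.:+ x P.:* (x P.:* g)) P.refl (C A) X g) (suc (suc j)))
      (trans (coeff-⊕ _ _ (suc (suc j))) (+-cong (coeff-C* A g _) (trans (coeff-X*-suc _ (suc j)) (coeff-X*-suc g j))))

    D-x²+A : D x²+A ≋ P.ι 2 P.* X
    D-x²+A = P.trans (D-+ (C A) (X P.* X)) (P.trans (P.+-cong (D-C A) (P.trans (D-X* X) (P.+-congˡ (P.trans (P.*-congˡ D-X) (P.*-identityʳ X)))))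
      (P.solve 1 (λ x → P.con (ℤ.+ 0) P.:+ (x P.:+ x) P.:= P.con (ℤ.+ 2) P.:* x) P.refl X))

    logarithmic : ∀ N → x²+A P.* D (x²+A P.^ suc N) ≋ P.ι (suc N) P.* P.ι 2 P.* (X P.* x²+A P.^ suc N)
    logarithmic N = P.trans (P.*-congˡ (P.trans (D-^ x²+A N) (P.*-congˡ (P.*-congˡ D-x²+A))))
      (P.solve 5 (λ q k g t x → q P.:* (k P.:* (g P.:* (t P.:* x))) P.:= k P.:* t P.:* (x P.:* (q P.:* g))) P.refl x²+A (P.ι (suc N)) (x²+A P.^ N) (P.ι 2) X)

  γ-0 : ∀ N → γ N 0 ≈ A ^ N
  γ-0 zero = refl
  γ-0 (suc N) = begin⟨ setoid ⟩
    coeff (x²+A P.* x²+A P.^ N) 0 ≈⟨ at (P.solve 3 (λ a x g → (a P.:+ x P.:* x) P.:* g P.:= a P.:* g P.:+ x P.:* (x P.:* g)) P.refl (C A) X _) 0 ⟩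
    coeff (C A P.* x²+A P.^ N P.+ X P.* (X P.* x²+A P.^ N)) 0 ≈⟨ trans (coeff-⊕ (C A P.* x²+A P.^ N) _ 0) (+-cong (coeff-C* A (x²+A P.^ N) 0) (coeff-X*-0 _)) ⟩
    A * γ N 0 + 0# ≈⟨ trans (+-identityʳ _) (*-congˡ (γ-0 N)) ⟩
    A * A ^ N ∎

  -- The coefficients of `x^(j+1)` in the logarithmic derivative of a power of `x² + A`: a two-step
  -- recurrence along the even exponents.
  γ-suc : ∀ N j → A * (ι (suc (suc j)) * γ (suc N) (suc (suc j))) + ι j * γ (suc N) j ≈ ι (suc N) * ι 2 * γ (suc N) j
  γ-suc N j = trans (sym left) (trans (at (logarithmic N) (suc j)) right)
    where
    g = x²+A P.^ suc N
    right : coeff (P.ι (suc N) P.* P.ι 2 P.* (X P.* g)) (suc j) ≈ ι (suc N) * ι 2 * coeff g j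
    right = trans (at (P.*-congʳ (P.trans (P.*-cong (P.sym (Hom.ι-homo C-hom (suc N))) (P.sym (Hom.ι-homo C-hom 2))) (P.sym (Hom.*-homo C-hom (ι (suc N)) (ι 2))))) (suc j))
      (trans (coeff-C* (ι (suc N) * ι 2) (X P.* g) (suc j)) (*-congˡ (coeff-X*-suc g j)))
    left : coeff (x²+A P.* D g) (suc j) ≈ A * (ι (suc (suc j)) * coeff g (suc (suc j))) + ι j * coeff g j
    left = go j
      where
      go : ∀ j → coeff (x²+A P.* D g) (suc j) ≈ A * (ι (suc (suc j)) * coeff g (suc (suc j))) + ι j * coeff g j
      go zero = begin⟨ setoid ⟩
        coeff (x²+A P.* D g) 1 ≈⟨ at (P.solve 3 (λ a x g → (a P.:+ x P.:* x) P.:* g P.:= a P.:* g P.:+ x P.:* (x P.:* g)) P.refl (C A) X (D g)) 1 ⟩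
        coeff (C A P.* D g P.+ X P.* (X P.* D g)) 1 ≈⟨ trans (coeff-⊕ (C A P.* D g) _ 1) (+-cong (coeff-C* A (D g) 1) (trans (coeff-X*-suc _ 0) (coeff-X*-0 (D g)))) ⟩
        A * coeff (D g) 1 + 0# ≈⟨ +-cong (*-congˡ (coeff-D g 1)) (sym (zeroˡ _)) ⟩
        A * (ι 2 * coeff g 2) + ι 0 * coeff g 0 ∎
      go (suc j) = trans (x²+A*-suc (D g) j) (+-cong (*-congˡ (coeff-D g _)) (coeff-D g j))

  hasse-at-0 : ∀ N j → Evaluation.ev {R} id-hom 0# (hasse N (N ℕ.+ j)) ≈ γ N j
  hasse-at-0 N j = begin⟨ setoid ⟩
    _ ≈⟨ eval-hasse 0# N (N ℕ.+ j) ⟩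
    coeff (Cubic.cubic R A 0# P.^ N) (N ℕ.+ j) ≈⟨ at (P.trans (P.^-congˡ N cubic₀) (P.^-distrib-* X x²+A N)) (N ℕ.+ j) ⟩
    coeff (X P.^ N P.* x²+A P.^ N) (N ℕ.+ j) ≈⟨ coeff-X^*-+ N (x²+A P.^ N) j ⟩
    γ N j ∎
    where
    cubic₀ : Cubic.cubic R A 0# ≋ X P.* x²+A
    cubic₀ = P.trans (Cubic.cubic≋ R A 0#) (P.trans (P.+-congʳ (Hom.0-homo C-hom)) (P.+-identityˡ _))

-- A solution f of 4 Δ f″ + 4 Δ′ f′ + κ f = 0 with Δ separable and deg f < p is separable: differentiating the equation,
-- any ideal containing f and Δ, and then any ideal containing f and f′, contains all derivatives of f, one of which is a unit.
module Separability (R : CommutativeRing 0ℓ 0ℓ) (isField : IsDiscreteField R) (p : ℕ)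
  (ι≉0 : ∀ j → 0 < j → j < p → ¬ CommutativeRing._≈_ R (RingTheory.ι R j) (CommutativeRing.0# R)) (4<p : 4 < p)
  (Δ E e : CommutativeRing.Carrier (R [X])) where
  open RingTheory R
  open PolyTheory R
  open FieldTheory R isField

  private
    -- The ideal of `f` and `g`, with explicit cofactors; `In f g P.1#` is coprimality.
    In : Poly → Poly → Poly → Set
    In f g h = ∃₂ λ u v → u P.* f P.+ v P.* g ≋ h

    module _ {f g : Poly} where
      In-cong : ∀ {h h′} → h ≋ h′ → In f g h → In f g h′
      In-cong e (u , v , eq) = u , v , P.trans eq e

      In-+ : ∀ {h h′} → In f g h → In f g h′ → In f g (h P.+ h′)
      In-+ (u , v , eq) (u′ , v′ , eq′) = u P.+ u′ , v P.+ v′ , P.trans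
        (P.solve 6 (λ u u′ v v′ f g → (u P.:+ u′) P.:* f P.:+ (v P.:+ v′) P.:* g P.:= (u P.:* f P.:+ v P.:* g) P.:+ (u′ P.:* f P.:+ v′ P.:* g)) P.refl u u′ v v′ f g) (P.+-cong eq eq′)

      In-* : ∀ {h} k → In f g h → In f g (k P.* h)
      In-* k (u , v , eq) = k P.* u , k P.* v , P.trans
        (P.solve 5 (λ k u v f g → k P.:* u P.:* f P.:+ k P.:* v P.:* g P.:= k P.:* (u P.:* f P.:+ v P.:* g)) P.refl k u v f g) (P.*-congˡ eq)

      In-unit : ∀ {h} a → ¬ a ≈ 0# → In f g (C a P.* h) → In f g h
      In-unit {h} a a≉0 i = In-cong (P.trans (P.sym (P.*-assoc _ _ _)) (P.trans (P.*-congʳ (P.trans (P.sym (Hom.*-homo C-hom _ a)) (Hom.cong C-hom (trans (*-comm _ a) (*-inv a a≉0))))) (P.*-identityˡ h)))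
        (In-* (C (inv a a≉0)) i)

      In-ι : ∀ {h} j → 0 < j → j < p → In f g (P.ι j P.* h) → In f g h
      In-ι j 0<j j<p i = In-unit (ι j) (ι≉0 j 0<j j<p) (In-cong (P.*-congʳ (P.sym (Hom.ι-homo C-hom j))) i)

      In-const : ∀ {h} → HasDegree h 0 → In f g h → In f g P.1#
      In-const {h} (b , ne) i = In-unit (coeff h 0) ne (In-cong (P.trans (ext λ { zero → refl ; (suc j) → vanish b (suc j) (s≤s z≤n) }) (P.sym (P.*-identityʳ _))) i)

    4ι≉0 : ∀ {f g h} j → 0 < j → j < p → In f g (P.ι 4 P.* P.ι j P.* h) → In f g h
    4ι≉0 j 0<j j<p i = In-ι j 0<j j<p (In-ι 4 (s≤s z≤n) 4<p (In-cong (P.*-assoc _ _ _) i))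

  D-degree : ∀ {g d} → HasDegree g (suc d) → suc d < p → HasDegree (D g) d
  D-degree {g} {d} (b , ne) lt = bound (λ i d<i → trans (coeff-D g i) (trans (*-congˡ (vanish b (suc i) (s≤s d<i))) (zeroʳ _))) ,
    λ e → *≉0 (ι≉0 (suc d) (s≤s z≤n) lt) ne (trans (sym (coeff-D g d)) e)

  -- The form of the equation for the `r`-th derivative, with `E = Δ′`. Differentiating once more
  -- raises `r + 1` by one and adds the constant `4 (r + 1) e`, with `e = E′`, to `κ`.
  ODE : ℕ → Poly → Poly → Set
  ODE r κ g = P.ι 4 P.* (Δ P.* D (D g)) P.+ P.ι 4 P.* P.ι (suc r) P.* (E P.* D g) P.+ κ P.* g ≋ P.0#

  D-ι : ∀ j g → D (P.ι j P.* g) ≋ P.ι j P.* D g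
  D-ι j g = P.trans (D-cong (P.*-congʳ (P.sym (Hom.ι-homo C-hom j)))) (P.trans (D-C* (ι j) g) (P.*-congʳ (Hom.ι-homo C-hom j)))

  module _ (DΔ : D Δ ≋ E) (DE : D E ≋ e) (De : D e ≋ P.0#) where
    private
      κ′ : ℕ → Poly → Poly
      κ′ r κ = κ P.+ P.ι 4 P.* P.ι (suc r) P.* e

      Dκ′ : ∀ r {κ} → D κ ≋ P.0# → D (κ′ r κ) ≋ P.0#
      Dκ′ r {κ} Dκ = P.trans (D-+ κ _) (P.trans (P.+-cong Dκ (P.trans (D-cong (P.*-assoc (P.ι 4) (P.ι (suc r)) e))
        (P.trans (D-ι 4 _) (P.trans (P.*-congˡ (P.trans (D-ι (suc r) e) (P.trans (P.*-congˡ De) (P.zeroʳ _)))) (P.zeroʳ _))))) (P.+-identityˡ _))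

      ODE-suc : ∀ r {κ g} → D κ ≋ P.0# → ODE r κ g → ODE (suc r) (κ′ r κ) (D g)
      ODE-suc r {κ} {g} Dκ ode = begin⟨ P.setoid ⟩
        P.ι 4 P.* (Δ P.* D g″) P.+ P.ι 4 P.* (P.1# P.+ j) P.* (E P.* g″) P.+ (κ P.+ P.ι 4 P.* j P.* e) P.* g′
          ≈⟨ P.solve 9 (λ k j δ ε c κ g′ g″ g‴ → k P.:* (δ P.:* g‴) P.:+ k P.:* (j P.:^ 0 P.:+ j) P.:* (ε P.:* g″) P.:+ (κ P.:+ k P.:* j P.:* c) P.:* g′
               P.:= k P.:* (ε P.:* g″ P.:+ δ P.:* g‴) P.:+ k P.:* (j P.:* (c P.:* g′ P.:+ ε P.:* g″)) P.:+ κ P.:* g′) P.refl (P.ι 4) j Δ E e κ g′ g″ (D g″) ⟩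
        P.ι 4 P.* (E P.* g″ P.+ Δ P.* D g″) P.+ P.ι 4 P.* (j P.* (e P.* g′ P.+ E P.* g″)) P.+ κ P.* g′
          ≈⟨ P.+-cong (P.+-cong (P.*-congˡ (P.trans (P.+-congʳ (P.*-congʳ (P.sym DΔ))) (P.sym (D-* Δ g″)))) (P.*-congˡ (P.*-congˡ (P.trans (P.+-congʳ (P.*-congʳ (P.sym DE))) (P.sym (D-* E g′))))))
               (P.trans (P.trans (P.sym (P.+-identityˡ _)) (P.+-congʳ (P.trans (P.sym (P.zeroˡ g)) (P.*-congʳ (P.sym Dκ))))) (P.sym (D-* κ g))) ⟩
        P.ι 4 P.* D (Δ P.* g″) P.+ P.ι 4 P.* (j P.* D (E P.* g′)) P.+ D (κ P.* g)
          ≈⟨ P.+-congʳ (P.+-cong (P.sym (D-ι 4 _)) (P.trans (P.*-congˡ (P.sym (D-ι (suc r) _))) (P.trans (P.sym (D-ι 4 _)) (D-cong (P.sym (P.*-assoc _ _ _)))))) ⟩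
        D (P.ι 4 P.* (Δ P.* g″)) P.+ D (P.ι 4 P.* j P.* (E P.* g′)) P.+ D (κ P.* g)
          ≈⟨ P.trans (P.+-congʳ (P.sym (D-+ _ _))) (P.sym (D-+ _ _)) ⟩
        D (P.ι 4 P.* (Δ P.* g″) P.+ P.ι 4 P.* j P.* (E P.* g′) P.+ κ P.* g) ≈⟨ D-cong ode ⟩
        D P.0# ≈⟨ D-0 ⟩
        P.0# ∎
        where
        j = P.ι (suc r)
        g′ = D g
        g″ = D (D g)

    module _ {f : Poly} (cop : Coprime E Δ) where
      private
        -- Modulo the ideal of `f` and `Δ` the equation leaves `E g′ = 0`, and `E` is invertible
        -- modulo `Δ`; so `g′` joins the ideal, until a nonzero constant is reached. The bound
        -- `r + d < p` keeps the factors `r + 1` and the leading coefficients of the derivatives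
        -- nonzero.
        coprime-Δ : ∀ d r κ g → D κ ≋ P.0# → HasDegree g d → r ℕ.+ d < p → ODE r κ g → In f Δ g → In f Δ P.1#
        coprime-Δ zero r κ g Dκ deg lt ode i = In-const deg i
        coprime-Δ (suc d) r κ g Dκ deg lt ode i = coprime-Δ d (suc r) (κ′ r κ) (D g) (Dκ′ r Dκ)
          (D-degree deg (ℕP.≤-<-trans (ℕP.m≤n+m (suc d) r) lt)) lt′ (ODE-suc r Dκ ode) Dg∈
          where
          lt′ : suc r ℕ.+ d < p
          lt′ = ≡.subst (_< p) (ℕP.+-suc r d) lt
          Δ∈ : In f Δ Δ
          Δ∈ = P.0# , P.1# , P.trans (P.+-cong (P.zeroˡ f) (P.*-identityˡ Δ)) (P.+-identityˡ Δ)
          EDg∈ : In f Δ (E P.* D g)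
          EDg∈ = 4ι≉0 (suc r) (s≤s z≤n) (ℕP.≤-<-trans (ℕP.m≤m+n (suc r) d) lt′)
            (In-cong (P.trans (P.+-congˡ (P.sym ode)) (P.solve 3 (λ a b c → (P.:- (a P.:^ 0)) P.:* (a P.:+ c) P.:+ (a P.:+ b P.:+ c) P.:= b) P.refl _ _ _))
              (In-+ (In-* (P.- P.1#) (In-+ (In-* (P.ι 4) (In-cong (P.*-comm _ Δ) (In-* (D (D g)) Δ∈))) (In-* κ i))) (In-cong (P.zeroˡ _) (In-* P.0# i))))
          Dg∈ : In f Δ (D g)
          Dg∈ = let s , t , st = cop in In-cong (P.trans (P.solve 5 (λ s t ε δ g → s P.:* (ε P.:* g) P.:+ (t P.:* g) P.:* δ P.:= (s P.:* ε P.:+ t P.:* δ) P.:* g) P.refl s t E Δ (D g)) (P.trans (P.*-congʳ st) (P.*-identityˡ _)))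
            (In-+ (In-* s EDg∈) (In-* (t P.* D g) Δ∈))

        -- With `g` and `g′` in the ideal of `f` and `f′`, the equation puts `Δ g″` there, and `Δ`
        -- is now known to be invertible modulo `f`.
        coprime-D : Coprime f Δ → ∀ d r κ g → D κ ≋ P.0# → HasDegree g d → r ℕ.+ d < p → ODE r κ g → In f (D f) g → In f (D f) (D g) → In f (D f) P.1#
        coprime-D fΔ zero r κ g Dκ deg lt ode i i′ = In-const deg i
        coprime-D fΔ (suc d) r κ g Dκ deg lt ode i i′ = coprime-D fΔ d (suc r) (κ′ r κ) (D g) (Dκ′ r Dκ)
          (D-degree deg (ℕP.≤-<-trans (ℕP.m≤n+m (suc d) r) lt)) (≡.subst (_< p) (ℕP.+-suc r d) lt) (ODE-suc r Dκ ode) i′ DDg∈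
          where
          ΔDDg∈ : In f (D f) (Δ P.* D (D g))
          ΔDDg∈ = In-ι 4 (s≤s z≤n) 4<p (In-cong
            (P.trans (P.+-congˡ (P.sym ode)) (P.solve 3 (λ a b c → (P.:- (a P.:^ 0)) P.:* (b P.:+ c) P.:+ (a P.:+ b P.:+ c) P.:= a) P.refl _ _ _))
            (In-+ (In-* (P.- P.1#) (In-+ (In-* (P.ι 4 P.* P.ι (suc r)) (In-* E i′)) (In-* κ i))) (In-cong (P.zeroˡ _) (In-* P.0# i))))
          DDg∈ : In f (D f) (D (D g))
          DDg∈ = let u , v , uv = fΔ in In-cong (P.trans (P.solve 5 (λ u v f δ g → (u P.:* g) P.:* f P.:+ v P.:* (δ P.:* g) P.:= (u P.:* f P.:+ v P.:* δ) P.:* g) P.refl u v f Δ (D (D g))) (P.trans (P.*-congʳ uv) (P.*-identityˡ _)))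
            (In-+ (In-* (u P.* D (D g)) f∈) (In-* v ΔDDg∈))
            where
            f∈ : In f (D f) f
            f∈ = P.1# , P.0# , P.trans (P.+-cong (P.*-identityˡ f) (P.zeroˡ _)) (P.+-identityʳ f)

      separable : ∀ {d κ} → D κ ≋ P.0# → HasDegree f d → d < p → ODE 0 κ f → Coprime f (D f)
      separable {d} {κ} Dκ deg d<p ode = coprime-D
        (coprime-Δ d 0 κ f Dκ deg d<p ode (P.1# , P.0# , P.trans (P.+-cong (P.*-identityˡ f) (P.zeroˡ _)) (P.+-identityʳ f)))
        d 0 κ f Dκ deg d<p ode
        (P.1# , P.0# , P.trans (P.+-cong (P.*-identityˡ f) (P.zeroˡ _)) (P.+-identityʳ f))
        (P.0# , P.1# , P.trans (P.+-cong (P.zeroˡ f) (P.*-identityˡ _)) (P.+-identityˡ _))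

module _ (S : CommutativeRing 0ℓ 0ℓ) where
  open RingTheory S

  private
    k : ∀ {m} → ℕ → Solver.Polynomial m
    k n = con (ℤ.+ n)

  -- With ν = n, ν₁ = n − 1, 2n = −1 and f′ = n c₁, f″ = n (n − 1) c₂.
  ode-coefficients : ∀ δ x c₀ c₁ c₂ ν ν₁ → ι 2 * ν ≈ - 1# → ι 2 * ν₁ ≈ - ι 3 →
    ι 3 * (δ * c₂) - ι 108 * (x * c₁) + ι 15 * c₀ ≈ 0# →
    ι 4 * (δ * (ν * (ν₁ * c₂))) + ι 4 * ι 1 * (ι 54 * x * (ν * c₁)) + ι 15 * c₀ ≈ 0#
  ode-coefficients δ x c₀ c₁ c₂ ν ν₁ e e₁ r = begin⟨ setoid ⟩
    ι 4 * (δ * (ν * (ν₁ * c₂))) + ι 4 * ι 1 * (ι 54 * x * (ν * c₁)) + ι 15 * c₀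
      ≈⟨ solve 7 (λ δ x c₀ c₁ c₂ ν ν₁ → k 4 :* (δ :* (ν :* (ν₁ :* c₂))) :+ k 4 :* k 1 :* (k 54 :* x :* (ν :* c₁)) :+ k 15 :* c₀
           := (k 2 :* ν) :* (k 2 :* ν₁) :* (δ :* c₂) :+ k 108 :* ((k 2 :* ν) :* (x :* c₁)) :+ k 15 :* c₀) refl δ x c₀ c₁ c₂ ν ν₁ ⟩
    (ι 2 * ν) * (ι 2 * ν₁) * (δ * c₂) + ι 108 * ((ι 2 * ν) * (x * c₁)) + ι 15 * c₀
      ≈⟨ +-congʳ (+-cong (*-congʳ (*-cong e e₁)) (*-congˡ (*-congʳ e))) ⟩
    (- 1#) * (- ι 3) * (δ * c₂) + ι 108 * ((- 1#) * (x * c₁)) + ι 15 * c₀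
      ≈⟨ solve 3 (λ a b c → (:- (a :^ 0)) :* (:- k 3) :* a :+ k 108 :* ((:- (a :^ 0)) :* b) :+ k 15 :* c := k 3 :* a :- k 108 :* b :+ k 15 :* c) refl (δ * c₂) (x * c₁) c₀ ⟩
    ι 3 * (δ * c₂) - ι 108 * (x * c₁) + ι 15 * c₀ ≈⟨ r ⟩
    0# ∎

  -- For Δ = 4a + 27x² and Δ′ = 54x.
  discriminant-bezout : ∀ a x → (- x) * (ι 54 * x) + ι 2 * (ι 4 * a + ι 27 * (x * x)) ≈ ι 8 * a
  discriminant-bezout = solve 2 (λ a x → (:- x) :* (k 54 :* x) :+ k 2 :* (k 4 :* a :+ k 27 :* (x :* x)) := k 8 :* a) refl

  derivative-x² : ∀ x → ι 27 * (x + x) ≈ ι 54 * x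
  derivative-x² = solve 1 (λ x → k 27 :* (x :+ x) := k 54 :* x) refl

module HasseSeparable (R : CommutativeRing 0ℓ 0ℓ) (isField : IsDiscreteField R) (N : ℕ)
  (ch : RingTheory.CharP R (suc (suc (suc N) ℕ.+ suc (suc N))))
  (ι≉0 : ∀ j → 0 < j → j < suc (suc (suc N) ℕ.+ suc (suc N)) → ¬ CommutativeRing._≈_ R (RingTheory.ι R j) (CommutativeRing.0# R))
  (1≤N : 1 ≤ N) (A : CommutativeRing.Carrier R) (A≉0 : ¬ CommutativeRing._≈_ R A (CommutativeRing.0# R)) where
  open RingTheory R
  open PolyTheory R
  open FieldTheory R isField
  open HasseFamily R A

  private
    n p : ℕ
    n = suc (suc N)
    p = suc (n ℕ.+ n)

    6≤2n : 6 ≤ n ℕ.+ n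
    6≤2n = ℕP.+-mono-≤ (s≤s (s≤s 1≤N)) (s≤s (s≤s 1≤N))

  f : Poly
  f = hasse n (n ℕ.+ n)

  private
    f₁ = hasse (suc N) (n ℕ.+ n)
    f₂ = hasse N (n ℕ.+ n)
    open Cubic (R [X]) (C A) X using (Δ; relation)

    P-ch : P.CharP p
    P-ch = Hom.CharP-homo C-hom {p} ch

    negate : ∀ i j → i ℕ.+ j ≡ p → P.ι i ≋ P.- P.ι j
    negate i j e = begin⟨ P.setoid ⟩
      P.ι i ≈⟨ P.solve 2 (λ a b → a P.:= (a P.:+ b) P.:- b) P.refl (P.ι i) (P.ι j) ⟩
      (P.ι i P.+ P.ι j) P.- P.ι j ≈⟨ P.+-congʳ (P.trans (P.sym (P.×-homo-+ P.1# i j)) (P.trans (P.reflexive (≡.cong P.ι e)) P-ch)) ⟩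
      P.0# P.- P.ι j ≈⟨ P.+-identityˡ _ ⟩
      P.- P.ι j ∎

    2n≋-1 : P.ι 2 P.* P.ι n ≋ P.- P.1#
    2n≋-1 = P.trans (P.sym (P.×1-homo-* 2 n)) (P.trans (negate (2 ℕ.* n) 1 lemma) (P.-‿cong (P.+-identityʳ P.1#)))
      where
      lemma : 2 ℕ.* suc (suc N) ℕ.+ 1 ≡ suc (suc (suc N) ℕ.+ suc (suc N))
      lemma = ℕSolver.solve (N ∷ [])

    2[n-1]≋-3 : P.ι 2 P.* P.ι (suc N) ≋ P.- P.ι 3
    2[n-1]≋-3 = P.trans (P.sym (P.×1-homo-* 2 (suc N))) (negate (2 ℕ.* suc N) 3 lemma)
      where
      lemma : 2 ℕ.* suc N ℕ.+ 3 ≡ suc (suc (suc N) ℕ.+ suc (suc N))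
      lemma = ℕSolver.solve (N ∷ [])

    E e : Poly
    E = P.ι 54 P.* X
    e = P.ι 54

    D-const : ∀ j → D (P.ι j) ≋ P.0#
    D-const j = P.trans (D-cong (P.sym (Hom.ι-homo C-hom j))) (D-C (ι j))

    module Sep = Separability R isField p ι≉0 (s≤s (ℕP.≤-trans (ℕP.m≤n+m 4 2) 6≤2n)) Δ E e

    DE : D E ≋ e
    DE = P.trans (Sep.D-ι 54 X) (P.trans (P.*-congˡ D-X) (P.*-identityʳ _))

    DΔ : D Δ ≋ E
    DΔ = P.trans (D-+ _ _) (P.trans (P.+-cong
        (P.trans (Sep.D-ι 4 _) (P.trans (P.*-congˡ (P.trans (D-cong (P.sym A³)) (D-C (A * A * A)))) (P.zeroʳ _)))
        (P.trans (Sep.D-ι 27 _) (P.trans (P.*-congˡ (P.trans (D-* X X) (P.+-cong (P.trans (P.*-congʳ D-X) (P.*-identityˡ X)) (P.trans (P.*-congˡ D-X) (P.*-identityʳ X))))) (derivative-x² (R [X]) X))))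
      (P.+-identityˡ E))
      where
      A³ : C (A * A * A) ≋ C A P.* C A P.* C A
      A³ = P.trans (Hom.*-homo C-hom (A * A) A) (P.*-congʳ (Hom.*-homo C-hom A A))

    coprime-E-Δ : Coprime E Δ
    coprime-E-Δ = u P.* (P.- X) , u P.* P.ι 2 , P.trans (P.solve 5 (λ u x ε t δ → u P.:* x P.:* ε P.:+ u P.:* t P.:* δ P.:= u P.:* (x P.:* ε P.:+ t P.:* δ)) P.refl u (P.- X) E (P.ι 2) Δ)
      (P.trans (P.*-congˡ (discriminant-bezout (R [X]) (C A P.* C A P.* C A) X)) (P.trans (P.*-congˡ 8A³) (P.trans (P.sym (Hom.*-homo C-hom _ _)) (Hom.cong C-hom (trans (*-comm _ _) (*-inv a a≉0))))))
      where
      a = ι 8 * (A * A * A)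
      2≉0 : ¬ ι 2 ≈ 0#
      2≉0 = ι≉0 2 (s≤s z≤n) (s≤s (ℕP.≤-trans (ℕP.m≤n+m 2 4) 6≤2n))
      8≉0 : ¬ ι 8 ≈ 0#
      8≉0 e = *≉0 2≉0 (*≉0 2≉0 2≉0) (trans (trans (*-congˡ (sym (×1-homo-* 2 2))) (sym (×1-homo-* 2 4))) e)
      a≉0 : ¬ a ≈ 0#
      a≉0 = *≉0 8≉0 (*≉0 (*≉0 A≉0 A≉0) A≉0)
      u = C (inv a a≉0)
      8A³ : P.ι 8 P.* (C A P.* C A P.* C A) ≋ C a
      8A³ = P.sym (P.trans (Hom.*-homo C-hom (ι 8) _) (P.*-cong (Hom.ι-homo C-hom 8) (P.trans (Hom.*-homo C-hom (A * A) A) (P.*-congʳ (Hom.*-homo C-hom A A)))))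

    Df : D f ≋ P.ι n P.* f₁
    Df = D-hasse (suc N) (n ℕ.+ n)

    DDf : D (D f) ≋ P.ι n P.* (P.ι (suc N) P.* f₂)
    DDf = P.trans (D-cong Df) (P.trans (Sep.D-ι n f₁) (P.*-congˡ (D-hasse N (n ℕ.+ n))))

    ode : Sep.ODE 0 (P.ι 15) f
    ode = P.trans (P.+-congʳ (P.+-cong (P.*-congˡ (P.*-congˡ DDf)) (P.*-congˡ (P.*-congˡ Df))))
      (ode-coefficients (R [X]) Δ X f f₁ f₂ (P.ι n) (P.ι (suc N)) 2n≋-1 2[n-1]≋-3 (relation N P-ch))

    -- Downwards along the recurrence: a zero at `x^(2i+2)` forces one at `x^(2i)`, because
    -- `2M - 2i` is positive and below `p`; the end would be `A^M = 0`.
    γ≉0 : ∀ M i → i ≤ M → M ℕ.+ M < p → ¬ Evaluation.ev {R} id-hom 0# (hasse M (M ℕ.+ (i ℕ.+ i))) ≈ 0#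
    γ≉0 M i i≤M 2M<p z = go M i i≤M 2M<p (trans (sym (hasse-at-0 M (i ℕ.+ i))) z)
      where
      go : ∀ M i → i ≤ M → M ℕ.+ M < p → ¬ γ M (i ℕ.+ i) ≈ 0#
      go M zero _ _ z = ^≉0 M A≉0 (trans (sym (γ-0 M)) z)
      go (suc M) (suc i) i<M 2M<p z = go (suc M) i (ℕP.<⇒≤ i<M) 2M<p (*-cancel-0 difference≉0 (begin⟨ setoid ⟩
          ι r * g ≈⟨ solve 3 (λ r j g → r :* g := (r :+ j) :* g :- j :* g) refl (ι r) (ι (i ℕ.+ i)) g ⟩
          (ι r + ι (i ℕ.+ i)) * g - ι (i ℕ.+ i) * g ≈⟨ +-congʳ (*-congʳ (trans (sym (×-homo-+ 1# r (i ℕ.+ i))) (trans (reflexive (≡.cong ι r+2i)) (×1-homo-* (suc M) 2)))) ⟩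
          ι (suc M) * ι 2 * g - ι (i ℕ.+ i) * g ≈⟨ +-congʳ (γ-suc M (i ℕ.+ i)) ⟨
          A * (ι (suc (suc (i ℕ.+ i))) * γ (suc M) (suc (suc (i ℕ.+ i)))) + ι (i ℕ.+ i) * g - ι (i ℕ.+ i) * g
            ≈⟨ +-congʳ (+-congʳ (*-congˡ (*-congˡ (trans (reflexive (≡.cong (γ (suc M)) (≡.cong suc (≡.sym (ℕP.+-suc i i))))) z)))) ⟩
          A * (ι (suc (suc (i ℕ.+ i))) * 0#) + ι (i ℕ.+ i) * g - ι (i ℕ.+ i) * g
            ≈⟨ solve 3 (λ a j c → a :* (j :* con (ℤ.+ 0)) :+ c :- c := con (ℤ.+ 0)) refl A (ι (suc (suc (i ℕ.+ i)))) (ι (i ℕ.+ i) * g) ⟩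
          0# ∎))
        where
        g = γ (suc M) (i ℕ.+ i)
        r = (suc M ℕ.* 2) ∸ (i ℕ.+ i)
        2i<2M : i ℕ.+ i < suc M ℕ.* 2
        2i<2M = ≡.subst (i ℕ.+ i <_) lemma (ℕP.+-mono-< i<M i<M)
          where
          lemma : suc M ℕ.+ suc M ≡ suc M ℕ.* 2
          lemma = ℕSolver.solve (M ∷ [])
        r+2i : r ℕ.+ (i ℕ.+ i) ≡ suc M ℕ.* 2
        r+2i = ℕP.m∸n+n≡m (ℕP.<⇒≤ 2i<2M)
        difference≉0 : ¬ ι r ≈ 0#
        difference≉0 = ι≉0 r (ℕP.m<n⇒0<n∸m 2i<2M) (ℕP.≤-<-trans (ℕP.m∸n≤m (suc M ℕ.* 2) (i ℕ.+ i)) (≡.subst (_< p) lemma 2M<p))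
          where
          lemma : suc M ℕ.+ suc M ≡ suc M ℕ.* 2
          lemma = ℕSolver.solve (M ∷ [])

    -- For even `n` the value at `B = 0` is already nonzero. For odd `n` it is an odd coefficient of
    -- a power of `x² + A`, hence useless, and the derivative `n f₁` is evaluated instead.
    f≉0 : f ≉0
    f≉0 f≋0 = case (Arithmetic.parity n)
      where
      zero-at-0 : ∀ {g} → g ≋ P.0# → eval 0# g ≈ 0#
      zero-at-0 e = Hom.cong (At.ev-hom 0#) e
      f₁≋0 : f₁ ≋ P.0#
      f₁≋0 = P-cancel (λ e → ι≉0 n (s≤s z≤n) (s≤s (ℕP.m≤m+n n n)) (at (P.trans (Hom.ι-homo C-hom n) e) 0))
        (P.trans (P.sym Df) (P.trans (P.trans (D-cong f≋0) D-0) (P.sym (P.zeroʳ _))))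
      case : (∃ λ j → n ≡ j ℕ.+ j ⊎ n ≡ suc (j ℕ.+ j)) → ⊥
      case (j , inj₁ n≡) = γ≉0 n j (≡.subst (j ≤_) (≡.sym n≡) (ℕP.m≤m+n j j)) ℕP.≤-refl
        (zero-at-0 (P.trans (P.reflexive (≡.cong (λ i → hasse n (n ℕ.+ i)) (≡.sym n≡))) f≋0))
      case (zero , inj₂ n≡) = ⊥-elim (ℕP.1+n≢0 (ℕP.suc-injective n≡))
      case (suc j , inj₂ n≡) = γ≉0 (suc N) (suc (suc j)) (≡.subst (suc (suc j) ≤_) (≡.sym N≡) (s≤s (ℕP.≤-trans (s≤s (ℕP.m≤n+m j j)) (ℕP.≤-reflexive (≡.sym (ℕP.+-suc j j))))))
        (ℕP.<-trans (ℕP.+-mono-< (ℕP.n<1+n (suc N)) (ℕP.n<1+n (suc N))) ℕP.≤-refl)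
        (zero-at-0 (P.trans (P.reflexive (≡.cong (hasse (suc N)) index)) f₁≋0))
        where
        N≡ : suc N ≡ suc j ℕ.+ suc j
        N≡ = ℕP.suc-injective n≡
        index : suc N ℕ.+ (suc (suc j) ℕ.+ suc (suc j)) ≡ n ℕ.+ n
        index = ≡.trans (≡.cong (λ i → suc N ℕ.+ suc i) (ℕP.+-suc (suc j) (suc j))) (≡.trans (≡.cong (λ i → suc N ℕ.+ suc (suc i)) (≡.sym N≡)) (ℕP.+-suc (suc N) (suc (suc N))))

    3d≤n : ∀ {d} → HasDegree f d → 3 ℕ.* d ≤ n
    3d≤n {d} deg = ℕP.≮⇒≥ λ n<3d → ℕP.<-irrefl ≡.refl (degree≥ deg (hasse≺ n (n ℕ.+ n) d (≡.subst (_< n ℕ.+ n ℕ.+ 3 ℕ.* d) lemma (ℕP.+-monoʳ-< (n ℕ.+ n) n<3d))))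
      where
      lemma : suc (suc N) ℕ.+ suc (suc N) ℕ.+ suc (suc N) ≡ 3 ℕ.* suc (suc N)
      lemma = ℕSolver.solve (N ∷ [])

  hasse-separable : ∃ λ d-1 → HasDegree f (suc d-1) × Coprime f (D f) × 3 ℕ.* suc d-1 ≤ n
  hasse-separable = case (degree f)
    where
    case : f ≋ P.0# ⊎ ∃ (HasDegree f) → ∃ λ d-1 → HasDegree f (suc d-1) × Coprime f (D f) × 3 ℕ.* suc d-1 ≤ n
    case (inj₁ e) = ⊥-elim (f≉0 e)
    case (inj₂ (suc d , deg)) = d , deg , Sep.separable DΔ DE (D-const 54) coprime-E-Δ (D-const 15) deg
      (ℕP.≤-<-trans (ℕP.≤-trans (ℕP.m≤m+n (suc d) _) (3d≤n deg)) (s≤s (ℕP.m≤m+n n n))) ode , 3d≤n deg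
    -- For a constant `f` the equation shrinks to `15 f = 0`, and 15 is invertible since `1 ≤ N`
    -- means `p ≥ 7`.
    case (inj₂ (zero , (b , _))) = ⊥-elim (f≉0 (P-cancel 15≉0 (P.trans (P.sym (P.trans (P.+-congʳ
        (P.trans (P.+-cong (P.trans (P.*-congˡ (P.trans (P.*-congˡ DDf≋0) (P.zeroʳ Δ))) (P.zeroʳ _)) (P.trans (P.*-congˡ (P.trans (P.*-congˡ Df≋0) (P.zeroʳ E))) (P.zeroʳ _))) (P.+-identityˡ _)))
        (P.+-identityˡ _))) (P.trans ode (P.sym (P.zeroʳ _))))))
      where
      Df≋0 : D f ≋ P.0#
      Df≋0 = ext λ j → trans (coeff-D f j) (trans (*-congˡ (vanish b (suc j) (s≤s z≤n))) (zeroʳ _))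
      DDf≋0 : D (D f) ≋ P.0#
      DDf≋0 = P.trans (D-cong Df≋0) D-0
      15≉0 : P.ι 15 ≉0
      15≉0 e = *≉0 (ι≉0 3 (s≤s z≤n) (s≤s (ℕP.≤-trans (ℕP.m≤n+m 3 3) 6≤2n))) (ι≉0 5 (s≤s z≤n) (s≤s (ℕP.≤-trans (ℕP.n≤1+n 5) 6≤2n)))
        (trans (sym (×1-homo-* 3 5)) (at (P.trans (Hom.ι-homo C-hom 15) e) 0))

-- The values of `f^c` on one column

length-filter-∪ : ∀ {A : Set} {U P Q : Pred A 0ℓ} (U? : Decidable U) (P? : Decidable P) (Q? : Decidable Q) →
  (∀ x → U x → P x ⊎ Q x) → ∀ xs → length (filter U? xs) ≤ length (filter P? xs) ℕ.+ length (filter Q? xs)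
length-filter-∪ U? P? Q? cover [] = z≤n
length-filter-∪ {U = U} {P} {Q} U? P? Q? cover (x ∷ xs) = step (length-filter-∪ U? P? Q? cover xs)
  where
  a = length (filter P? xs)
  b = length (filter Q? xs)
  bit : ∀ {X : Set} → Dec X → ℕ
  bit (yes _) = 1
  bit (no _) = 0
  length-filter-∷ : ∀ {V : Pred _ 0ℓ} (V? : Decidable V) → length (filter V? (x ∷ xs)) ≡ bit (V? x) ℕ.+ length (filter V? xs)
  length-filter-∷ V? with V? x
  ... | yes _ = ≡.refl
  ... | no _ = ≡.refl
  bits : (u : Dec (U x)) (p : Dec (P x)) (q : Dec (Q x)) → bit u ≤ bit p ℕ.+ bit q
  bits (no _) _ _ = z≤n
  bits (yes _) (yes _) _ = s≤s z≤n
  bits (yes _) (no _) (yes _) = s≤s z≤n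
  bits (yes u) (no ¬p) (no ¬q) = ⊥-elim ([ ¬p , ¬q ]′ (cover x u))
  regroup : ∀ i j a b → (i ℕ.+ j) ℕ.+ (a ℕ.+ b) ≡ (i ℕ.+ a) ℕ.+ (j ℕ.+ b)
  regroup i j a b = ℕSolver.solve (i ∷ j ∷ a ∷ b ∷ [])
  step : length (filter U? xs) ≤ a ℕ.+ b →
         length (filter U? (x ∷ xs)) ≤ length (filter P? (x ∷ xs)) ℕ.+ length (filter Q? (x ∷ xs))
  step ih = ≡.subst₂ _≤_ (≡.sym (length-filter-∷ U?)) (≡.sym (≡.trans (≡.cong₂ ℕ._+_ (length-filter-∷ P?) (length-filter-∷ Q?)) (≡.sym (regroup (bit (P? x)) (bit (Q? x)) a b))))
    (ℕP.+-mono-≤ (bits (U? x) (P? x) (Q? x)) ih)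

nth : ∀ {A : Set} → A → List A → ℕ → A
nth a [] _ = a
nth a (x ∷ xs) zero = x
nth a (x ∷ xs) (suc i) = nth a xs i

∈⇒nth : ∀ {A : Set} (a : A) {x xs} → x ∈ xs → ∃ λ i → i < length xs × x ≡ nth a xs i
∈⇒nth a (here ≡.refl) = 0 , s≤s z≤n , ≡.refl
∈⇒nth a (there x∈) = let i , i< , e = ∈⇒nth a x∈ in suc i , s≤s i< , e

module Column (R : CommutativeRing 0ℓ 0ℓ) (isField : IsDiscreteField R)
  {elements : List (CommutativeRing.Carrier R)} (unique : Unique elements) (complete : ∀ x → x ∈ elements)
  (m′ k c : ℕ) (pr : Prime (suc (suc m′))) (order : length elements ≡ suc (suc m′) ℕ.^ k) (q≡ : suc (suc m′ ℕ.* c) ≡ suc (suc m′) ℕ.^ k)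
  (1≤c : 1 ≤ c) (4≤m : 4 ≤ suc m′)
  {f δ} (deg : FieldTheory.HasDegree R isField f (suc δ)) (cop : FieldTheory.Coprime R isField f (PolyTheory.D R f)) (4d≤m : 4 ℕ.* suc δ ≤ suc m′) where
  open RingTheory R
  open PolyTheory R
  open FieldTheory R isField
  open FiniteFieldTheory R isField unique complete {suc (suc m′)} {k} pr order
  open Arithmetic

  private
    m p d q : ℕ
    m = suc m′
    p = suc m
    d = suc δ
    q = p ℕ.^ k

    P-ch : P.CharP p
    P-ch = Hom.CharP-homo C-hom {p} ι-p

    1<F : 1 < length elements
    1<F = ≡.subst (1 <_) (≡.trans q≡ (≡.sym order)) (s≤s (ℕP.*-mono-≤ {1} {m} (s≤s z≤n) 1≤c))

    module St = Stepanov R isField unique complete 1<F pr P-ch k x^q≈x deg cop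

    mc≤q : m ℕ.* c ≤ q
    mc≤q = ℕP.≤-trans (ℕP.n≤1+n _) (ℕP.≤-reflexive q≡)

    1≤q : 1 ≤ q
    1≤q = ≡.subst (1 ≤_) q≡ (s≤s z≤n)

  module Bounds (s r : ℕ) (s²≤q : s ℕ.* s ≤ suc (m ℕ.* c)) (q<s² : suc (m ℕ.* c) < suc s ℕ.* suc s)
    (mr≤s : m ℕ.* r ≤ s) (s<mr+m : s < m ℕ.* suc r) (1≤r : 1 ≤ r) where

    private
      l = m ℕ.* r

      l≤q : l ≤ q
      l≤q = ℕP.≤-trans mr≤s (ℕP.≤-trans (ℕP.m≤m*n s s {{ℕ.>-nonZero (ℕP.<-≤-trans (s≤s z≤n) (ℕP.≤-trans (ℕP.*-mono-≤ {1} {m} (s≤s z≤n) 1≤r) mr≤s))}}) (ℕP.≤-trans s²≤q (ℕP.≤-reflexive q≡)))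

      degree-term : ∀ {K₀ i j J} → i < m → j < suc J → K₀ ℕ.+ J ≡ c → K₀ ℕ.+ j ℕ.* q ℕ.+ i ℕ.* (c ℕ.* d) ≤ c ℕ.* (J ℕ.+ d) ℕ.* m
      degree-term {K₀} {i} {j} {J} i<m j≤J e = ℕP.≤-trans
        (ℕP.+-mono-≤ (ℕP.+-monoʳ-≤ K₀ (ℕP.*-mono-≤ (ℕ.s≤s⁻¹ j≤J) (ℕP.≤-reflexive (≡.sym q≡)))) (ℕP.*-monoˡ-≤ (c ℕ.* d) (ℕ.s≤s⁻¹ i<m)))
        (degree-bound m′ c s r δ 4≤m 4d≤m s²≤q q<s² mr≤s s<mr+m 1≤r {K₀} {J} e)

      cancel-m : ∀ {N X} → N ℕ.* l < c ℕ.* X ℕ.* m → N ℕ.* r < c ℕ.* X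
      cancel-m {N} {X} lt = ℕP.*-cancelˡ-< m _ _ (≡.subst₂ _<_ (lemma m) (ℕP.*-comm (c ℕ.* X) m) lt)
        where
        lemma : ∀ m → N ℕ.* (m ℕ.* r) ≡ m ℕ.* (N ℕ.* r)
        lemma m = ℕSolver.solve (N ∷ m ∷ r ∷ [])

    module _ {xs : List Carrier} (uniq : Unique xs) (f≉0 : ∀ x → x ∈ xs → ¬ eval x f ≈ 0#) where

      -- Without a power of `f` the `j`-th term carries `f(x₀)^j`, so `w j = j`. Its degree `j d`
      -- together with `(s - j) d` exactly fills `L s = κ + s d`, and `K j` stays constant.
      few-points : ∀ t → (∀ x → x ∈ xs → eval x f ^ c ≈ t) → length xs ≤ c ℕ.+ 2 ℕ.* p ℕ.* s
      few-points t values = upper-bound m′ c s r δ 4≤m 4d≤m s²≤q q<s² mr≤s s<mr+m 1≤r (≡.subst (λ X → length xs ℕ.* r < c ℕ.* X) lemma₁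
        (cancel-m {length xs} {r ℕ.+ δ ℕ.+ d} (St.points-bound m c (r ℕ.+ d) l 1 (c ℕ.* (r ℕ.+ δ ℕ.+ d) ℕ.* m) 0 (λ _ → κ) (λ s → κ ℕ.+ s ℕ.* d) (λ _ → 0) (λ j → j) (λ _ → t)
          mc≤q l≤q (λ j → ≡.refl) inner outer conditions count uniq f≉0 (λ x x∈ → 0 , s≤s z≤n , values x x∈) 1≤q)))
        where
        -- The largest value allowed by `inner`: `κ + (J - 1) = c`.
        κ = suc c ∸ (r ℕ.+ d)
        κ+J : κ ℕ.+ (r ℕ.+ d) ≡ suc c
        κ+J = ℕP.m∸n+n≡m (ℕP.≤-trans (ℕP.+-monoʳ-≤ r (ℕP.m≤n*m d 2)) (ℕP.≤-trans (r+2d≤c m′ c s r δ 4≤m 4d≤m s²≤q q<s² mr≤s s<mr+m 1≤r) (ℕP.n≤1+n c)))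
        J≡ : r ℕ.+ d ≡ suc (r ℕ.+ δ)
        J≡ = ℕP.+-suc r δ
        κ+J-1 : κ ℕ.+ (r ℕ.+ δ) ≡ c
        κ+J-1 = ℕP.suc-injective (≡.trans (≡.sym (ℕP.+-suc κ _)) (≡.trans (≡.cong (κ ℕ.+_) (≡.sym J≡)) κ+J))
        lemma₁ : r ℕ.+ δ ℕ.+ suc δ ≡ r ℕ.+ (2 ℕ.* δ ℕ.+ 1)
        lemma₁ = ℕSolver.solve (r ∷ δ ∷ [])
        inner : ∀ j → j < r ℕ.+ d → κ ℕ.+ 0 ℕ.+ j ≤ c
        inner j j<J = ℕP.≤-trans (ℕP.+-mono-≤ (ℕP.≤-reflexive (ℕP.+-identityʳ κ)) (ℕ.s≤s⁻¹ (≡.subst (j <_) J≡ j<J))) (ℕP.≤-reflexive κ+J-1)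
        outer : ∀ i j → i < m → j < r ℕ.+ d → κ ℕ.+ 0 ℕ.+ j ℕ.* q ℕ.+ i ℕ.* (c ℕ.* d) ≤ c ℕ.* (r ℕ.+ δ ℕ.+ d) ℕ.* m
        outer i j i<m j<J = ≡.subst (λ x → x ℕ.+ j ℕ.* q ℕ.+ i ℕ.* (c ℕ.* d) ≤ c ℕ.* (r ℕ.+ δ ℕ.+ d) ℕ.* m) (≡.sym (ℕP.+-identityʳ κ)) (degree-term i<m (≡.subst (j <_) J≡ j<J) κ+J-1)
        conditions : ∀ j s → j < r ℕ.+ d → j ≤ s → s < l → j ℕ.* d ℕ.+ κ ℕ.+ (s ∸ j) ℕ.* d ≤ κ ℕ.+ s ℕ.* d
        conditions j s _ j≤s _ = ℕP.≤-reflexive (≡.trans (lemma κ (s ∸ j) d) (≡.cong (λ i → κ ℕ.+ i ℕ.* d) (ℕP.m+[n∸m]≡n j≤s)))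
          where
          lemma : ∀ κ i d → j ℕ.* d ℕ.+ κ ℕ.+ i ℕ.* d ≡ κ ℕ.+ (j ℕ.+ i) ℕ.* d
          lemma κ i d = ℕSolver.solve (j ∷ i ∷ d ∷ κ ∷ [])
        count : total (λ _ → total (λ s → κ ℕ.+ s ℕ.* d) l) 1 < total (λ _ → total (λ _ → κ) (r ℕ.+ d)) m
        count = ≡.subst₂ _<_ (≡.sym (ℕP.+-identityʳ _)) (≡.sym (≡.trans (total-const _ m) (≡.cong (m ℕ.*_) (total-const κ (r ℕ.+ d)))))
          (upper-count m′ c s r δ 4≤m 4d≤m s²≤q q<s² mr≤s s<mr+m 1≤r κ+J)

      -- The factor `f^(l - j)` raises every term to the same power `f(x₀)^l`, so `w j = 0` for
      -- `j ≤ l` and `K j` may grow by `j d`. Against `m - 1` values a constant `K j` would cost an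
      -- excess of order `m d` in `J`. The price is a degree `d l` in `inner`, covered by `p² ≤ s`.
      few-other-points : p ℕ.* p ≤ s → ∀ (Z : List Carrier) → length Z ≤ m′ → (∀ x → x ∈ xs → ∃ λ y → y ∈ Z × eval x f ^ c ≈ y) →
                         length xs ℕ.* r < c ℕ.* (m′ ℕ.* r ℕ.+ (2 ℕ.* δ ℕ.+ 1))
      few-other-points p²≤s Z Z≤ values = ≡.subst (λ X → length xs ℕ.* r < c ℕ.* X) (lemma₁ (m′ ℕ.* r))
        (cancel-m {length xs} {m′ ℕ.* r ℕ.+ δ ℕ.+ d} (St.points-bound m c J₀ l (length Z) (c ℕ.* (m′ ℕ.* r ℕ.+ δ ℕ.+ d) ℕ.* m) l (λ j → κ ℕ.+ j ℕ.* d) (λ s → κ ℕ.+ s ℕ.* d) (λ j → l ∸ j) (λ j → j ∸ l) (nth 0# Z)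
          mc≤q l≤q exponents inner outer conditions count uniq f≉0
          (λ x x∈ → let y , y∈ , e = values x x∈ ; i , i< , e′ = ∈⇒nth 0# y∈ in i , i< , trans e (reflexive e′)) 1≤q))
        where
        J₀ = J m′ c s r δ 4≤m 4d≤m s²≤q q<s² mr≤s s<mr+m 1≤r p²≤s
        J₀≤l : J₀ ≤ l
        J₀≤l = J≤l m′ c s r δ 4≤m 4d≤m s²≤q q<s² mr≤s s<mr+m 1≤r p²≤s
        κ = suc c ∸ (d ℕ.* l ℕ.+ J₀)
        κ+J : κ ℕ.+ (d ℕ.* l ℕ.+ J₀) ≡ suc c
        κ+J = ℕP.m∸n+n≡m (ℕP.≤-trans (ℕP.m≤n*m (d ℕ.* l ℕ.+ J₀) 2) (ℕP.≤-trans (2[dl+J]≤c m′ c s r δ 4≤m 4d≤m s²≤q q<s² mr≤s s<mr+m 1≤r p²≤s) (ℕP.n≤1+n c)))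
        J≡ : J₀ ≡ suc (m′ ℕ.* r ℕ.+ δ)
        J≡ = ℕP.+-suc (m′ ℕ.* r) δ
        κ+J-1 : (κ ℕ.+ d ℕ.* l) ℕ.+ (m′ ℕ.* r ℕ.+ δ) ≡ c
        κ+J-1 = ℕP.suc-injective (≡.trans (≡.sym (ℕP.+-suc (κ ℕ.+ d ℕ.* l) _)) (≡.trans (≡.cong ((κ ℕ.+ d ℕ.* l) ℕ.+_) (≡.sym J≡)) (≡.trans (ℕP.+-assoc κ (d ℕ.* l) J₀) κ+J)))
        lemma₁ : ∀ x → x ℕ.+ δ ℕ.+ suc δ ≡ x ℕ.+ (2 ℕ.* δ ℕ.+ 1)
        lemma₁ x = ℕSolver.solve (x ∷ δ ∷ [])
        exponents : ∀ j → (l ∸ j) ℕ.+ j ≡ l ℕ.+ (j ∸ l)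
        exponents j = [ (λ l≤j → ≡.trans (≡.cong (ℕ._+ j) (ℕP.m≤n⇒m∸n≡0 l≤j)) (≡.sym (ℕP.m+[n∸m]≡n l≤j)))
                      , (λ j≤l → ≡.trans (ℕP.m∸n+n≡m j≤l) (≡.sym (≡.trans (≡.cong (l ℕ.+_) (ℕP.m≤n⇒m∸n≡0 j≤l)) (ℕP.+-identityʳ l)))) ]′ (ℕP.≤-total l j)
        merge : ∀ j → j < J₀ → κ ℕ.+ j ℕ.* d ℕ.+ (l ∸ j) ℕ.* d ≡ κ ℕ.+ d ℕ.* l
        merge j j<J = ≡.trans (lemma κ (l ∸ j) d) (≡.cong (λ x → κ ℕ.+ d ℕ.* x) (ℕP.m+[n∸m]≡n (ℕP.≤-trans (ℕP.<⇒≤ j<J) J₀≤l)))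
          where
          lemma : ∀ κ i d → κ ℕ.+ j ℕ.* d ℕ.+ i ℕ.* d ≡ κ ℕ.+ d ℕ.* (j ℕ.+ i)
          lemma κ i d = ℕSolver.solve (κ ∷ j ∷ i ∷ d ∷ [])
        inner : ∀ j → j < J₀ → κ ℕ.+ j ℕ.* d ℕ.+ (l ∸ j) ℕ.* d ℕ.+ j ≤ c
        inner j j<J = ℕP.≤-trans (ℕP.+-mono-≤ (ℕP.≤-reflexive (merge j j<J)) (ℕ.s≤s⁻¹ (≡.subst (j <_) J≡ j<J))) (ℕP.≤-reflexive κ+J-1)
        outer : ∀ i j → i < m → j < J₀ → κ ℕ.+ j ℕ.* d ℕ.+ (l ∸ j) ℕ.* d ℕ.+ j ℕ.* q ℕ.+ i ℕ.* (c ℕ.* d) ≤ c ℕ.* (m′ ℕ.* r ℕ.+ δ ℕ.+ d) ℕ.* m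
        outer i j i<m j<J = ≡.subst (λ x → x ℕ.+ j ℕ.* q ℕ.+ i ℕ.* (c ℕ.* d) ≤ c ℕ.* (m′ ℕ.* r ℕ.+ δ ℕ.+ d) ℕ.* m) (≡.sym (merge j j<J)) (degree-term i<m (≡.subst (j <_) J≡ j<J) κ+J-1)
        conditions : ∀ j s → j < J₀ → j ≤ s → s < l → (j ∸ l) ℕ.* d ℕ.+ (κ ℕ.+ j ℕ.* d) ℕ.+ (s ∸ j) ℕ.* d ≤ κ ℕ.+ s ℕ.* d
        conditions j s j<J j≤s _ = ℕP.≤-reflexive (≡.trans (≡.cong (λ x → x ℕ.* d ℕ.+ (κ ℕ.+ j ℕ.* d) ℕ.+ (s ∸ j) ℕ.* d) (ℕP.m≤n⇒m∸n≡0 (ℕP.≤-trans (ℕP.<⇒≤ j<J) J₀≤l)))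
            (≡.trans (lemma κ (s ∸ j) d) (≡.cong (λ i → κ ℕ.+ i ℕ.* d) (ℕP.m+[n∸m]≡n j≤s))))
          where
          lemma : ∀ κ i d → κ ℕ.+ j ℕ.* d ℕ.+ i ℕ.* d ≡ κ ℕ.+ (j ℕ.+ i) ℕ.* d
          lemma κ i d = ℕSolver.solve (κ ∷ j ∷ i ∷ d ∷ [])
        count : total (λ _ → total (λ s → κ ℕ.+ s ℕ.* d) l) (length Z) < total (λ _ → total (λ j → κ ℕ.+ j ℕ.* d) J₀) m
        count = ≡.subst₂ _<_ (≡.sym (total-const _ (length Z))) (≡.sym (total-const _ m))
          (ℕP.≤-<-trans (ℕP.*-monoˡ-≤ (total (λ s → κ ℕ.+ s ℕ.* d) l) Z≤) (lower-count m′ c s r δ 4≤m 4d≤m s²≤q q<s² mr≤s s<mr+m 1≤r p²≤s κ+J))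

  module Deviation (t : Carrier) (t^m≈1 : t ^ m ≈ 1#) (s : ℕ) (s²≤q : s ℕ.* s ≤ q) (q<s² : q < suc s ℕ.* suc s) where
    open PowerSums R isField unique complete {p} {k} pr order using (eval-X^-1; X^-1≉0; X^-1≺)

    N : ℕ
    N = length (filter (λ x → eval x f ^ c ≈? t) elements)

    private
      t≉0 : ¬ t ≈ 0#
      t≉0 t≈0 = 0≉1 (trans (sym (trans (^-congˡ m t≈0) (0^ {m} (s≤s z≤n)))) t^m≈1)

      value-t⇒f≉0 : ∀ x → eval x f ^ c ≈ t → ¬ eval x f ≈ 0#
      value-t⇒f≉0 x e z = t≉0 (trans (sym e) (trans (^-congˡ c z) (0^ 1≤c)))

      r : ℕ
      r = s DivMod./ m

      mr≤s : m ℕ.* r ≤ s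
      mr≤s = ≡.subst (_≤ s) (ℕP.*-comm r m) (DivMod.m/n*n≤m s m)

      s<mr+m : s < m ℕ.* suc r
      s<mr+m = ≡.subst₂ _<_ (≡.sym (DivMod.m≡m%n+[m/n]*n s m)) (ℕP.*-comm (suc r) m) (ℕP.+-monoˡ-< (r ℕ.* m) (DivMod.m%n<n s m))

      large⇒p≤s : 2 ≤ k → p ≤ s
      large⇒p≤s 2≤k = square-cancel (ℕP.≤-<-trans (ℕP.≤-trans (ℕP.≤-reflexive (≡.cong (p ℕ.*_) (≡.sym (ℕP.*-identityʳ p)))) (ℕP.^-monoʳ-≤ p 2≤k)) q<s²)

      1≤r : 2 ≤ k → 1 ≤ r
      1≤r 2≤k = ℕP.n≢0⇒n>0 λ r≡0 → ℕP.<⇒≱ (≡.subst (λ r → s < m ℕ.* suc r) r≡0 s<mr+m)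
        (ℕP.≤-trans (ℕP.≤-reflexive (ℕP.*-identityʳ m)) (ℕP.≤-trans (ℕP.n≤1+n m) (large⇒p≤s 2≤k)))

      module B (2≤k : 2 ≤ k) = Bounds s r (≡.subst (s ℕ.* s ≤_) (≡.sym q≡) s²≤q) (≡.subst (_< suc s ℕ.* suc s) (≡.sym q≡) q<s²) mr≤s s<mr+m (1≤r 2≤k)

    upper : N ≤ c ℕ.+ (2 ℕ.* p ℕ.* s ℕ.+ p)
    upper with 3 ℕP.≤? k
    ... | yes 3≤k = ℕP.≤-trans (B.few-points (ℕP.≤-trans (ℕP.n≤1+n 2) 3≤k) (UniqueP.filter⁺ (λ x → eval x f ^ c ≈? t) unique)
            (λ x x∈ → value-t⇒f≉0 x (member x∈)) t (λ x → member))
          (ℕP.+-monoʳ-≤ c (ℕP.m≤m+n _ p))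
      where
      member : ∀ {x} → x ∈ filter (λ x → eval x f ^ c ≈? t) elements → eval x f ^ c ≈ t
      member x∈ = proj₂ (∈-filter⁻ (λ x → eval x f ^ c ≈? t) {xs = elements} x∈)
    -- For `k < 3` the whole field fits into the error term.
    ... | no k<3 = ℕP.≤-trans (ℕP.≤-trans (ListP.length-filter (λ x → eval x f ^ c ≈? t) elements) (ℕP.≤-trans (ℕP.≤-reflexive order) q≤)) (ℕP.m≤n+m _ c)
      where
      q≤ : q ≤ 2 ℕ.* p ℕ.* s ℕ.+ p
      q≤ with 2 ℕP.≤? k
      ... | yes 2≤k = ℕP.≤-trans (ℕP.^-monoʳ-≤ p (ℕ.s≤s⁻¹ (ℕP.≰⇒> k<3))) (ℕP.≤-trans (ℕP.≤-reflexive (≡.cong (p ℕ.*_) (ℕP.*-identityʳ p)))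
            (ℕP.≤-trans (ℕP.*-mono-≤ (ℕP.m≤n*m p 2) (large⇒p≤s 2≤k)) (ℕP.m≤m+n _ p)))
      ... | no k<2 = ℕP.≤-trans (ℕP.^-monoʳ-≤ p (ℕ.s≤s⁻¹ (ℕP.≰⇒> k<2))) (ℕP.≤-trans (ℕP.≤-reflexive (ℕP.*-identityʳ p)) (ℕP.m≤n+m p _))

    private
      zero? : Decidable (λ x → eval x f ≈ 0#)
      zero? x = eval x f ≈? 0#

      other? : Decidable (λ x → ¬ eval x f ≈ 0# × ¬ eval x f ^ c ≈ t)
      other? x = ¬? (eval x f ≈? 0#) ×-dec ¬? (eval x f ^ c ≈? t)

      others : List Carrier
      others = filter other? elements

      partition : suc (m ℕ.* c) ≤ d ℕ.+ N ℕ.+ length others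
      partition = ℕP.≤-trans (ℕP.≤-reflexive (≡.trans q≡ (≡.sym order)))
        (ℕP.≤-trans (≡.subst (_≤ length (filter zero? elements) ℕ.+ length (filter (¬? ∘ zero?) elements)) (≡.cong length (ListP.filter-all (λ _ → yes tt) (All.universal (λ _ → tt) elements)))
            (length-filter-∪ {U = λ _ → ⊤} (λ _ → yes tt) zero? (¬? ∘ zero?) (λ x _ → excluded (zero? x)) elements))
          (ℕP.≤-trans (ℕP.+-mono-≤ (roots-bound₁ (UniqueP.filter⁺ zero? unique) f (degree⇒≉0 deg) (λ x x∈ → proj₂ (∈-filter⁻ zero? {xs = elements} x∈)) (proj₁ deg))
              (length-filter-∪ (¬? ∘ zero?) (λ x → eval x f ^ c ≈? t) other? (λ x ne → split ne (eval x f ^ c ≈? t)) elements))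
            (ℕP.≤-reflexive (≡.sym (ℕP.+-assoc d N _)))))
        where
        excluded : ∀ {P : Set} → Dec P → P ⊎ ¬ P
        excluded (yes p) = inj₁ p
        excluded (no ¬p) = inj₂ ¬p
        split : ∀ {P Q : Set} → ¬ P → Dec Q → Q ⊎ (¬ P × ¬ Q)
        split ¬p (yes q) = inj₁ q
        split ¬p (no ¬q) = inj₂ (¬p , ¬q)

      Z? : Decidable (λ y → y ^ m ≈ 1# × ¬ y ≈ t)
      Z? y = (y ^ m ≈? 1#) ×-dec ¬? (y ≈? t)

      Z : List Carrier
      Z = filter Z? elements

      Z⁻ : ∀ {y} → y ∈ Z → y ^ m ≈ 1# × ¬ y ≈ t
      Z⁻ y∈ = proj₂ (∈-filter⁻ Z? {xs = elements} y∈)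

      -- Together with `t`, the other possible values are distinct roots of `X^m - 1`.
      Z≤ : length Z ≤ m′
      Z≤ = ℕ.s≤s⁻¹ (roots-bound₁ {t ∷ Z} (All.tabulate (λ y∈ t≡y → proj₂ (Z⁻ y∈) (reflexive (≡.sym t≡y))) ∷ UniqueP.filter⁺ Z? unique)
        (X P.^ m P.- P.1#) (X^-1≉0 m (s≤s z≤n)) root (X^-1≺ m))
        where
        root : ∀ y → y ∈ t ∷ Z → eval y (X P.^ m P.- P.1#) ≈ 0#
        root y (here ≡.refl) = trans (eval-X^-1 t m) (x≈y⇒x-y≈0 t^m≈1)
        root y (there y∈) = trans (eval-X^-1 y m) (x≈y⇒x-y≈0 (proj₁ (Z⁻ y∈)))

      other⁻ : ∀ {x} → x ∈ others → ¬ eval x f ≈ 0# × ¬ eval x f ^ c ≈ t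
      other⁻ x∈ = proj₂ (∈-filter⁻ other? {xs = elements} x∈)

      value-in-Z : ∀ {x} → x ∈ others → eval x f ^ c ∈ Z
      value-in-Z {x} x∈ = ∈-filter⁺ Z? (complete _) ((begin⟨ setoid ⟩
        (eval x f ^ c) ^ m ≈⟨ ^-assocʳ (eval x f) c m ⟩
        eval x f ^ (c ℕ.* m) ≈⟨ reflexive (≡.cong (eval x f ^_) (≡.trans (ℕP.*-comm c m) (ℕP.suc-injective (≡.trans q≡ (≡.sym 1+Q≡q))))) ⟩
        eval x f ^ Q ≈⟨ x^Q≈1 (eval x f) (proj₁ (other⁻ x∈)) ⟩
        1# ∎) , proj₂ (other⁻ x∈))

    lower : c ≤ N ℕ.+ (2 ℕ.* p ℕ.* s ℕ.+ p)
    lower with 4 ℕP.≤? k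
    ... | yes 4≤k = ≡.subst (c ≤_) (ℕP.+-assoc N _ p) (lower-bound m′ c s r δ 4≤m 4d≤m (≡.subst (s ℕ.* s ≤_) (≡.sym q≡) s²≤q) (≡.subst (_< suc s ℕ.* suc s) (≡.sym q≡) q<s²) mr≤s s<mr+m (1≤r 2≤k)
            (B.few-other-points 2≤k (UniqueP.filter⁺ other? unique) (λ x x∈ → proj₁ (other⁻ x∈)) p²≤s Z Z≤ (λ x x∈ → _ , value-in-Z x∈ , refl)) partition)
      where
      2≤k : 2 ≤ k
      2≤k = ℕP.≤-trans (s≤s (s≤s z≤n)) 4≤k
      p²≤s : p ℕ.* p ≤ s
      p²≤s = square-cancel (ℕP.≤-<-trans (ℕP.≤-trans (ℕP.≤-reflexive (lemma p)) (ℕP.^-monoʳ-≤ p 4≤k)) q<s²)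
        where
        lemma : ∀ p → p ℕ.* p ℕ.* (p ℕ.* p) ≡ p ℕ.* (p ℕ.* (p ℕ.* (p ℕ.* 1)))
        lemma p = ℕSolver.solve (p ∷ [])
    -- For `k < 4` the expected number `c` itself is within the error: `m c < q ≤ p³ ≤ 2 m p²` and
    -- `p ≤ s` when `k` is 2 or 3, and `m c < q ≤ p` below that.
    ... | no k<4 = ℕP.≤-trans c≤ (ℕP.m≤n+m _ N)
      where
      mc<q : m ℕ.* c < q
      mc<q = ℕP.≤-reflexive q≡
      c≤ : c ≤ 2 ℕ.* p ℕ.* s ℕ.+ p
      c≤ with 2 ℕP.≤? k
      ... | yes 2≤k = ℕP.≤-trans (ℕP.<⇒≤ (ℕP.*-cancelˡ-< m c (2 ℕ.* p ℕ.* p) (ℕP.<-≤-trans mc<q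
              (ℕP.≤-trans (ℕP.^-monoʳ-≤ p (ℕ.s≤s⁻¹ (ℕP.≰⇒> k<4))) (ℕP.≤-trans (ℕP.≤-reflexive (lemma₁ p)) (ℕP.≤-trans (ℕP.*-monoˡ-≤ (p ℕ.* p) p≤2m) (ℕP.≤-reflexive (lemma₂ m p))))))))
            (ℕP.≤-trans (ℕP.*-monoʳ-≤ (2 ℕ.* p) (large⇒p≤s 2≤k)) (ℕP.m≤m+n _ p))
        where
        lemma₁ : ∀ p → p ℕ.* (p ℕ.* (p ℕ.* 1)) ≡ p ℕ.* (p ℕ.* p)
        lemma₁ p = ℕSolver.solve (p ∷ [])
        lemma₂ : ∀ m p → 2 ℕ.* m ℕ.* (p ℕ.* p) ≡ m ℕ.* (2 ℕ.* p ℕ.* p)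
        lemma₂ m p = ℕSolver.solve (m ∷ p ∷ [])
        p≤2m : p ≤ 2 ℕ.* m
        p≤2m = ℕP.+-mono-≤ {1} {m} (s≤s z≤n) (ℕP.≤-reflexive (≡.sym (ℕP.+-identityʳ m)))
      ... | no k<2 = ℕP.≤-trans (ℕP.<⇒≤ (ℕP.*-cancelˡ-< m c p (ℕP.<-≤-trans mc<q (ℕP.≤-trans (ℕP.^-monoʳ-≤ p (ℕ.s≤s⁻¹ (ℕP.≰⇒> k<2))) (ℕP.≤-trans (ℕP.≤-reflexive (ℕP.*-identityʳ p)) (ℕP.m≤n*m p m))))))
            (ℕP.m≤n+m p _)

-- Counting pairs by rows and columns

module _ {A : Set} where
  length-filter-mono : ∀ {P Q : Pred A 0ℓ} (P? : Decidable P) (Q? : Decidable Q) → (∀ x → P x → Q x) → ∀ xs → length (filter P? xs) ≤ length (filter Q? xs)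
  length-filter-mono P? Q? sub [] = z≤n
  length-filter-mono P? Q? sub (x ∷ xs) with P? x | Q? x
  ... | yes _ | yes _ = s≤s (length-filter-mono P? Q? sub xs)
  ... | yes px | no ¬qx = ⊥-elim (¬qx (sub x px))
  ... | no _ | yes _ = ℕP.m≤n⇒m≤1+n (length-filter-mono P? Q? sub xs)
  ... | no _ | no _ = length-filter-mono P? Q? sub xs

  length-filter-complement : ∀ {P : Pred A 0ℓ} (P? : Decidable P) (¬P? : Decidable (¬_ ∘ P)) → ∀ xs → length (filter P? xs) ℕ.+ length (filter ¬P? xs) ≡ length xs
  length-filter-complement P? ¬P? [] = ≡.refl
  length-filter-complement P? ¬P? (x ∷ xs) with P? x | ¬P? x
  ... | yes _ | no _ = ≡.cong suc (length-filter-complement P? ¬P? xs)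
  ... | no _ | yes _ = ≡.trans (ℕP.+-suc _ _) (≡.cong suc (length-filter-complement P? ¬P? xs))
  ... | yes p | yes ¬p = ⊥-elim (¬p p)
  ... | no ¬p | no ¬¬p = ⊥-elim (¬¬p ¬p)

  length-filter-filter : ∀ {P Q : Pred A 0ℓ} (P? : Decidable P) (Q? : Decidable Q) → ∀ xs → length (filter Q? (filter P? xs)) ≡ length (filter (λ x → P? x ×-dec Q? x) xs)
  length-filter-filter P? Q? [] = ≡.refl
  length-filter-filter P? Q? (x ∷ xs) with P? x
  ... | no _ = length-filter-filter P? Q? xs
  ... | yes _ with Q? x
  ...   | yes _ = ≡.cong suc (length-filter-filter P? Q? xs)
  ...   | no _ = length-filter-filter P? Q? xs

length-cartesianProduct : ∀ {A B : Set} (xs : List A) (ys : List B) → length (cartesianProduct xs ys) ≡ length xs ℕ.* length ys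
length-cartesianProduct [] ys = ≡.refl
length-cartesianProduct (x ∷ xs) ys = ≡.trans (ListP.length-++ (map (x ,_) ys)) (≡.cong₂ ℕ._+_ (ListP.length-map (x ,_) ys) (length-cartesianProduct xs ys))

module ℕSum = ListFold ℕP.+-0-commutativeMonoid

module _ {A B : Set} {P : Pred (A × B) 0ℓ} (P? : Decidable P) where
  private
    length-filter-map : ∀ a ys → length (filter P? (map (a ,_) ys)) ≡ length (filter (λ b → P? (a , b)) ys)
    length-filter-map a [] = ≡.refl
    length-filter-map a (b ∷ ys) with P? (a , b)
    ... | yes _ = ≡.cong suc (length-filter-map a ys)
    ... | no _ = length-filter-map a ys

  count-columns : ∀ xs ys → length (filter P? (cartesianProduct xs ys)) ≡ ℕSum.fold xs (λ a → length (filter (λ b → P? (a , b)) ys))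
  count-columns [] ys = ≡.refl
  count-columns (a ∷ xs) ys = ≡.trans (≡.cong length (ListP.filter-++ P? (map (a ,_) ys) (cartesianProduct xs ys)))
    (≡.trans (ListP.length-++ (filter P? (map (a ,_) ys))) (≡.cong₂ ℕ._+_ (length-filter-map a ys) (count-columns xs ys)))

  private
    exchange : ∀ a xs b ys → length (filter (λ b → P? (a , b)) ys) ℕ.+ (length (filter (λ a → P? (a , b)) xs) ℕ.+ ℕSum.fold ys (λ b → length (filter (λ a → P? (a , b)) xs))) ≡
                             length (filter (λ a → P? (a , b)) xs) ℕ.+ ℕSum.fold ys (λ b → length (filter (λ a → P? (a , b)) (a ∷ xs)))

    add-column : ∀ a xs ys → length (filter (λ b → P? (a , b)) ys) ℕ.+ ℕSum.fold ys (λ b → length (filter (λ a → P? (a , b)) xs)) ≡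
                             ℕSum.fold ys (λ b → length (filter (λ a → P? (a , b)) (a ∷ xs)))
    add-column a xs [] = ≡.refl
    add-column a xs (b ∷ ys) with P? (a , b)
    ... | yes _ = ≡.cong suc (exchange a xs b ys)
    ... | no _ = exchange a xs b ys

    exchange a xs b ys = ≡.trans (swap-+ (length (filter (λ b → P? (a , b)) ys)) (length (filter (λ a → P? (a , b)) xs)) _) (≡.cong (length (filter (λ a → P? (a , b)) xs) ℕ.+_) (add-column a xs ys))
      where
      swap-+ : ∀ x y z → x ℕ.+ (y ℕ.+ z) ≡ y ℕ.+ (x ℕ.+ z)
      swap-+ x y z = ℕSolver.solve (x ∷ y ∷ z ∷ [])

  swap-columns : ∀ xs ys → ℕSum.fold xs (λ a → length (filter (λ b → P? (a , b)) ys)) ≡ ℕSum.fold ys (λ b → length (filter (λ a → P? (a , b)) xs))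
  swap-columns [] ys = ≡.sym (fold-0 ys)
    where
    fold-0 : ∀ ys → ℕSum.fold ys (λ _ → 0) ≡ 0
    fold-0 [] = ≡.refl
    fold-0 (_ ∷ ys) = fold-0 ys
  swap-columns (a ∷ xs) ys = ≡.trans (≡.cong (length (filter (λ b → P? (a , b)) ys) ℕ.+_) (swap-columns xs ys)) (add-column a xs ys)

-- Singular pairs

module Singular (R : CommutativeRing 0ℓ 0ℓ) (isField : IsDiscreteField R)
  {elements : List (CommutativeRing.Carrier R)} (unique : Unique elements) (complete : ∀ x → x ∈ elements)
  (2≉0 : ¬ CommutativeRing._≈_ R (RingTheory.ι R 2) (CommutativeRing.0# R)) (3≉0 : ¬ CommutativeRing._≈_ R (RingTheory.ι R 3) (CommutativeRing.0# R)) where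
  open RingTheory R
  open FieldTheory R isField

  disc : Carrier × Carrier → Carrier
  disc (A , B) = ι 4 * (A * A * A) + ι 27 * (B * B)

  private
    -- The cubics x³ + A x + B = (x − a)² (x + 2a).
    cusp : Carrier → Carrier × Carrier
    cusp a = - (ι 3 * (a * a)) , ι 2 * (a * a * a)

    disc-cusp : ∀ a → disc (cusp a) ≈ 0#
    disc-cusp = solve 1 (λ a → let A = :- (con (ℤ.+ 3) :* (a :* a)) ; B = con (ℤ.+ 2) :* (a :* a :* a) in
      con (ℤ.+ 4) :* (A :* A :* A) :+ con (ℤ.+ 27) :* (B :* B) := con (ℤ.+ 0)) refl

    27≉0 : ¬ ι 27 ≈ 0#
    27≉0 e = *≉0 3≉0 (*≉0 3≉0 3≉0) (trans (trans (*-congˡ (sym (×1-homo-* 3 3))) (sym (×1-homo-* 3 9))) e)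

    square-0 : ∀ {a} → a * a ≈ 0# → a ≈ 0#
    square-0 {a} e with a ≟ 0#
    ... | yes a≈0 = a≈0
    ... | no a≉0 = ⊥-elim (*≉0 a≉0 a≉0 e)

    cusp-injective : ∀ {a b} → cusp a ≡ cusp b → a ≡ b
    cusp-injective {a} {b} e = ≈⇒≡ (case (a ≟ 0#))
      where
      a²≈b² : a * a ≈ b * b
      a²≈b² = x-y≈0⇒x≈y (*-cancel-0 3≉0 (trans (solve 3 (λ k a b → k :* (a :- b) := (:- (k :* b)) :- (:- (k :* a))) refl (ι 3) (a * a) (b * b))
        (x≈y⇒x-y≈0 (reflexive (≡.cong proj₁ (≡.sym e))))))
      a³≈b³ : a * a * a ≈ b * b * b
      a³≈b³ = x-y≈0⇒x≈y (*-cancel-0 2≉0 (trans (solve 3 (λ k a b → k :* (a :- b) := k :* a :- k :* b) refl (ι 2) _ _) (x≈y⇒x-y≈0 (reflexive (≡.cong proj₂ e)))))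
      case : Dec (a ≈ 0#) → a ≈ b
      case (yes a≈0) = trans a≈0 (sym (square-0 (trans (sym a²≈b²) (trans (*-congʳ a≈0) (zeroˡ a)))))
      case (no a≉0) = x-y≈0⇒x≈y (*-cancel-0 (*≉0 a≉0 a≉0) (begin⟨ setoid ⟩
        a * a * (a - b) ≈⟨ solve 2 (λ a b → a :* a :* (a :- b) := a :* a :* a :- a :* a :* b) refl a b ⟩
        a * a * a - a * a * b ≈⟨ +-cong a³≈b³ (-‿cong (*-congʳ a²≈b²)) ⟩
        b * b * b - b * b * b ≈⟨ -‿inverseʳ _ ⟩
        0# ∎))

    cusp-surjective : ∀ A B → disc (A , B) ≈ 0# → ∃ λ a → (A , B) ≡ cusp a
    cusp-surjective A B e = case (A ≟ 0#)
      where
      case : Dec (A ≈ 0#) → ∃ λ a → (A , B) ≡ cusp a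
      case (yes A≈0) = 0# , ≡.cong₂ _,_ (≈⇒≡ (trans A≈0 (solve 1 (λ z → con (ℤ.+ 0) := :- (con (ℤ.+ 3) :* (con (ℤ.+ 0) :* con (ℤ.+ 0)))) refl A)))
          (≈⇒≡ (trans B≈0 (solve 1 (λ z → con (ℤ.+ 0) := con (ℤ.+ 2) :* (con (ℤ.+ 0) :* con (ℤ.+ 0) :* con (ℤ.+ 0))) refl A)))
        where
        B≈0 : B ≈ 0#
        B≈0 = square-0 (*-cancel-0 27≉0 (begin⟨ setoid ⟩
          ι 27 * (B * B) ≈⟨ solve 3 (λ k a b → b := (k :* (a :* con (ℤ.+ 0) :* con (ℤ.+ 0)) :+ b)) refl (ι 4) A (ι 27 * (B * B)) ⟩
          ι 4 * (A * 0# * 0#) + ι 27 * (B * B) ≈⟨ +-congʳ (*-congˡ (*-cong (*-congˡ (sym A≈0)) (sym A≈0))) ⟩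
          disc (A , B) ≈⟨ e ⟩
          0# ∎))
      case (no A≉0) = a , ≡.cong₂ _,_ (≈⇒≡ A≈) (≈⇒≡ B≈)
        where
        2A≉0 = *≉0 2≉0 A≉0
        i = inv (ι 2 * A) 2A≉0
        -- The double root of a singular `x³ + A x + B` with `A ≠ 0` is `-3B / (2A)`. Multiplying by
        -- powers of `2 A i = 1` makes both identities hold up to a multiple of the discriminant.
        a = - (ι 3 * B * i)
        2Ai : ι 2 * A * i ≈ 1#
        2Ai = *-inv (ι 2 * A) 2A≉0
        A≈ : A ≈ - (ι 3 * (a * a))
        A≈ = begin⟨ setoid ⟩
          A ≈⟨ solve 1 (λ A → A := A :* (A :^ 0) :* (A :^ 0)) refl A ⟩
          A * 1# * 1# ≈⟨ *-cong (*-congˡ 2Ai) 2Ai ⟨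
          A * (ι 2 * A * i) * (ι 2 * A * i)
            ≈⟨ solve 3 (λ A B i → A :* (con (ℤ.+ 2) :* A :* i) :* (con (ℤ.+ 2) :* A :* i) :=
                 :- (con (ℤ.+ 3) :* ((:- (con (ℤ.+ 3) :* B :* i)) :* (:- (con (ℤ.+ 3) :* B :* i)))) :+ i :* i :* (con (ℤ.+ 4) :* (A :* A :* A) :+ con (ℤ.+ 27) :* (B :* B))) refl A B i ⟩
          - (ι 3 * (a * a)) + i * i * disc (A , B) ≈⟨ trans (+-congˡ (trans (*-congˡ e) (zeroʳ _))) (+-identityʳ _) ⟩
          - (ι 3 * (a * a)) ∎
        B≈ : B ≈ ι 2 * (a * a * a)
        B≈ = begin⟨ setoid ⟩
          B ≈⟨ solve 1 (λ B → B := B :* (B :^ 0) :* (B :^ 0) :* (B :^ 0)) refl B ⟩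
          B * 1# * 1# * 1# ≈⟨ *-cong (*-cong (*-congˡ 2Ai) 2Ai) 2Ai ⟨
          B * (ι 2 * A * i) * (ι 2 * A * i) * (ι 2 * A * i)
            ≈⟨ solve 3 (λ A B i → let a = :- (con (ℤ.+ 3) :* B :* i) in B :* (con (ℤ.+ 2) :* A :* i) :* (con (ℤ.+ 2) :* A :* i) :* (con (ℤ.+ 2) :* A :* i) :=
                 con (ℤ.+ 2) :* (a :* a :* a) :+ con (ℤ.+ 2) :* B :* i :* i :* i :* (con (ℤ.+ 4) :* (A :* A :* A) :+ con (ℤ.+ 27) :* (B :* B))) refl A B i ⟩
          ι 2 * (a * a * a) + ι 2 * B * i * i * i * disc (A , B) ≈⟨ trans (+-congˡ (trans (*-congˡ e) (zeroʳ _))) (+-identityʳ _) ⟩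
          ι 2 * (a * a * a) ∎

  -- The map `cusp` is a bijection from the field onto the singular pairs.
  count-singular : length (filter (λ AB → disc AB ≟ 0#) (cartesianProduct elements elements)) ≡ length elements
  count-singular = ≡.trans (↭-length (unique-↭ (UniqueP.filter⁺ singular? (UniqueP.cartesianProduct⁺ unique unique)) (UniqueP.map⁺ cusp-injective unique)
      (λ { {A , B} AB∈ → let a , e = cusp-surjective A B (proj₂ (∈-filter⁻ singular? {xs = cartesianProduct elements elements} AB∈)) in
            ≡.subst (_∈ map cusp elements) (≡.sym e) (∈-map⁺ cusp (complete a)) })
      (λ {AB} AB∈ → let a , _ , e = ∈-map⁻ cusp AB∈ in
            ∈-filter⁺ singular? (∈-cartesianProduct⁺ (complete _) (complete _)) (trans (reflexive (≡.cong disc e)) (disc-cusp a)))))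
    (ListP.length-map cusp elements)
    where
    singular? : Decidable (λ AB → disc AB ≈ 0#)
    singular? AB = disc AB ≟ 0#

-- Norms of Hasse invariants, summed over the columns

module _ {A : Set} (N : A → ℕ) {c X : ℕ} where
  fold-upper : ∀ xs → (∀ x → x ∈ xs → N x ≤ c ℕ.+ X) → ℕSum.fold xs N ≤ length xs ℕ.* (c ℕ.+ X)
  fold-upper [] _ = z≤n
  fold-upper (x ∷ xs) b = ℕP.+-mono-≤ (b x (here ≡.refl)) (fold-upper xs (λ y y∈ → b y (there y∈)))

  fold-lower : ∀ xs → (∀ x → x ∈ xs → c ≤ N x ℕ.+ X) → length xs ℕ.* c ≤ ℕSum.fold xs N ℕ.+ length xs ℕ.* X
  fold-lower [] _ = z≤n
  fold-lower (x ∷ xs) b = ℕP.≤-trans (ℕP.+-mono-≤ (b x (here ≡.refl)) (fold-lower xs (λ y y∈ → b y (there y∈))))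
    (ℕP.≤-reflexive (regroup (N x) X (ℕSum.fold xs N) (length xs ℕ.* X)))
    where
    regroup : ∀ a b c d → (a ℕ.+ b) ℕ.+ (c ℕ.+ d) ≡ (a ℕ.+ c) ℕ.+ (b ℕ.+ d)
    regroup a b c d = ℕSolver.solve (a ∷ b ∷ c ∷ d ∷ [])

module Family (R : CommutativeRing 0ℓ 0ℓ) (isField : IsDiscreteField R)
  {elements : List (CommutativeRing.Carrier R)} (unique : Unique elements) (complete : ∀ x → x ∈ elements)
  (N k : ℕ) (pr : Prime (suc (suc (suc N) ℕ.+ suc (suc N)))) (order : length elements ≡ suc (suc (suc N) ℕ.+ suc (suc N)) ℕ.^ k) (1≤k : 1 ≤ k) where
  open RingTheory R
  open PolyTheory R
  open FieldTheory R isField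
  private
    n m m′ p q : ℕ
    n = suc (suc N)
    m = n ℕ.+ n
    m′ = suc N ℕ.+ n
    p = suc m
    q = p ℕ.^ k
    module Ex = Exponents n
  open FiniteFieldTheory R isField unique complete {p} {k} pr order
  open PowerSums R isField unique complete {p} {k} pr order

  c : ℕ
  c = Ex.c k

  H : Carrier → Carrier → Carrier
  H A B = coeff (Cubic.cubic R A B P.^ n) (n ℕ.+ n)

  1+mc≡q : suc (m ℕ.* c) ≡ q
  1+mc≡q = ≡.trans (≡.cong suc (≡.sym (Ex.Q≡mc k))) (Ex.1+Q≡p^ k)

  1≤c : 1 ≤ c
  1≤c = go k 1≤k
    where
    go : ∀ k → 1 ≤ k → 1 ≤ Ex.c k
    go (suc k) _ = s≤s z≤n

  4≤m : 4 ≤ m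
  4≤m = ℕP.+-mono-≤ {2} {n} (s≤s (s≤s z≤n)) (s≤s (s≤s z≤n))

  private
    Q≡mc : Q ≡ m ℕ.* c
    Q≡mc = ℕP.suc-injective (≡.trans 1+Q≡q (≡.sym 1+mc≡q))

    Q≡Qₑ : Q ≡ Ex.Qₑ k
    Q≡Qₑ = ≡.trans Q≡mc (≡.sym (Ex.Q≡mc k))

    h = Ex.h k

    h+h≡Q : h ℕ.+ h ≡ Q
    h+h≡Q = ≡.trans (Ex.h+h≡Q k) (≡.sym Q≡Qₑ)

    0<Q : 0 < Q
    0<Q = ≡.subst (0 <_) (≡.sym Q≡mc) (ℕP.*-mono-≤ {1} {m} (s≤s z≤n) 1≤c)

  trace-norm : ∀ A B {P : Pred (Carrier × Carrier) 0ℓ} (P? : Decidable P) →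
    (∀ x y → P (x , y) → y * y ≈ x * x * x + A * x + B) → (∀ x y → y * y ≈ x * x * x + A * x + B → P (x , y)) →
    ι (length (filter P? (cartesianProduct elements elements))) ≈ - (H A B ^ c)
  trace-norm A B P? to from = begin⟨ setoid ⟩
    ι (length (filter P? (cartesianProduct elements elements))) ≈⟨ points-mod-p 0<Q h h+h≡Q (λ x → x * x * x + A * x + B) P? to from ⟩
    Σ (λ x → (x * x * x + A * x + B) ^ h) ≈⟨ Sum.fold-cong elements (λ x _ → trans (Hom.^-homo (At.ev-hom x) cubic h) (^-congˡ h (eval-cubic x))) ⟨
    Σ (λ x → eval x (cubic P.^ h)) ≈⟨ Σ-eval 0<Q (cubic P.^ h) (≺-mono degree≤ (≺-^ 3 h (Cubic.cubic≺ R A B))) ⟩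
    - coeff (cubic P.^ h) Q ≈⟨ -‿cong (trans (reflexive (≡.cong (coeff (cubic P.^ h)) Q≡Qₑ)) (coeff-power R n pr ι-p cubic (Cubic.cubic≺ R A B) k)) ⟩
    - (H A B ^ c) ∎
    where
    cubic = Cubic.cubic R A B
    eval-cubic : ∀ x → eval x cubic ≈ x * x * x + A * x + B
    eval-cubic x = solve 3 (λ x a b → b :+ x :* (a :+ x :* (con (ℤ.+ 0) :+ x :* (x :^ 0 :+ x :* con (ℤ.+ 0)))) := x :* x :* x :+ a :* x :+ b) refl x A B
    -- The degree `3 h` stays below `2 Q = 4 h`, so only the exponent `Q` contributes to the sum
    -- over the field.
    degree≤ : suc (h ℕ.* 3) ≤ Q ℕ.+ Q
    degree≤ = ≡.subst (suc (h ℕ.* 3) ≤_) (≡.trans (lemma h) (≡.cong₂ ℕ._+_ h+h≡Q h+h≡Q)) (ℕP.+-monoˡ-≤ (h ℕ.* 3) 1≤h)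
      where
      lemma : ∀ h → h ℕ.+ h ℕ.* 3 ≡ (h ℕ.+ h) ℕ.+ (h ℕ.+ h)
      lemma h = ℕSolver.solve (h ∷ [])
      1≤h : 1 ≤ h
      1≤h = ℕP.n≢0⇒n>0 λ h≡0 → ℕP.<⇒≢ 0<Q (≡.trans (≡.cong (λ h → h ℕ.+ h) (≡.sym h≡0)) h+h≡Q)

  module Total (t : Carrier) (t^m≈1 : t ^ m ≈ 1#) (s : ℕ) (s²≤q : s ℕ.* s ≤ q) (q<s² : q < suc s ℕ.* suc s) where
    private
      err : ℕ
      err = 2 ℕ.* p ℕ.* s ℕ.+ p

    norm? : (AB : Carrier × Carrier) → Dec (H (proj₁ AB) (proj₂ AB) ^ c ≈ t)
    norm? AB = H (proj₁ AB) (proj₂ AB) ^ c ≈? t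

    M : ℕ
    M = length (filter norm? (cartesianProduct elements elements))

    private
      module _ {g : Carrier → Carrier} {f δ} (deg : HasDegree f (suc δ)) (cop : Coprime f (D f)) (4d≤m : 4 ℕ.* suc δ ≤ m) (f≈g : ∀ x → eval x f ≈ g x) where
        private
          module Dev = Column.Deviation R isField unique complete m′ k c pr order 1+mc≡q 1≤c 4≤m deg cop 4d≤m t t^m≈1 s s²≤q q<s²

        column-upper : length (filter (λ x → g x ^ c ≈? t) elements) ≤ c ℕ.+ err
        column-upper = ℕP.≤-trans (length-filter-mono (λ x → g x ^ c ≈? t) (λ x → eval x f ^ c ≈? t) (λ x e → trans (^-congˡ c (f≈g x)) e) elements) Dev.upper

        column-lower : c ≤ length (filter (λ x → g x ^ c ≈? t) elements) ℕ.+ err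
        column-lower = ℕP.≤-trans Dev.lower (ℕP.+-monoˡ-≤ err (length-filter-mono (λ x → eval x f ^ c ≈? t) (λ x → g x ^ c ≈? t) (λ x e → trans (^-congˡ c (sym (f≈g x))) e) elements))

      module _ (F : Carrier → ℕ) (upper : ∀ a → ¬ a ≈ 0# → F a ≤ c ℕ.+ err) (lower : ∀ a → ¬ a ≈ 0# → c ≤ F a ℕ.+ err) (F≤q : ∀ a → F a ≤ q) where
        -- The column over 0 is estimated trivially, by `q` from above and by 0 from below.
        fold-bounds : (ℕSum.fold elements F ≤ q ℕ.+ Q ℕ.* (c ℕ.+ err)) × (Q ℕ.* c ≤ ℕSum.fold elements F ℕ.+ Q ℕ.* err)
        fold-bounds = ℕP.≤-trans (ℕP.≤-reflexive (ℕSum.fold-↭ F elements-↭)) (ℕP.+-mono-≤ (F≤q 0#) (fold-upper F {c} {err} nonzero (λ x x∈ → upper x (nonzero⁻ x∈))))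
                    , ℕP.≤-trans (fold-lower F {c} {err} nonzero (λ x x∈ → lower x (nonzero⁻ x∈)))
                        (ℕP.+-monoˡ-≤ (Q ℕ.* err) (ℕP.≤-trans (ℕP.m≤n+m _ (F 0#)) (ℕP.≤-reflexive (≡.sym (ℕSum.fold-↭ F elements-↭)))))

      length-filter≤q : ∀ {P : Pred Carrier 0ℓ} (P? : Decidable P) → length (filter P? elements) ≤ q
      length-filter≤q P? = ℕP.≤-trans (ListP.length-filter P? elements) (ℕP.≤-reflexive order)

    -- For p = 5 the Hasse invariant is 2A, so the columns are taken along A; otherwise along B.
    bounds : ∀ N′ → N ≡ N′ → (M ≤ q ℕ.+ Q ℕ.* (c ℕ.+ err)) × (Q ℕ.* c ≤ M ℕ.+ Q ℕ.* err)
    bounds (suc N₁) N≡ = ≡.subst (λ M → (M ≤ q ℕ.+ Q ℕ.* (c ℕ.+ err)) × (Q ℕ.* c ≤ M ℕ.+ Q ℕ.* err)) (≡.sym (count-columns norm? elements elements))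
      (fold-bounds (λ A → length (filter (λ B → norm? (A , B)) elements)) (λ A A≉0 → proj₁ (column A A≉0)) (λ A A≉0 → proj₂ (column A A≉0)) (λ A → length-filter≤q (λ B → norm? (A , B))))
      where
      1≤N : 1 ≤ N
      1≤N = ≡.subst (1 ≤_) (≡.sym N≡) (s≤s z≤n)
      column : ∀ A → ¬ A ≈ 0# → (length (filter (λ B → norm? (A , B)) elements) ≤ c ℕ.+ err) × (c ≤ length (filter (λ B → norm? (A , B)) elements) ℕ.+ err)
      column A A≉0 = let δ , deg , cop , 3d≤n = HasseSeparable.hasse-separable R isField N ι-p ι≉0 1≤N A A≉0
                         4d≤m = 4d δ 3d≤n
                         e = λ B → HasseFamily.eval-hasse R A B n (n ℕ.+ n)
                     in column-upper {H A} deg cop 4d≤m e , column-lower {H A} deg cop 4d≤m e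
        where
        4d : ∀ δ → 3 ℕ.* suc δ ≤ n → 4 ℕ.* suc δ ≤ m
        4d δ le = ℕP.≤-trans (ℕP.*-monoˡ-≤ (suc δ) {4} {6} (s≤s (s≤s (s≤s (s≤s z≤n))))) (ℕP.≤-trans (ℕP.≤-reflexive (lemma (suc δ))) (ℕP.+-mono-≤ le le))
          where
          lemma : ∀ d → 6 ℕ.* d ≡ 3 ℕ.* d ℕ.+ 3 ℕ.* d
          lemma d = ℕSolver.solve (d ∷ [])
    bounds zero N≡ = ≡.subst (λ M → (M ≤ q ℕ.+ Q ℕ.* (c ℕ.+ err)) × (Q ℕ.* c ≤ M ℕ.+ Q ℕ.* err))
        (≡.sym (≡.trans (count-columns norm? elements elements) (swap-columns norm? elements elements)))
      (fold-bounds (λ B → length (filter (λ A → norm? (A , B)) elements)) (λ B _ → column-upper {λ A → H A B} deg₂ cop₂ 4≤m (e B)) (λ B _ → column-lower {λ A → H A B} deg₂ cop₂ 4≤m (e B)) (λ B → length-filter≤q (λ A → norm? (A , B))))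
      where
      f₂ : Poly
      f₂ = 0# ∷ ι 2 ∷ []
      2≉0 : ¬ ι 2 ≈ 0#
      2≉0 = ι≉0 2 (s≤s z≤n) (s≤s (ℕP.≤-trans (ℕP.m≤n+m 2 2) 4≤m))
      deg₂ : HasDegree f₂ 1
      deg₂ = ≺-length f₂ , 2≉0
      Df₂ : D f₂ ≋ C (ι 2)
      Df₂ = ext λ { zero → trans (coeff-D f₂ 0) (trans (*-congʳ (+-identityʳ 1#)) (*-identityˡ _)) ; (suc i) → trans (coeff-D f₂ (suc i)) (zeroʳ _) }
      cop₂ : Coprime f₂ (D f₂)
      cop₂ = P.0# , C (inv (ι 2) 2≉0) , P.trans (P.+-cong (P.zeroˡ f₂) (P.trans (P.*-congˡ Df₂) (P.trans (P.sym (Hom.*-homo C-hom _ _)) (Hom.cong C-hom (trans (*-comm _ _) (*-inv (ι 2) 2≉0)))))) (P.+-identityˡ _)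
      H₂ : ∀ A B → coeff (Cubic.cubic R A B P.^ 2) 4 ≈ ι 2 * A
      H₂ A B = trans (at (P.*-congˡ (P.*-identityʳ cubic)) 4) (trans (coeff-⊛ cubic cubic 4)
        (solve 2 (λ a b → b :* con (ℤ.+ 0) :+ (a :* b :^ 0 :+ (con (ℤ.+ 0) :* con (ℤ.+ 0) :+ (b :^ 0 :* a :+ con (ℤ.+ 0) :* b))) := con (ℤ.+ 2) :* a) refl A B))
        where cubic = Cubic.cubic R A B
      e : ∀ B A → eval A f₂ ≈ H A B
      e B A = trans (solve 2 (λ a t → con (ℤ.+ 0) :+ a :* (t :+ a :* con (ℤ.+ 0)) := t :* a) refl A (ι 2)) (sym (trans (reflexive (≡.cong (λ N → coeff (Cubic.cubic R A B P.^ suc (suc N)) (suc (suc N) ℕ.+ suc (suc N))) N≡)) (H₂ A B)))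

-- Traces of Frobenius and the conclusion

open import Defs
open import Data.Integer using (∣_∣)

module _ (R : CommutativeRing 0ℓ 0ℓ) where
  open RingTheory R

  ι±≈0⇒ι∣∣≈0 : ∀ z → ι± z ≈ 0# → ι ∣ z ∣ ≈ 0#
  ι±≈0⇒ι∣∣≈0 (+ n) e = e
  ι±≈0⇒ι∣∣≈0 (-[1+ n ]) e = trans (sym (-‿involutive _)) (trans (-‿cong e) -0≈0)

  ι∣∣≈0⇒ι±≈0 : ∀ z → ι ∣ z ∣ ≈ 0# → ι± z ≈ 0#
  ι∣∣≈0⇒ι±≈0 (+ n) e = e
  ι∣∣≈0⇒ι±≈0 (-[1+ n ]) e = trans (-‿cong e) -0≈0

  ι±-trace : ∀ q a t {y} → ι q ≈ 0# → ι a ≈ - y → ι± ((+ suc q ℤ.- + suc a) ℤ.- + t) ≈ y - ι t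
  ι±-trace q a t {y} eq ea = begin⟨ setoid ⟩
    ι± ((+ suc q ℤ.- + suc a) ℤ.- + t) ≈⟨ trans (+-homo (+ suc q ℤ.- + suc a) (ℤ.- + t)) (+-cong (trans (+-homo (+ suc q) (ℤ.- + suc a)) (+-congˡ (-‿homo (+ suc a)))) (-‿homo (+ t))) ⟩
    (1# + ι q) - (1# + ι a) - ι t ≈⟨ +-congʳ (+-cong (+-congˡ eq) (-‿cong (+-congˡ ea))) ⟩
    (1# + 0#) - (1# - y) - ι t ≈⟨ solve 2 (λ y t → (y :^ 0 :+ con (+ 0)) :- (y :^ 0 :- y) :- t := y :- t) refl y (ι t) ⟩
    y - ι t ∎
    where open _-Raw-AlmostCommutative⟶_ ι±-hom using (+-homo; -‿homo)

  fermat : ∀ {p} → Prime p → CharP p → ∀ t → ι t ^ p ≈ ι t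
  fermat {suc p} pr ch zero = 0^ {suc p} (s≤s z≤n)
  fermat {p} pr ch (suc t) = trans (Frobenius.frobenius-+ R pr ch 1# (ι t)) (+-cong (1^ p) (fermat {p} pr ch t))

fieldRing : FiniteField → CommutativeRing 0ℓ 0ℓ
fieldRing F = record { isCommutativeRing = FiniteField.isCommutativeRing F }

isDiscreteField : ∀ F → IsDiscreteField (fieldRing F)
isDiscreteField F = record { ≈⇒≡ = id ; _≟_ = FiniteField._≟_ F ; 0≉1 = FiniteField.0≢1 F ; inverse = FiniteField.inverse F }

module Main (N k t : ℕ) (pr : Prime (suc (suc (suc N) ℕ.+ suc (suc N)))) (1≤k : 1 ≤ k) (1≤t : 1 ≤ t) (t<p : t < suc (suc (suc N) ℕ.+ suc (suc N)))
  (F : FiniteField) (order≡ : order F ≡ suc (suc (suc N) ℕ.+ suc (suc N)) ℕ.^ k) where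
  open FiniteField F using (elements; elements-unique; elements-complete; _≟_)
  private
    R = fieldRing F
    isField = isDiscreteField F
    m p q : ℕ
    m = suc (suc N) ℕ.+ suc (suc N)
    p = suc m
    q = p ℕ.^ k
    module K = RingTheory R
    module Fam = Family R isField elements-unique elements-complete N k pr order≡ 1≤k
    module FF = FiniteFieldTheory R isField elements-unique elements-complete {p} {k} pr order≡
    module FT = FieldTheory R isField
    open K using (ι; ι±)

    pairs : List (K.Carrier × K.Carrier)
    pairs = cartesianProduct elements elements

    5≤p : 5 ≤ p
    5≤p = s≤s Fam.4≤m

    fromℕ≡ι : ∀ j → fromℕ F j ≡ ι j
    fromℕ≡ι zero = ≡.refl
    fromℕ≡ι (suc j) = ≡.cong (K._+_ K.1#) (fromℕ≡ι j)

    module Sing = Singular R isField elements-unique elements-complete (FF.ι≉0 2 (s≤s z≤n) (ℕP.≤-trans (ℕP.m≤n+m 3 2) 5≤p)) (FF.ι≉0 3 (s≤s z≤n) (ℕP.≤-trans (ℕP.n≤1+n 4) 5≤p))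

    singular? : Decidable (λ (AB : K.Carrier × K.Carrier) → disc F (proj₁ AB) (proj₂ AB) ≡ K.0#)
    singular? AB = disc F (proj₁ AB) (proj₂ AB) ≟ K.0#

    disc≡ : ∀ AB → disc F (proj₁ AB) (proj₂ AB) ≡ Sing.disc AB
    disc≡ (A , B) = ≡.cong₂ K._+_ (≡.cong (K._* _) (fromℕ≡ι 4)) (≡.cong (K._* _) (fromℕ≡ι 27))

    count-singular : length (filter singular? pairs) ≡ q
    count-singular = ≡.trans (ℕP.≤-antisym
        (length-filter-mono singular? (λ AB → Sing.disc AB ≟ K.0#) (λ AB e → ≡.trans (≡.sym (disc≡ AB)) e) pairs)
        (length-filter-mono (λ AB → Sing.disc AB ≟ K.0#) singular? (λ AB e → ≡.trans (disc≡ AB) e) pairs))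
      (≡.trans Sing.count-singular order≡)

    S+q : #S F ℕ.+ q ≡ q ℕ.* q
    S+q = ≡.trans (ℕP.+-comm (#S F) q) (≡.trans (≡.cong (ℕ._+ #S F) (≡.sym count-singular)) (≡.trans (length-filter-complement singular? (nonsingular? F) pairs)
      (≡.trans (length-cartesianProduct elements elements) (≡.cong₂ ℕ._*_ order≡ order≡))))

    τ : K.Carrier
    τ = ι t

    τ^m : τ K.^ m ≡ K.1#
    τ^m = K.x-y≈0⇒x≈y (FT.*-cancel-0 (FF.ι≉0 t 1≤t t<p) (K.trans (K.solve 2 (λ x y → x K.:* (y K.:- x K.:^ 0) K.:= x K.:* y K.:- x) K.refl τ (τ K.^ m))
      (K.x≈y⇒x-y≈0 (fermat R pr FF.ι-p t))))

    affine : ∀ A B → ι (affineCount F A B) ≡ K.- (Fam.H A B K.^ Fam.c)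
    affine A B = Fam.trace-norm A B _ (λ x y e → e) (λ x y e → e)

    ι-trace : ∀ A B → ι± (trace F A B ℤ.- + t) ≡ Fam.H A B K.^ Fam.c K.- τ
    ι-trace A B = ι±-trace R (order F) (affineCount F A B) t (≡.trans (≡.cong ι order≡) FF.ι-q) (affine A B)

    TraceCong : K.Carrier × K.Carrier → Set
    TraceCong AB = (+ p) ℤD.∣ (trace F (proj₁ AB) (proj₂ AB) ℤ.- + t)

    trace⇒norm : ∀ AB → TraceCong AB → Fam.H (proj₁ AB) (proj₂ AB) K.^ Fam.c ≡ τ
    trace⇒norm (A , B) d = K.x-y≈0⇒x≈y (≡.trans (≡.sym (ι-trace A B)) (ι∣∣≈0⇒ι±≈0 R (trace F A B ℤ.- + t) (K.char-∣ FF.ι-p d)))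

    norm⇒trace : ∀ AB → Fam.H (proj₁ AB) (proj₂ AB) K.^ Fam.c ≡ τ → TraceCong AB
    norm⇒trace (A , B) e = FF.ι≈0⇒∣ ∣ trace F A B ℤ.- + t ∣ (ι±≈0⇒ι∣∣≈0 R (trace F A B ℤ.- + t) (≡.trans (ι-trace A B) (K.x≈y⇒x-y≈0 e)))

    s : ℕ
    s = proj₁ (Arithmetic.square-root q)
    s²≤q = proj₁ (proj₂ (Arithmetic.square-root q))
    q<s² = proj₂ (proj₂ (Arithmetic.square-root q))

    module Tot = Fam.Total τ τ^m s s²≤q q<s²

    2≤s : 2 ≤ s
    2≤s = Arithmetic.square-cancel (ℕP.≤-<-trans (ℕP.≤-trans (ℕP.≤-trans (ℕP.n≤1+n 4) 5≤p) (ℕP.≤-trans (ℕP.≤-reflexive (≡.sym (ℕP.*-identityʳ p))) (ℕP.^-monoʳ-≤ p 1≤k))) q<s²)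

    both? : Decidable (λ AB → (¬ disc F (proj₁ AB) (proj₂ AB) ≡ K.0#) × TraceCong AB)
    both? AB = nonsingular? F AB ×-dec traceCong? F p t AB

    St≡ : #S[_,_] F p t ≡ length (filter both? pairs)
    St≡ = length-filter-filter (nonsingular? F) (traceCong? F p t) pairs

    St≤M : #S[_,_] F p t ≤ Tot.M
    St≤M = ≡.subst (_≤ Tot.M) (≡.sym St≡) (length-filter-mono both? Tot.norm? (λ AB b → trace⇒norm AB (proj₂ b)) pairs)

    -- A pair of norm `t` either belongs to `S_t` or is one of the `q` singular pairs.
    M≤St+q : Tot.M ≤ #S[_,_] F p t ℕ.+ q
    M≤St+q = ≡.subst₂ (λ a b → Tot.M ≤ a ℕ.+ b) (≡.sym St≡) count-singular
      (length-filter-∪ Tot.norm? both? singular? (λ AB e → split (singular? AB) (norm⇒trace AB e)) pairs)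
      where
      split : ∀ {P Q : Set} → Dec P → Q → (¬ P × Q) ⊎ P
      split (yes p) _ = inj₂ p
      split (no ¬p) q = inj₁ (¬p , q)

  count-S : #S F ≡ p ℕ.^ (2 ℕ.* k) ∸ p ℕ.^ k
  count-S = ≡.trans (≡.sym (ℕP.m+n∸n≡m (#S F) q)) (≡.cong (_∸ q) (≡.trans S+q (≡.trans (≡.cong (q ℕ.*_) (≡.sym (ℕP.*-identityʳ q)))
    (≡.trans (ℕP.^-*-assoc p k 2) (≡.cong (p ℕ.^_) (ℕP.*-comm k 2))))))

  deviation : ∣ + m ℤ.* + #S[_,_] F p t ℤ.- + #S F ∣ ℕ.^ 2 ≤ 9 ℕ.* m ℕ.^ 2 ℕ.* p ℕ.^ (3 ℕ.* k ℕ.+ 2)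
  deviation = Numerics.deviation-bound m Fam.c k s (#S[_,_] F p t) Tot.M (#S F) FF.Q (ℕP.≤-trans (s≤s (s≤s z≤n)) 5≤p) 2≤s s²≤q FF.1+Q≡q Fam.1+mc≡q S+q St≤M M≤St+q
    (proj₁ (Tot.bounds N ≡.refl)) (proj₂ (Tot.bounds N ≡.refl))

-- Writing `p = 2 n + 1` with `n = N + 2` provides the exponents `n`, `n - 1` and `n - 2` of the
-- Picard-Fuchs equation without subtraction.
odd-prime : ∀ {p} → Prime p → 5 ≤ p → ∃ λ N → p ≡ suc (suc (suc N) ℕ.+ suc (suc N))
odd-prime {p} pr 5≤p = go (Arithmetic.parity p)
  where
  2∤p : ¬ 2 ∣ⁿ p
  2∤p d with prime⇒irreducible pr d
  ... | inj₁ ()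
  ... | inj₂ ≡.refl = ℕP.<⇒≱ (s≤s (s≤s (s≤s z≤n))) 5≤p
  go : (∃ λ j → p ≡ j ℕ.+ j ⊎ p ≡ suc (j ℕ.+ j)) → ∃ λ N → p ≡ suc (suc (suc N) ℕ.+ suc (suc N))
  go (j , inj₁ e) = ⊥-elim (2∤p (ℕD.divides j (≡.trans e (≡.trans (≡.cong (j ℕ.+_) (≡.sym (ℕP.+-identityʳ j))) (ℕP.*-comm 2 j)))))
  go (suc (suc N) , inj₂ e) = N , e
  go (zero , inj₂ e) = ⊥-elim (ℕP.<⇒≱ (s≤s (s≤s z≤n)) (≡.subst (5 ≤_) e 5≤p))
  go (suc zero , inj₂ e) = ⊥-elim (ℕP.<⇒≱ (s≤s (s≤s (s≤s (s≤s z≤n)))) (≡.subst (5 ≤_) e 5≤p))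

open import Data.Nat using (_*_; _^_; _+_)

theorem11 : (p k t : ℕ) → Prime p → 5 ≤ p → 1 ≤ k → 1 ≤ t → t < p →
    (F : FiniteField) → order F ≡ p ^ k →
    (#S F ≡ p ^ (2 * k) ∸ p ^ k)
    × (∣ (+ (p ∸ 1)) ℤ.* (+ #S[_,_] F p t) ℤ.- + (#S F) ∣ ^ 2
        ≤ 9 * (p ∸ 1) ^ 2 * p ^ (3 * k + 2))
theorem11 p k t pr 5≤p 1≤k 1≤t t<p F order≡ with odd-prime pr 5≤p
... | N , ≡.refl = Main.count-S N k t pr 1≤k 1≤t t<p F order≡ , Main.deviation N k t pr 1≤k 1≤t t<p F order≡
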